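{- For each $\varepsilon > 0$ there is a $K$ such that for $p \ge K/\sqrt{n}$, \[ \Pr\big(G_{n,p} \text{ contains the square of a Hamilton cycle}\big) \ge 1 - \varepsilon \] for all sufficiently large $n$.
   Context: $G_{n,p}$ is the binomial random graph on vertex set $\{1,\dots,n\}$ in which each of the $\binom n2$ possible edges is present independently with probability $p$. The square of a graph $G$ is the graph on $V(G)$ in which two vertices are adjacent iff their distance in $G$ is at most $2$; the square of a Hamilton cycle of $K_n$ is the square of an $n$-vertex cycle on the vertex set of $K_n$. "$G_{n,p}$ contains the square of a Hamilton cycle" means some such graph is a subgraph of $G_{n,p}$.
   Formalization: The edge probability p and ε range over rational numbers instead of real numbers (K is likewise rational). -}

module Defs where

open import Data.Nat as ℕ using (ℕ; zero; suc)
open import Data.Nat.DivMod using (_%_; m%n<n)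
open import Data.Bool using (Bool; true; false; if_then_else_)
open import Data.Fin as Fin using (Fin; toℕ; fromℕ<)
open import Data.Fin.Permutation using (Permutation′; _⟨$⟩ʳ_)
open import Data.List as List using (List; []; _∷_; map; concatMap; filter; allFin; length; _++_)
open import Data.Vec as Vec using (Vec; []; _∷_)
open import Data.Product using (Σ; _×_; _,_)
open import Data.Sum using (_⊎_)
open import Data.Integer using (+_)
open import Data.Rational using (ℚ; 0ℚ; 1ℚ; _+_; _*_; _-_; _/_)
open import Relation.Binary.PropositionalEquality using (_≡_)
open import Relation.Nullary using (Dec; does)
open import Relation.Unary using (Decidable)

pairs : (n : ℕ) → List (Fin n × Fin n)
pairs n = concatMap (λ i → map (λ j → (i , j)) (filter (λ j → toℕ i ℕ.<? toℕ j) (allFin n))) (allFin n)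

-- A simple graph on vertex set Fin n: one Boolean per potential edge.
Graph : ℕ → Set
Graph n = Vec Bool (length (pairs n))

Adj : ∀ {n} → Graph n → Fin n → Fin n → Set
Adj {n} G i j = Σ (Fin (length (pairs n))) λ k →
  (Vec.lookup G k ≡ true) ×
  ((List.lookup (pairs n) k ≡ (i , j)) ⊎ (List.lookup (pairs n) k ≡ (j , i)))

shift : ∀ {n} → ℕ → Fin n → Fin n
shift {suc m} d i = fromℕ< (m%n<n (toℕ i ℕ.+ d) (suc m))

ContainsSqHamCycle : ∀ {n} → Graph n → Set
ContainsSqHamCycle {n} G = Σ (Permutation′ n) λ σ → ∀ i →
  Adj G (σ ⟨$⟩ʳ i) (σ ⟨$⟩ʳ shift 1 i) × Adj G (σ ⟨$⟩ʳ i) (σ ⟨$⟩ʳ shift 2 i)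

allBoolVecs : (m : ℕ) → List (Vec Bool m)
allBoolVecs zero = [] ∷ []
allBoolVecs (suc m) = map (true ∷_) (allBoolVecs m) ++ map (false ∷_) (allBoolVecs m)

weight : ∀ {m} → ℚ → Vec Bool m → ℚ
weight p [] = 1ℚ
weight p (b ∷ bs) = (if b then p else (1ℚ - p)) * weight p bs

Prob : (n : ℕ) → ℚ → (P : Graph n → Set) → Decidable P → ℚ
Prob n p P dec =
  List.foldr _+_ 0ℚ (map (λ G → if does (dec G) then weight p G else 0ℚ) (allBoolVecs (length (pairs n))))

ℕtoℚ : ℕ → ℚ
ℕtoℚ n = + n / 1

{-# OPTIONS --safe #-}
-- A random labelled squared cycle is "spread": a set of edges of a squared cycle with ℓ edges and c components lies in it with
-- probability at most C^ℓ n^(-(ℓ+c)/2). Hence for x of order δ √n and any subset F of a squared cycle, the average of (1+x)^|F ∩ S|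
-- over squared cycles S is at most (1 + O(δ)/√n)^|F|, up to a polynomial factor caused by edges across the cut of the cyclic order.
--
-- Expose the random graph in two rounds W, W′ of density about p/2. For a squared cycle S let the fragment of (S , W) be a
-- smallest set S′ ∖ W over squared cycles S′ ⊆ W ∪ S. Its union Z with W determines it up to a subset χ of one fixed squared
-- cycle inside Z, since by minimality every squared cycle in Z contains χ. As W is at most p^-|χ| times as likely as
-- Z = W ∪ χ, spreadness with |F| = O(n) makes fragments larger than √n exponentially rare. For the small fragments
-- spreadness with |F| ≤ √n bounds the variance of a weighted count of the fragments contained in W′, so one of them is covered.
module Submission where

open import Defs
open import Data.Bool using (Bool; _∧_; _∨_; false; if_then_else_; true)
open import Data.Product using (_,_; _×_; proj₁; proj₂; Σ; ∃)
open import Data.Sum using ([_,_]′; _⊎_; inj₁; inj₂)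
open import Function using (_∘_; id)
open import Relation.Binary.PropositionalEquality using (_≡_; _≢_; cong; cong₂; refl; subst; subst₂; sym; trans; module ≡-Reasoning)
open import Relation.Nullary using (Dec; _×-dec_; _⊎-dec_; contradiction; does; no; yes; ¬?; ¬_)
open import Relation.Nullary.Decidable using (dec-false; dec-true)

-- The probability that a set of edges lies in a random squared cycle is needed even for sets that
-- force almost all positions, when no constant fraction of the vertices is free to be moved. Links
-- are therefore removed from the top of the linear order downwards, each freeing one more vertex,
-- and the product of the resulting counts is compared with a power of `n` at a constant cost per
-- link.
--
-- The gain of one link per component comes from vertices with both back edges: such a vertex is
-- linked itself and forces the next lower vertex to be linked too. Without the second link, the two
-- edges would contribute `x * x * y` with `y` of order `1 / n`, a constant factor per vertex and
-- far too much over `n` vertices; the second link turns this into a term of order `x * y`.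
--
-- The polynomial factor from the cut is harmless against the exponential gain for large fragments
-- but fatal to the variance. For small edge sets the cut is therefore placed where it meets no edge
-- of the set.

-- Rational arithmetic, finite sums and expectation over random subsets.

module Expectation where

  open import Data.Nat as ℕ using (ℕ; zero; suc)
  import Data.Nat.Properties as ℕₚ
  open import Data.Integer using (+_)
  import Data.Integer.Properties as ℤₚ
  open import Data.List using (List; []; _∷_; map; length; foldr; _++_)
  open import Data.List.Membership.Propositional using (_∈_)
  open import Data.List.Relation.Unary.Any using (here; there)
  open import Data.Maybe using (Maybe; just; nothing)
  open import Data.Vec using (Vec; []; _∷_)
  open import Data.Rational using (ℚ; 0ℚ; 1ℚ; _+_; _*_; _-_; -_; _<_; nonNegative; positive; toℚᵘ) renaming (_≤_ to _≤ℚ_)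
  open import Data.Rational.Properties using (+-*-commutativeRing; module ≤-Reasoning; ≤-refl; ≤-trans; ≤-reflexive; <⇒≤; ≰⇒>; <-≤-trans; ≤-<-trans; <-irrefl; +-mono-≤; +-monoʳ-≤; +-monoˡ-≤; *-monoʳ-≤-nonNeg; *-monoˡ-≤-nonNeg; *-cancelˡ-≤-pos; *-monoˡ-<-pos; _≟_; _≤?_; *-zeroˡ; *-zeroʳ; *-identityˡ; *-identityʳ; +-identityˡ; +-identityʳ; *-comm; *-assoc; +-assoc; *-distribˡ-+; neg-antimono-≤; toℚᵘ-injective; toℚᵘ-homo-+; toℚᵘ-fromℚᵘ; +-inverseʳ; nonNegative⁻¹; ≤-total; positive⁻¹; pos*pos⇒pos)
  import Data.Rational.Unnormalised as ℚᵘ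
  import Data.Rational.Unnormalised.Properties as ℚᵘₚ
  open import Tactic.RingSolver using (solve-∀)
  open import Tactic.RingSolver.Core.AlmostCommutativeRing using (AlmostCommutativeRing; fromCommutativeRing)
  open import Relation.Unary using (Decidable)

  private variable
    A B : Set

  ℚ-ring : AlmostCommutativeRing _ _
  ℚ-ring = fromCommutativeRing +-*-commutativeRing 0?
    where
    0? : ∀ x → Maybe (0ℚ ≡ x)
    0? x with 0ℚ ≟ x
    ... | yes e = just e
    ... | no  _ = nothing

  *-monoʳ : ∀ {a b c} → 0ℚ ≤ℚ c → a ≤ℚ b → a * c ≤ℚ b * c
  *-monoʳ {c = c} 0≤c = *-monoʳ-≤-nonNeg c {{nonNegative 0≤c}}

  *-monoˡ : ∀ {a b c} → 0ℚ ≤ℚ c → a ≤ℚ b → c * a ≤ℚ c * b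
  *-monoˡ {c = c} 0≤c = *-monoˡ-≤-nonNeg c {{nonNegative 0≤c}}

  *-mono : ∀ {a b c d} → 0ℚ ≤ℚ b → 0ℚ ≤ℚ c → a ≤ℚ b → c ≤ℚ d → a * c ≤ℚ b * d
  *-mono 0≤b 0≤c a≤b c≤d = ≤-trans (*-monoʳ 0≤c a≤b) (*-monoˡ 0≤b c≤d)

  0≤* : ∀ {a b} → 0ℚ ≤ℚ a → 0ℚ ≤ℚ b → 0ℚ ≤ℚ a * b
  0≤* {a} {b} 0≤a 0≤b = subst (_≤ℚ a * b) (*-zeroˡ b) (*-monoʳ 0≤b 0≤a)

  0≤+ : ∀ {a b} → 0ℚ ≤ℚ a → 0ℚ ≤ℚ b → 0ℚ ≤ℚ a + b
  0≤+ {a} {b} 0≤a 0≤b = subst (_≤ℚ a + b) (+-identityˡ 0ℚ) (+-mono-≤ 0≤a 0≤b)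

  0≤1 : 0ℚ ≤ℚ 1ℚ
  0≤1 = nonNegative⁻¹ 1ℚ

  x≤x+ : ∀ {x y} → 0ℚ ≤ℚ y → x ≤ℚ x + y
  x≤x+ {x} {y} 0≤y = subst (_≤ℚ x + y) (+-identityʳ x) (+-monoʳ-≤ x 0≤y)

  x≤+x : ∀ {x y} → 0ℚ ≤ℚ y → x ≤ℚ y + x
  x≤+x {x} {y} 0≤y = subst (_≤ℚ y + x) (+-identityˡ x) (+-monoˡ-≤ x 0≤y)

  0≤- : ∀ {a b} → a ≤ℚ b → 0ℚ ≤ℚ b - a
  0≤- {a} {b} a≤b = subst (_≤ℚ b - a) (+-inverseʳ a) (+-monoˡ-≤ (- a) a≤b)

  -≤ : ∀ {a b} → 0ℚ ≤ℚ b → a - b ≤ℚ a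
  -≤ {a} {b} 0≤b = subst (a - b ≤ℚ_) (+-identityʳ a) (+-monoʳ-≤ a (neg-antimono-≤ 0≤b))

  0≤-⇒≤ : ∀ {a b} → 0ℚ ≤ℚ b - a → a ≤ℚ b
  0≤-⇒≤ {a} {b} d = subst₂ _≤ℚ_ (+-identityʳ a) (eq a b) (+-monoʳ-≤ a d)
    where
    eq : ∀ a b → a + (b - a) ≡ b
    eq = solve-∀ ℚ-ring

  0≤sq : ∀ a → 0ℚ ≤ℚ a * a
  0≤sq a with ≤-total 0ℚ a
  ... | inj₁ 0≤a = 0≤* 0≤a 0≤a
  ... | inj₂ a≤0 = subst (0ℚ ≤ℚ_) (eq a) (0≤* 0≤-a 0≤-a)
    where
    0≤-a : 0ℚ ≤ℚ - a
    0≤-a = neg-antimono-≤ a≤0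
    eq : ∀ a → - a * - a ≡ a * a
    eq = solve-∀ ℚ-ring

  *-cancelˡ : ∀ {a b c} → 0ℚ < c → c * a ≤ℚ c * b → a ≤ℚ b
  *-cancelˡ {c = c} 0<c = *-cancelˡ-≤-pos c {{positive 0<c}}

  0<* : ∀ {a b} → 0ℚ < a → 0ℚ < b → 0ℚ < a * b
  0<* {a} {b} 0<a 0<b = positive⁻¹ (a * b) {{pos*pos⇒pos a {{positive 0<a}} b {{positive 0<b}}}}

  -- Bounds involving √n are proved in squared form and brought back with this, as √n is in general
  -- irrational.
  sq-cancel-≤ : ∀ {a b} → 0ℚ ≤ℚ b → a * a ≤ℚ b * b → a ≤ℚ b
  sq-cancel-≤ {a} {b} 0≤b a²≤b² with a ≤? b
  ... | yes a≤b = a≤b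
  ... | no a≰b = contradiction (<-≤-trans b²<a² a²≤b²) (<-irrefl refl)
    where
    b<a : b < a
    b<a = ≰⇒> a≰b
    b²<a² : b * b < a * a
    b²<a² = ≤-<-trans (*-monoˡ 0≤b (<⇒≤ b<a)) (*-monoˡ-<-pos a {{positive (≤-<-trans 0≤b b<a)}} b<a)

  -- Abstract because evaluating rational arithmetic on numerals is prohibitively slow.
  abstract
    ι : ℕ → ℚ
    ι = ℕtoℚ

    ι≡ℕtoℚ : ∀ n → ι n ≡ ℕtoℚ n
    ι≡ℕtoℚ n = refl

    ι-0 : ι 0 ≡ 0ℚ
    ι-0 = refl

    ι-1 : ι 1 ≡ 1ℚ
    ι-1 = refl

    ι-+ : ∀ m n → ι (m ℕ.+ n) ≡ ι m + ι n
    ι-+ m n = toℚᵘ-injective (begin-equality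
      toℚᵘ (ι (m ℕ.+ n))                  ≃⟨ toℚᵘ-fromℚᵘ (ιᵘ (m ℕ.+ n)) ⟩
      ιᵘ (m ℕ.+ n)                        ≃⟨ ℚᵘ.*≡* (cong (ℤ._* + 1) (sym (cong₂ ℤ._+_ (ℤₚ.*-identityʳ (+ m)) (ℤₚ.*-identityʳ (+ n))))) ⟩
      ιᵘ m ℚᵘ.+ ιᵘ n                      ≃⟨ ℚᵘₚ.+-cong (toℚᵘ-fromℚᵘ (ιᵘ m)) (toℚᵘ-fromℚᵘ (ιᵘ n)) ⟨
      toℚᵘ (ι m) ℚᵘ.+ toℚᵘ (ι n)          ≃⟨ toℚᵘ-homo-+ (ι m) (ι n) ⟨
      toℚᵘ (ι m + ι n) ∎)
      where
      open ℚᵘₚ.≤-Reasoning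
      import Data.Integer as ℤ
      ιᵘ : ℕ → ℚᵘ.ℚᵘ
      ιᵘ n = ℚᵘ.mkℚᵘ (+ n) 0

  ι-suc : ∀ n → ι (suc n) ≡ 1ℚ + ι n
  ι-suc n = trans (ι-+ 1 n) (cong (_+ ι n) ι-1)

  ι-* : ∀ m n → ι (m ℕ.* n) ≡ ι m * ι n
  ι-* zero    n = trans ι-0 (sym (trans (cong (_* ι n) ι-0) (*-zeroˡ (ι n))))
  ι-* (suc m) n = trans (ι-+ n (m ℕ.* n)) (trans (cong (_+_ (ι n)) (ι-* m n)) (trans (eq (ι m) (ι n)) (cong (_* ι n) (sym (ι-suc m)))))
    where
    eq : ∀ a b → b + a * b ≡ (1ℚ + a) * b
    eq = solve-∀ ℚ-ring

  0≤ι : ∀ n → 0ℚ ≤ℚ ι n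
  0≤ι zero    = ≤-reflexive (sym ι-0)
  0≤ι (suc n) = subst (0ℚ ≤ℚ_) (sym (ι-suc n)) (0≤+ 0≤1 (0≤ι n))

  ι-mono : ∀ {m n} → m ℕ.≤ n → ι m ≤ℚ ι n
  ι-mono {m} {n} m≤n = subst (ι m ≤ℚ_) (trans (sym (ι-+ m (n ℕ.∸ m))) (cong ι (ℕₚ.m+[n∸m]≡n m≤n))) (x≤x+ (0≤ι (n ℕ.∸ m)))

  0<ι : ∀ n → 1 ℕ.≤ n → 0ℚ < ι n
  0<ι n 1≤n = <-≤-trans (positive⁻¹ 1ℚ) (subst (_≤ℚ ι n) ι-1 (ι-mono 1≤n))

  infixr 8 _^_
  _^_ : ℚ → ℕ → ℚ
  x ^ zero  = 1ℚ
  x ^ suc n = x * x ^ n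

  ι-^ : ∀ m k → ι (m ℕ.^ k) ≡ ι m ^ k
  ι-^ m zero    = ι-1
  ι-^ m (suc k) = trans (ι-* m (m ℕ.^ k)) (cong (ι m *_) (ι-^ m k))

  ^-+ : ∀ x m n → x ^ (m ℕ.+ n) ≡ x ^ m * x ^ n
  ^-+ x zero    n = sym (*-identityˡ _)
  ^-+ x (suc m) n = trans (cong (x *_) (^-+ x m n)) (sym (*-assoc x (x ^ m) (x ^ n)))

  ^-* : ∀ x m n → x ^ (m ℕ.* n) ≡ (x ^ n) ^ m
  ^-* x zero    n = refl
  ^-* x (suc m) n = trans (^-+ x n (m ℕ.* n)) (cong (x ^ n *_) (^-* x m n))

  *-^ : ∀ x y n → (x * y) ^ n ≡ x ^ n * y ^ n
  *-^ x y zero    = refl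
  *-^ x y (suc n) = trans (cong (x * y *_) (*-^ x y n)) (eq x y (x ^ n) (y ^ n))
    where
    eq : ∀ a b c d → a * b * (c * d) ≡ a * c * (b * d)
    eq = solve-∀ ℚ-ring

  0≤^ : ∀ {x} n → 0ℚ ≤ℚ x → 0ℚ ≤ℚ x ^ n
  0≤^ zero    0≤x = 0≤1
  0≤^ (suc n) 0≤x = 0≤* 0≤x (0≤^ n 0≤x)

  0<^ : ∀ {x} n → 0ℚ < x → 0ℚ < x ^ n
  0<^ zero    0<x = positive⁻¹ 1ℚ
  0<^ (suc n) 0<x = 0<* 0<x (0<^ n 0<x)

  1≤^ : ∀ {x} n → 1ℚ ≤ℚ x → 1ℚ ≤ℚ x ^ n
  1≤^ zero    1≤x = ≤-refl
  1≤^ (suc n) 1≤x = *-mono (≤-trans 0≤1 1≤x) 0≤1 1≤x (1≤^ n 1≤x)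

  ^-monoˡ : ∀ {x y} n → 0ℚ ≤ℚ x → x ≤ℚ y → x ^ n ≤ℚ y ^ n
  ^-monoˡ zero    0≤x x≤y = ≤-refl
  ^-monoˡ (suc n) 0≤x x≤y = *-mono (≤-trans 0≤x x≤y) (0≤^ n 0≤x) x≤y (^-monoˡ n 0≤x x≤y)

  ^-monoʳ : ∀ {x m n} → 1ℚ ≤ℚ x → m ℕ.≤ n → x ^ m ≤ℚ x ^ n
  ^-monoʳ {n = n} 1≤x ℕ.z≤n = 1≤^ n 1≤x
  ^-monoʳ 1≤x (ℕ.s≤s m≤n) = *-monoˡ (≤-trans 0≤1 1≤x) (^-monoʳ 1≤x m≤n)

  ∑ : List A → (A → ℚ) → ℚ
  ∑ []       f = 0ℚ
  ∑ (x ∷ xs) f = f x + ∑ xs f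

  ∑-mono : ∀ (xs : List A) {f g : A → ℚ} → (∀ {a} → a ∈ xs → f a ≤ℚ g a) → ∑ xs f ≤ℚ ∑ xs g
  ∑-mono []       h = ≤-refl
  ∑-mono (x ∷ xs) h = +-mono-≤ (h (here refl)) (∑-mono xs (h ∘ there))

  ∑-cong : ∀ (xs : List A) {f g : A → ℚ} → (∀ a → f a ≡ g a) → ∑ xs f ≡ ∑ xs g
  ∑-cong []       h = refl
  ∑-cong (x ∷ xs) h = cong₂ _+_ (h x) (∑-cong xs h)

  ∑-+ : ∀ (xs : List A) (f g : A → ℚ) → ∑ xs (λ a → f a + g a) ≡ ∑ xs f + ∑ xs g
  ∑-+ []       f g = refl
  ∑-+ (x ∷ xs) f g = trans (cong (_+_ (f x + g x)) (∑-+ xs f g)) (eq (f x) (g x) (∑ xs f) (∑ xs g))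
    where
    eq : ∀ a b c d → a + b + (c + d) ≡ a + c + (b + d)
    eq = solve-∀ ℚ-ring

  ∑-*ˡ : ∀ (xs : List A) c (f : A → ℚ) → ∑ xs (λ a → c * f a) ≡ c * ∑ xs f
  ∑-*ˡ []       c f = sym (*-zeroʳ c)
  ∑-*ˡ (x ∷ xs) c f = trans (cong (_+_ (c * f x)) (∑-*ˡ xs c f)) (sym (*-distribˡ-+ c (f x) (∑ xs f)))

  ∑-*ʳ : ∀ (xs : List A) c (f : A → ℚ) → ∑ xs (λ a → f a * c) ≡ ∑ xs f * c
  ∑-*ʳ xs c f = trans (∑-cong xs (λ a → *-comm (f a) c)) (trans (∑-*ˡ xs c f) (*-comm c (∑ xs f)))

  ∑-const : ∀ (xs : List A) c → ∑ xs (λ _ → c) ≡ ι (length xs) * c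
  ∑-const []       c = sym (trans (cong (_* c) ι-0) (*-zeroˡ c))
  ∑-const (x ∷ xs) c = trans (cong (_+_ c) (∑-const xs c)) (trans (eq c (ι (length xs))) (cong (_* c) (sym (ι-suc (length xs)))))
    where
    eq : ∀ c l → c + l * c ≡ (1ℚ + l) * c
    eq = solve-∀ ℚ-ring

  0≤∑ : ∀ (xs : List A) {f : A → ℚ} → (∀ a → 0ℚ ≤ℚ f a) → 0ℚ ≤ℚ ∑ xs f
  0≤∑ []       h = ≤-refl
  0≤∑ (x ∷ xs) h = 0≤+ (h x) (0≤∑ xs h)

  -- Recursion on the coordinates, instead of a weighted sum over a list, turns identities about
  -- random subsets into inductions that reveal one edge at a time.
  𝔼 : ℚ → ∀ {N} → (Vec Bool N → ℚ) → ℚ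
  𝔼 p {zero}  f = f []
  𝔼 p {suc N} f = p * 𝔼 p (f ∘ (true ∷_)) + (1ℚ - p) * 𝔼 p (f ∘ (false ∷_))

  module _ {p : ℚ} where

    𝔼-cong : ∀ {N} {f g : Vec Bool N → ℚ} → (∀ W → f W ≡ g W) → 𝔼 p f ≡ 𝔼 p g
    𝔼-cong {zero}  h = h []
    𝔼-cong {suc N} h = cong₂ (λ a b → p * a + (1ℚ - p) * b) (𝔼-cong (h ∘ (true ∷_))) (𝔼-cong (h ∘ (false ∷_)))

    𝔼-+ : ∀ {N} (f g : Vec Bool N → ℚ) → 𝔼 p (λ W → f W + g W) ≡ 𝔼 p f + 𝔼 p g
    𝔼-+ {zero}  f g = refl
    𝔼-+ {suc N} f g = trans
      (cong₂ (λ a b → p * a + (1ℚ - p) * b) (𝔼-+ (f ∘ (true ∷_)) (g ∘ (true ∷_))) (𝔼-+ (f ∘ (false ∷_)) (g ∘ (false ∷_))))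
      (eq p _ _ _ _)
      where
      eq : ∀ p a b c d → p * (a + b) + (1ℚ - p) * (c + d) ≡ (p * a + (1ℚ - p) * c) + (p * b + (1ℚ - p) * d)
      eq = solve-∀ ℚ-ring

    𝔼-*ˡ : ∀ {N} c (f : Vec Bool N → ℚ) → 𝔼 p (λ W → c * f W) ≡ c * 𝔼 p f
    𝔼-*ˡ {zero}  c f = refl
    𝔼-*ˡ {suc N} c f = trans
      (cong₂ (λ a b → p * a + (1ℚ - p) * b) (𝔼-*ˡ c (f ∘ (true ∷_))) (𝔼-*ˡ c (f ∘ (false ∷_))))
      (eq p c _ _)
      where
      eq : ∀ p c a b → p * (c * a) + (1ℚ - p) * (c * b) ≡ c * (p * a + (1ℚ - p) * b)
      eq = solve-∀ ℚ-ring

    𝔼-const : ∀ {N} c → 𝔼 p {N} (λ _ → c) ≡ c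
    𝔼-const {zero}  c = refl
    𝔼-const {suc N} c = trans (cong₂ (λ a b → p * a + (1ℚ - p) * b) (𝔼-const {N} c) (𝔼-const {N} c)) (eq p c)
      where
      eq : ∀ p c → p * c + (1ℚ - p) * c ≡ c
      eq = solve-∀ ℚ-ring

    𝔼-complement : ∀ {N} (f : Vec Bool N → ℚ) → 𝔼 p (λ W → 1ℚ - f W) ≡ 1ℚ - 𝔼 p f
    𝔼-complement {N} f = trans (𝔼-cong (λ W → ring (f W))) (trans (𝔼-+ (λ _ → 1ℚ) (λ W → - 1ℚ * f W))
      (trans (cong₂ _+_ (𝔼-const {N} 1ℚ) (𝔼-*ˡ (- 1ℚ) f)) (sym (ring (𝔼 p f)))))
      where
      ring : ∀ a → 1ℚ - a ≡ 1ℚ + - 1ℚ * a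
      ring = solve-∀ ℚ-ring

    𝔼-∑ : ∀ {N} (xs : List A) (f : A → Vec Bool N → ℚ) → 𝔼 p (λ W → ∑ xs (λ a → f a W)) ≡ ∑ xs (λ a → 𝔼 p (f a))
    𝔼-∑ {N = N} [] f = 𝔼-const {N} 0ℚ
    𝔼-∑ (x ∷ xs) f = trans (𝔼-+ (f x) (λ W → ∑ xs (λ a → f a W))) (cong (_+_ (𝔼 p (f x))) (𝔼-∑ xs f))

    module _ (0≤p : 0ℚ ≤ℚ p) (p≤1 : p ≤ℚ 1ℚ) where

      𝔼-mono : ∀ {N} {f g : Vec Bool N → ℚ} → (∀ W → f W ≤ℚ g W) → 𝔼 p f ≤ℚ 𝔼 p g
      𝔼-mono {zero}  h = h []
      𝔼-mono {suc N} h = +-mono-≤ (*-monoˡ 0≤p (𝔼-mono (h ∘ (true ∷_)))) (*-monoˡ (0≤- p≤1) (𝔼-mono (h ∘ (false ∷_))))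

  ∑ₛ : ∀ {N} → (Vec Bool N → ℚ) → ℚ
  ∑ₛ {zero}  f = f []
  ∑ₛ {suc N} f = ∑ₛ (f ∘ (true ∷_)) + ∑ₛ (f ∘ (false ∷_))

  ∑ₛ-cong : ∀ {N} {f g : Vec Bool N → ℚ} → (∀ W → f W ≡ g W) → ∑ₛ f ≡ ∑ₛ g
  ∑ₛ-cong {zero}  h = h []
  ∑ₛ-cong {suc N} h = cong₂ _+_ (∑ₛ-cong (h ∘ (true ∷_))) (∑ₛ-cong (h ∘ (false ∷_)))

  ∑ₛ-*ˡ : ∀ {N} c (f : Vec Bool N → ℚ) → ∑ₛ (λ W → c * f W) ≡ c * ∑ₛ f
  ∑ₛ-*ˡ {zero}  c f = refl
  ∑ₛ-*ˡ {suc N} c f = trans (cong₂ _+_ (∑ₛ-*ˡ c (f ∘ (true ∷_))) (∑ₛ-*ˡ c (f ∘ (false ∷_)))) (sym (*-distribˡ-+ c _ _))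

  0≤∑ₛ : ∀ {N} {f : Vec Bool N → ℚ} → (∀ W → 0ℚ ≤ℚ f W) → 0ℚ ≤ℚ ∑ₛ f
  0≤∑ₛ {zero}  h = h []
  0≤∑ₛ {suc N} h = 0≤+ (0≤∑ₛ (h ∘ (true ∷_))) (0≤∑ₛ (h ∘ (false ∷_)))

  -- Pays for not knowing which subset is the fragment: the right guess is one term of a sum of
  -- nonnegative ones.
  term≤∑ₛ : ∀ {N} (f : Vec Bool N → ℚ) → (∀ W → 0ℚ ≤ℚ f W) → ∀ W → f W ≤ℚ ∑ₛ f
  term≤∑ₛ f h [] = ≤-refl
  term≤∑ₛ f h (true  ∷ W) = ≤-trans (term≤∑ₛ (f ∘ (true ∷_)) (h ∘ (true ∷_)) W) (x≤x+ (0≤∑ₛ (h ∘ (false ∷_))))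
  term≤∑ₛ f h (false ∷ W) = ≤-trans (term≤∑ₛ (f ∘ (false ∷_)) (h ∘ (false ∷_)) W) (x≤+x (0≤∑ₛ (h ∘ (true ∷_))))

  𝟙 : Bool → ℚ
  𝟙 b = if b then 1ℚ else 0ℚ

  ∑-++ : ∀ (xs ys : List A) (f : A → ℚ) → ∑ (xs ++ ys) f ≡ ∑ xs f + ∑ ys f
  ∑-++ []       ys f = sym (+-identityˡ _)
  ∑-++ (x ∷ xs) ys f = trans (cong (_+_ (f x)) (∑-++ xs ys f)) (sym (+-assoc (f x) _ _))

  ∑-map : ∀ (g : A → B) (xs : List A) (f : B → ℚ) → ∑ (map g xs) f ≡ ∑ xs (f ∘ g)
  ∑-map g []       f = refl
  ∑-map g (x ∷ xs) f = cong (_+_ (f (g x))) (∑-map g xs f)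

  ∑-weight : ∀ p {N} (f : Vec Bool N → ℚ) → ∑ (allBoolVecs N) (λ G → weight p G * f G) ≡ 𝔼 p f
  ∑-weight p {zero}  f = trans (+-identityʳ _) (*-identityˡ (f []))
  ∑-weight p {suc N} f = begin
    ∑ (map (true ∷_) Gs ++ map (false ∷_) Gs) w
      ≡⟨ ∑-++ (map (true ∷_) Gs) (map (false ∷_) Gs) w ⟩
    ∑ (map (true ∷_) Gs) w + ∑ (map (false ∷_) Gs) w
      ≡⟨ cong₂ _+_ (half true) (half false) ⟩
    p * 𝔼 p (f ∘ (true ∷_)) + (1ℚ - p) * 𝔼 p (f ∘ (false ∷_)) ∎
    where
    open ≡-Reasoning
    Gs = allBoolVecs N
    w : Vec Bool (suc N) → ℚ
    w G = weight p G * f G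
    half : ∀ b → ∑ (map (b ∷_) Gs) w ≡ (if b then p else (1ℚ - p)) * 𝔼 p (f ∘ (b ∷_))
    half b = trans (∑-map (b ∷_) Gs w)
      (trans (∑-cong Gs (λ G → *-assoc (if b then p else (1ℚ - p)) (weight p G) (f (b ∷ G))))
      (trans (∑-*ˡ Gs (if b then p else (1ℚ - p)) _) (cong ((if b then p else (1ℚ - p)) *_) (∑-weight p (f ∘ (b ∷_))))))

  Prob≡𝔼 : ∀ n p (P : Graph n → Set) (dec : Decidable P) → Prob n p P dec ≡ 𝔼 p (λ G → 𝟙 (does (dec G)))
  Prob≡𝔼 n p P dec = trans (go (allBoolVecs _)) (∑-weight p (λ G → 𝟙 (does (dec G))))
    where
    select : ∀ b (w : ℚ) → (if b then w else 0ℚ) ≡ w * 𝟙 b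
    select true  w = sym (*-identityʳ w)
    select false w = sym (*-zeroʳ w)
    go : ∀ Gs → foldr _+_ 0ℚ (map (λ G → if does (dec G) then weight p G else 0ℚ) Gs)
       ≡ ∑ Gs (λ G → weight p G * 𝟙 (does (dec G)))
    go []       = refl
    go (G ∷ Gs) = cong₂ _+_ (select (does (dec G)) (weight p G)) (go Gs)

-- Random subsets: two-round exposure, inclusion weights and the change of measure.

module RandomSubsets where

  open import Data.Nat using (ℕ; zero; suc)
  open import Data.Fin.Subset using (Subset; _∪_; _∩_; _─_; ∣_∣; _⊆_)
  open import Data.Fin.Subset.Properties using (drop-∷-⊆; in⊆in; out⊆)
  open import Data.List using ([]; _∷_)
  open import Data.List.Relation.Unary.Any using (here)
  open import Data.Vec using ([]; _∷_; here)
  open import Data.Rational using (ℚ; 0ℚ; 1ℚ; _+_; _*_; _-_; -_) renaming (_≤_ to _≤ℚ_)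
  open import Data.Rational.Properties using (module ≤-Reasoning; ≤-refl; +-mono-≤; *-zeroˡ; *-zeroʳ; *-identityˡ; +-identityˡ; *-assoc)
  open import Tactic.RingSolver using (solve-∀)
  open Expectation

  private variable
    N : ℕ

  -- An element is missed by both rounds with probability `(1 - q) * (1 - q′)`, which the hypothesis
  -- equates with `1 - p`.
  𝔼-∪ : ∀ {p q q′} → p ≡ q + (1ℚ - q) * q′ → (f : Subset N → ℚ) →
        𝔼 p f ≡ 𝔼 q (λ W → 𝔼 q′ (λ W′ → f (W ∪ W′)))
  𝔼-∪ {zero} eq f = refl
  𝔼-∪ {suc N} {p} {q} {q′} eq f = begin
    p * 𝔼 p ft + (1ℚ - p) * 𝔼 p ff
      ≡⟨ cong₂ (λ a b → p * a + (1ℚ - p) * b) (𝔼-∪ eq ft) (𝔼-∪ eq ff) ⟩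
    p * T + (1ℚ - p) * F
      ≡⟨ cong (λ p → p * T + (1ℚ - p) * F) eq ⟩
    (q + (1ℚ - q) * q′) * T + (1ℚ - (q + (1ℚ - q) * q′)) * F
      ≡⟨ ring q q′ T F ⟩
    q * T + (1ℚ - q) * (q′ * T + (1ℚ - q′) * F)
      -- Once `W` contains the first element, its status in `W′` is averaged out.
      ≡⟨ cong₂ (λ a b → q * a + (1ℚ - q) * b) (sym (𝔼-cong (λ W → idem q′ (gt W)))) (sym both) ⟩
    q * 𝔼 q (λ W → q′ * gt W + (1ℚ - q′) * gt W) + (1ℚ - q) * 𝔼 q (λ W → q′ * gt W + (1ℚ - q′) * gf W) ∎
    where
    open ≡-Reasoning
    ft ff gt gf : Subset N → ℚ
    ft = f ∘ (true ∷_)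
    ff = f ∘ (false ∷_)
    gt W = 𝔼 q′ (λ W′ → ft (W ∪ W′))
    gf W = 𝔼 q′ (λ W′ → ff (W ∪ W′))
    T F : ℚ
    T = 𝔼 q gt
    F = 𝔼 q gf
    ring : ∀ q q′ T F → (q + (1ℚ - q) * q′) * T + (1ℚ - (q + (1ℚ - q) * q′)) * F ≡ q * T + (1ℚ - q) * (q′ * T + (1ℚ - q′) * F)
    ring = solve-∀ ℚ-ring
    idem : ∀ q a → q * a + (1ℚ - q) * a ≡ a
    idem = solve-∀ ℚ-ring
    both : 𝔼 q (λ W → q′ * gt W + (1ℚ - q′) * gf W) ≡ q′ * T + (1ℚ - q′) * F
    both = trans (𝔼-+ (λ W → q′ * gt W) (λ W → (1ℚ - q′) * gf W)) (cong₂ _+_ (𝔼-*ˡ q′ gt) (𝔼-*ˡ (1ℚ - q′) gf))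

  -- incl y A χ is y ^ ∣ χ ∣ if χ ⊆ A, and 0 otherwise.
  incl : ℚ → Subset N → Subset N → ℚ
  incl y []          []          = 1ℚ
  incl y (_     ∷ A) (false ∷ χ) = incl y A χ
  incl y (true  ∷ A) (true  ∷ χ) = y * incl y A χ
  incl y (false ∷ A) (true  ∷ χ) = 0ℚ

  incl-⊆ : ∀ y {A χ : Subset N} → χ ⊆ A → incl y A χ ≡ y ^ ∣ χ ∣
  incl-⊆ y {[]}        {[]}        χ⊆A = refl
  incl-⊆ y {a     ∷ A} {false ∷ χ} χ⊆A = incl-⊆ y (drop-∷-⊆ χ⊆A)
  incl-⊆ y {true  ∷ A} {true  ∷ χ} χ⊆A = cong (y *_) (incl-⊆ y (drop-∷-⊆ χ⊆A))
  incl-⊆ y {false ∷ A} {true  ∷ χ} χ⊆A with χ⊆A here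
  ... | ()

  incl-⊈ : ∀ y {A χ : Subset N} → ¬ (χ ⊆ A) → incl y A χ ≡ 0ℚ
  incl-⊈ y {[]}        {[]}        χ⊈A = contradiction (λ ()) χ⊈A
  incl-⊈ y {a     ∷ A} {false ∷ χ} χ⊈A = incl-⊈ y (χ⊈A ∘ out⊆)
  incl-⊈ y {true  ∷ A} {true  ∷ χ} χ⊈A = trans (cong (y *_) (incl-⊈ y (χ⊈A ∘ in⊆in))) (*-zeroʳ y)
  incl-⊈ y {false ∷ A} {true  ∷ χ} χ⊈A = refl

  0≤incl : ∀ {y} → 0ℚ ≤ℚ y → (A χ : Subset N) → 0ℚ ≤ℚ incl y A χ
  0≤incl 0≤y []          []          = 0≤1
  0≤incl 0≤y (a     ∷ A) (false ∷ χ) = 0≤incl 0≤y A χ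
  0≤incl 0≤y (true  ∷ A) (true  ∷ χ) = 0≤* 0≤y (0≤incl 0≤y A χ)
  0≤incl 0≤y (false ∷ A) (true  ∷ χ) = ≤-refl

  ^*incl : ∀ x y (A χ : Subset N) → x ^ ∣ χ ∣ * incl y A χ ≡ incl (x * y) A χ
  ^*incl x y []          []          = refl
  ^*incl x y (a     ∷ A) (false ∷ χ) = ^*incl x y A χ
  ^*incl x y (true  ∷ A) (true  ∷ χ) = trans (ring x y (x ^ ∣ χ ∣) (incl y A χ)) (cong (x * y *_) (^*incl x y A χ))
    where
    ring : ∀ x y a b → x * a * (y * b) ≡ x * y * (a * b)
    ring = solve-∀ ℚ-ring
  ^*incl x y (false ∷ A) (true  ∷ χ) = *-zeroʳ (x * x ^ ∣ χ ∣)

  -- The binomial theorem, as only subsets of `A` contribute: each element of `A` is left out with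
  -- factor 1 or taken with factor `y`.
  ∑ₛ-incl : ∀ y (A : Subset N) → ∑ₛ (incl y A) ≡ (1ℚ + y) ^ ∣ A ∣
  ∑ₛ-incl y []          = refl
  ∑ₛ-incl y (true  ∷ A) = trans (cong₂ _+_ (∑ₛ-*ˡ y (incl y A)) refl)
    (trans (ring y (∑ₛ (incl y A))) (cong ((1ℚ + y) *_) (∑ₛ-incl y A)))
    where
    ring : ∀ y a → y * a + a ≡ (1ℚ + y) * a
    ring = solve-∀ ℚ-ring
  ∑ₛ-incl {suc N} y (false ∷ A) = trans (cong (_+ ∑ₛ (incl y A)) (∑ₛ-0 {N})) (trans (+-identityˡ _) (∑ₛ-incl y A))
    where
    ∑ₛ-0 : ∀ {N} → ∑ₛ {N} (λ _ → 0ℚ) ≡ 0ℚ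
    ∑ₛ-0 {zero}  = refl
    ∑ₛ-0 {suc N} = cong₂ _+_ (∑ₛ-0 {N}) (∑ₛ-0 {N})

  module _ {q Q : ℚ} (qQ≡1 : q * Q ≡ 1ℚ) where

    private
      average : ∀ c → q * c + (1ℚ - q) * c ≡ c
      average = ring q
        where
        ring : ∀ q c → q * c + (1ℚ - q) * c ≡ c
        ring = solve-∀ ℚ-ring

      conditioned : ∀ c → q * (Q * c) + (1ℚ - q) * 0ℚ ≡ c
      conditioned c = trans (ring q Q c) (trans (cong (_* c) qQ≡1) (*-identityˡ c))
        where
        ring : ∀ q Q c → q * (Q * c) + (1ℚ - q) * 0ℚ ≡ q * Q * c
        ring = solve-∀ ℚ-ring

      𝔼-conditioned : ∀ {f g h : Subset N → ℚ} → (∀ W → f W ≡ Q * h W) → (∀ W → g W ≡ 0ℚ) →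
        q * 𝔼 q f + (1ℚ - q) * 𝔼 q g ≡ 𝔼 q h
      𝔼-conditioned {N} {h = h} f≡ g≡ = trans
        (cong₂ (λ a b → q * a + (1ℚ - q) * b) (trans (𝔼-cong f≡) (𝔼-*ˡ Q h)) (trans (𝔼-cong g≡) (𝔼-const {N = N} 0ℚ)))
        (conditioned (𝔼 q h))

    -- With `Q = 1 / q`, the weight `Q ^ ∣ χ ∣` is the inverse of the probability of `χ ⊆ W`.
    𝔼-incl : (χ : Subset N) → 𝔼 q (λ W → incl Q W χ) ≡ 1ℚ
    𝔼-incl []          = refl
    𝔼-incl (false ∷ χ) = trans (average _) (𝔼-incl χ)
    𝔼-incl (true  ∷ χ) = trans (𝔼-conditioned {h = λ W → incl Q W χ} (λ _ → refl) (λ _ → refl)) (𝔼-incl χ)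

    -- A common element has to be present only once but is compensated twice, which leaves one
    -- factor `Q`; all other elements average out.
    𝔼-incl-incl : (χ χ′ : Subset N) → 𝔼 q (λ W → incl Q W χ * incl Q W χ′) ≡ Q ^ ∣ χ ∩ χ′ ∣
    𝔼-incl-incl []          []           = refl
    𝔼-incl-incl (false ∷ χ) (false ∷ χ′) = trans (average _) (𝔼-incl-incl χ χ′)
    𝔼-incl-incl (false ∷ χ) (true  ∷ χ′) = trans
      (𝔼-conditioned (λ W → ring Q (incl Q W χ) (incl Q W χ′)) (λ W → *-zeroʳ (incl Q W χ))) (𝔼-incl-incl χ χ′)
      where
      ring : ∀ Q a b → a * (Q * b) ≡ Q * (a * b)
      ring = solve-∀ ℚ-ring
    𝔼-incl-incl (true  ∷ χ) (false ∷ χ′) = trans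
      (𝔼-conditioned (λ W → *-assoc Q (incl Q W χ) (incl Q W χ′)) (λ W → *-zeroˡ (incl Q W χ′))) (𝔼-incl-incl χ χ′)
    𝔼-incl-incl (true  ∷ χ) (true  ∷ χ′) = trans
      (𝔼-conditioned (λ W → ring Q (incl Q W χ) (incl Q W χ′)) (λ W → refl))
      (trans (𝔼-*ˡ Q (λ W → incl Q W χ * incl Q W χ′)) (cong (Q *_) (𝔼-incl-incl χ χ′)))
      where
      ring : ∀ Q a b → Q * a * (Q * b) ≡ Q * (Q * (a * b))
      ring = solve-∀ ℚ-ring

  disj : Subset N → Subset N → ℚ
  disj []          []          = 1ℚ
  disj (true  ∷ W) (true  ∷ χ) = 0ℚ
  disj (true  ∷ W) (false ∷ χ) = disj W χ
  disj (false ∷ W) (_     ∷ χ) = disj W χ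

  0≤disj : (W χ : Subset N) → 0ℚ ≤ℚ disj W χ
  0≤disj []          []          = 0≤1
  0≤disj (true  ∷ W) (true  ∷ χ) = ≤-refl
  0≤disj (true  ∷ W) (false ∷ χ) = 0≤disj W χ
  0≤disj (false ∷ W) (_     ∷ χ) = 0≤disj W χ

  disj-─ : (A W : Subset N) → disj W (A ─ W) ≡ 1ℚ
  disj-─ []          []          = refl
  disj-─ (true  ∷ A) (true  ∷ W) = disj-─ A W
  disj-─ (true  ∷ A) (false ∷ W) = disj-─ A W
  disj-─ (false ∷ A) (true  ∷ W) = disj-─ A W
  disj-─ (false ∷ A) (false ∷ W) = disj-─ A W

  -- Passing from (W , χ) to (W ∪ χ , χ): for disjoint W and χ, the probability of W is at most X ^ ∣ χ ∣ times that of W ∪ χ.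
  module _ {q X : ℚ} (0≤q : 0ℚ ≤ℚ q) (q≤1 : q ≤ℚ 1ℚ) (1≤qX : 1ℚ ≤ℚ q * X) (0≤X : 0ℚ ≤ℚ X) where

    𝔼-shift : (g : Subset N → Subset N → ℚ) → (∀ Z χ → 0ℚ ≤ℚ g Z χ) →
      𝔼 q (λ W → ∑ₛ (λ χ → disj W χ * g (W ∪ χ) χ)) ≤ℚ 𝔼 q (λ Z → ∑ₛ (λ χ → X ^ ∣ χ ∣ * g Z χ))
    𝔼-shift {zero} g 0≤g = ≤-refl
    𝔼-shift {suc N} g 0≤g = begin
      q * 𝔼 q (λ W → ∑ₛ (λ χ → 0ℚ * g (true ∷ (W ∪ χ)) (true ∷ χ)) + ∑ₛ (λ χ → disj W χ * g₁₀ (W ∪ χ) χ))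
        + (1ℚ - q) * 𝔼 q (λ W → ∑ₛ (λ χ → disj W χ * g₁₁ (W ∪ χ) χ) + ∑ₛ (λ χ → disj W χ * g₀₀ (W ∪ χ) χ))
        ≡⟨ cong₂ (λ a b → q * a + (1ℚ - q) * b)
             (𝔼-cong (λ W → trans (cong₂ _+_ (∑ₛ-*ˡ 0ℚ (λ χ → g (true ∷ (W ∪ χ)) (true ∷ χ))) refl) (drop0 (∑ₛ (λ χ → g₁₁ (W ∪ χ) χ)) (∑ₛ (λ χ → disj W χ * g₁₀ (W ∪ χ) χ)))))
             (𝔼-+ (λ W → ∑ₛ (λ χ → disj W χ * g₁₁ (W ∪ χ) χ)) (λ W → ∑ₛ (λ χ → disj W χ * g₀₀ (W ∪ χ) χ))) ⟩
      q * low g₁₀ + (1ℚ - q) * (low g₁₁ + low g₀₀)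
        ≤⟨ +-mono-≤ (*-monoˡ 0≤q (𝔼-shift g₁₀ (λ Z χ → 0≤g _ _)))
             (*-monoˡ (0≤- q≤1) (+-mono-≤ (𝔼-shift g₁₁ (λ Z χ → 0≤g _ _)) (𝔼-shift g₀₀ (λ Z χ → 0≤g _ _)))) ⟩
      q * high g₁₀ + (1ℚ - q) * (high g₁₁ + high g₀₀)
        -- Two slacks: a coordinate in both `Z` and `χ` has weight `q * X` on the right against
        -- `1 - q` on the left, and a coordinate in `χ` but not in `Z` never arises on the left.
        ≤⟨ 0≤-⇒≤ (subst (0ℚ ≤ℚ_) (ring q X (high g₁₀) (high g₁₁) (high g₀₀) (high g₀₁))
             (0≤+ (0≤* (0≤+ (0≤- 1≤qX) 0≤q) (0≤high g₁₁ (λ Z χ → 0≤g _ _)))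
                  (0≤* (0≤* (0≤- q≤1) 0≤X) (0≤high g₀₁ (λ Z χ → 0≤g _ _))))) ⟩
      q * (X * high g₁₁ + high g₁₀) + (1ℚ - q) * (X * high g₀₁ + high g₀₀)
        ≡⟨ cong₂ (λ a b → q * a + (1ℚ - q) * b) (split g₁₁ g₁₀) (split g₀₁ g₀₀) ⟩
      q * 𝔼 q (λ Z → ∑ₛ (λ χ → X * X ^ ∣ χ ∣ * g₁₁ Z χ) + ∑ₛ (λ χ → X ^ ∣ χ ∣ * g₁₀ Z χ))
        + (1ℚ - q) * 𝔼 q (λ Z → ∑ₛ (λ χ → X * X ^ ∣ χ ∣ * g₀₁ Z χ) + ∑ₛ (λ χ → X ^ ∣ χ ∣ * g₀₀ Z χ))
        ∎
      where
      open ≤-Reasoning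
      g₁₁ g₁₀ g₀₁ g₀₀ : Subset N → Subset N → ℚ
      g₁₁ Z χ = g (true ∷ Z) (true ∷ χ)
      g₁₀ Z χ = g (true ∷ Z) (false ∷ χ)
      g₀₁ Z χ = g (false ∷ Z) (true ∷ χ)
      g₀₀ Z χ = g (false ∷ Z) (false ∷ χ)
      low high : (Subset N → Subset N → ℚ) → ℚ
      low g = 𝔼 q (λ W → ∑ₛ (λ χ → disj W χ * g (W ∪ χ) χ))
      high g = 𝔼 q (λ Z → ∑ₛ (λ χ → X ^ ∣ χ ∣ * g Z χ))
      0≤high : ∀ g → (∀ Z χ → 0ℚ ≤ℚ g Z χ) → 0ℚ ≤ℚ high g
      0≤high g 0≤g = subst (_≤ℚ high g) (𝔼-const {p = q} {N = N} 0ℚ)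
        (𝔼-mono 0≤q q≤1 (λ Z → 0≤∑ₛ (λ χ → 0≤* (0≤^ ∣ χ ∣ 0≤X) (0≤g Z χ))))
      drop0 : ∀ a b → 0ℚ * a + b ≡ b
      drop0 = solve-∀ ℚ-ring
      split : ∀ g g′ → X * high g + high g′ ≡ 𝔼 q (λ Z → ∑ₛ (λ χ → X * X ^ ∣ χ ∣ * g Z χ) + ∑ₛ (λ χ → X ^ ∣ χ ∣ * g′ Z χ))
      split g g′ = sym (trans (𝔼-+ (λ Z → ∑ₛ (λ χ → X * X ^ ∣ χ ∣ * g Z χ)) (λ Z → ∑ₛ (λ χ → X ^ ∣ χ ∣ * g′ Z χ)))
        (cong (_+ high g′) (trans
          (𝔼-cong (λ Z → trans (∑ₛ-cong (λ χ → *-assoc X (X ^ ∣ χ ∣) (g Z χ))) (∑ₛ-*ˡ X (λ χ → X ^ ∣ χ ∣ * g Z χ))))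
          (𝔼-*ˡ X (λ Z → ∑ₛ (λ χ → X ^ ∣ χ ∣ * g Z χ))))))
      ring : ∀ q X a b c d → (q * X - 1ℚ + q) * b + (1ℚ - q) * X * d ≡
        q * (X * b + a) + (1ℚ - q) * (X * d + c) - (q * a + (1ℚ - q) * (b + c))
      ring = solve-∀ ℚ-ring

-- Minimum fragments: few large ones, and a second moment for the small ones.

module FragmentMethod where

  open import Data.Nat as ℕ using (ℕ)
  import Data.Nat.Properties as ℕₚ
  open import Data.Fin.Subset using (Subset; _∪_; _∩_; _─_; ∣_∣; _⊆_) renaming (_∈_ to _∈ₛ_)
  open import Data.Fin.Subset.Properties using (_⊆?_; drop-∷-⊆; p⊆q⇒∣p∣≤∣q∣; x∈p∪q⁻; x∈p∪q⁺; x∈p∩q⁺; p∩q⊆p; p∩q⊆q; x∈p∧x∉q⇒x∈p─q; p─q⊆p; ⊆-trans; in⊆in; out⊆) renaming (_∈?_ to _∈ₛ?_)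
  open import Data.List using (List; []; _∷_; length; filter)
  open import Data.List.Extrema ℕₚ.≤-totalOrder using (argmin; argmin-all; f[argmin]≤f[xs])
  open import Data.List.Membership.Propositional using (_∈_; find; lose)
  open import Data.List.Membership.Propositional.Properties using (∈-filter⁺; ∈-filter⁻; ∈-length)
  open import Data.List.Relation.Unary.Any using (here; there; any?)
  import Data.List.Relation.Unary.All as All
  open import Data.Vec using ([]; _∷_; here; there)
  open import Data.Rational using (ℚ; 0ℚ; 1ℚ; _+_; _*_; _-_; -_; _<_) renaming (_≤_ to _≤ℚ_)
  open import Data.Rational.Properties using (module ≤-Reasoning; ≤-refl; ≤-trans; ≤-reflexive; <⇒≤; ≰⇒>; +-monoʳ-≤; +-monoˡ-≤; _≤?_; *-zeroˡ; *-zeroʳ; *-identityˡ; *-identityʳ; *-assoc; *-distribˡ-+; ≤-antisym)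
  open import Tactic.RingSolver using (solve-∀)
  open Expectation
  open RandomSubsets

  card-⊆-antisym : ∀ {N} {A B : Subset N} → A ⊆ B → ∣ B ∣ ℕ.≤ ∣ A ∣ → B ⊆ A
  card-⊆-antisym {A = A} {B} A⊆B ∣B∣≤∣A∣ with B ⊆? A
  ... | yes B⊆A = B⊆A
  ... | no  B⊈A = contradiction ∣B∣≤∣A∣ (ℕₚ.<⇒≱ (strict A⊆B B⊈A))
    where
    strict : ∀ {N} {A B : Subset N} → A ⊆ B → ¬ (B ⊆ A) → ∣ A ∣ ℕ.< ∣ B ∣
    strict {A = []}        {[]}        A⊆B B⊈A = contradiction (λ ()) B⊈A
    strict {A = true  ∷ A} {true  ∷ B} A⊆B B⊈A = ℕ.s≤s (strict (drop-∷-⊆ A⊆B) (B⊈A ∘ in⊆in))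
    strict {A = true  ∷ A} {false ∷ B} A⊆B B⊈A with A⊆B here
    ... | ()
    strict {A = false ∷ A} {true  ∷ B} A⊆B B⊈A = ℕ.s≤s (p⊆q⇒∣p∣≤∣q∣ (drop-∷-⊆ A⊆B))
    strict {A = false ∷ A} {false ∷ B} A⊆B B⊈A = strict (drop-∷-⊆ A⊆B) (B⊈A ∘ out⊆)

  x∈p─q⇒x∉q : ∀ {N x} (p q : Subset N) → x ∈ₛ p ─ q → ¬ (x ∈ₛ q)
  x∈p─q⇒x∉q (true  ∷ p) (true ∷ q) ()       here
  x∈p─q⇒x∉q (false ∷ p) (true ∷ q) ()       here
  x∈p─q⇒x∉q (_     ∷ p) (_    ∷ q) (there i) (there j) = x∈p─q⇒x∉q p q i j

  𝟙-does : ∀ {P : Set} (d : Dec P) → (P × 𝟙 (does d) ≡ 1ℚ) ⊎ (¬ P × 𝟙 (does d) ≡ 0ℚ)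
  𝟙-does (yes p) = inj₁ (p , refl)
  𝟙-does (no ¬p) = inj₂ (¬p , refl)

  0≤𝟙 : ∀ b → 0ℚ ≤ℚ 𝟙 b
  0≤𝟙 true  = 0≤1
  0≤𝟙 false = ≤-refl

  𝟙≤1 : ∀ b → 𝟙 b ≤ℚ 1ℚ
  𝟙≤1 true  = ≤-refl
  𝟙≤1 false = 0≤1

  module Fragments {A : Set} (Ω : List A) {ω₀ : A} (ω₀∈Ω : ω₀ ∈ Ω) {N : ℕ} (E : A → Subset N) where

    h : ℚ
    h = ι (length Ω)

    0<h : 0ℚ < h
    0<h = 0<ι (length Ω) (∈-length ω₀∈Ω)

    -- The default of `argmin` is `ω`, itself a candidate, so for `ω` in `Ω` the result always lies
    -- in `Ω` and is contained in `W ∪ E ω`.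
    best : A → Subset N → A
    best ω W = argmin (λ ω′ → ∣ E ω′ ─ W ∣) ω (filter (λ ω′ → E ω′ ⊆? W ∪ E ω) Ω)

    frag : A → Subset N → Subset N
    frag ω W = E (best ω W) ─ W

    best-spec : ∀ {ω} → ω ∈ Ω → ∀ W → best ω W ∈ Ω × E (best ω W) ⊆ W ∪ E ω
    best-spec {ω} ω∈Ω W = argmin-all (λ ω′ → ∣ E ω′ ─ W ∣) {P = λ ω′ → ω′ ∈ Ω × E ω′ ⊆ W ∪ E ω}
      (ω∈Ω , λ x∈ → x∈p∪q⁺ (inj₂ x∈))
      (All.tabulate (λ ω′∈ → ∈-filter⁻ (λ ω′ → E ω′ ⊆? W ∪ E ω) {xs = Ω} ω′∈))

    frag⊆E : ∀ {ω} → ω ∈ Ω → ∀ W → frag ω W ⊆ E ω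
    frag⊆E {ω} ω∈Ω W x∈f with x∈p∪q⁻ W (E ω) (proj₂ (best-spec ω∈Ω W) (p─q⊆p _ W x∈f))
    ... | inj₁ x∈W = contradiction x∈W (x∈p─q⇒x∉q _ W x∈f)
    ... | inj₂ x∈E = x∈E

    E-best⊆ : ∀ ω W → E (best ω W) ⊆ W ∪ frag ω W
    E-best⊆ ω W {x} x∈E with x ∈ₛ? W
    ... | yes x∈W = x∈p∪q⁺ (inj₁ x∈W)
    ... | no  x∉W = x∈p∪q⁺ (inj₂ (x∈p∧x∉q⇒x∈p─q x∈E x∉W))

    -- Since `frag ω W` lies in `E ω`, such a `τ` competes in the minimum defining `best ω W`. Hence
    -- `E τ ─ W` is no smaller than the fragment, and being contained in it, it is all of it.
    frag-minimal : ∀ {ω τ} → ω ∈ Ω → τ ∈ Ω → ∀ W → E τ ⊆ W ∪ frag ω W → frag ω W ⊆ E τ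
    frag-minimal {ω} {τ} ω∈Ω τ∈Ω W Eτ⊆ = ⊆-trans (card-⊆-antisym Eτ─W⊆frag ∣frag∣≤) (p─q⊆p (E τ) W)
      where
      Eτ─W⊆frag : E τ ─ W ⊆ frag ω W
      Eτ─W⊆frag x∈ with x∈p∪q⁻ W (frag ω W) (Eτ⊆ (p─q⊆p (E τ) W x∈))
      ... | inj₁ x∈W = contradiction x∈W (x∈p─q⇒x∉q (E τ) W x∈)
      ... | inj₂ x∈f = x∈f
      τ-candidate : E τ ⊆ W ∪ E ω
      τ-candidate x∈ with x∈p∪q⁻ W (frag ω W) (Eτ⊆ x∈)
      ... | inj₁ x∈W = x∈p∪q⁺ (inj₁ x∈W)
      ... | inj₂ x∈f = x∈p∪q⁺ (inj₂ (frag⊆E ω∈Ω W x∈f))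
      ∣frag∣≤ : ∣ frag ω W ∣ ℕ.≤ ∣ E τ ─ W ∣
      ∣frag∣≤ = All.lookup (f[argmin]≤f[xs] ω (filter (λ ω′ → E ω′ ⊆? W ∪ E ω) Ω))
        (∈-filter⁺ (λ ω′ → E ω′ ⊆? W ∪ E ω) τ∈Ω τ-candidate)

    -- The choice depends on `Z` alone, which is what makes `Z` and a subset of one fixed edge set a
    -- complete record of the fragment. The default `ω₀` keeps the value in `Ω`, so that spreadness
    -- applies for every `Z`.
    canon : Subset N → A
    canon Z with any? (λ τ → E τ ⊆? Z) Ω
    ... | yes some = proj₁ (find some)
    ... | no  _    = ω₀

    canon∈Ω : ∀ Z → canon Z ∈ Ω
    canon∈Ω Z with any? (λ τ → E τ ⊆? Z) Ω
    ... | yes some = proj₁ (proj₂ (find some))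
    ... | no  _    = ω₀∈Ω

    canon⊆ : ∀ {Z τ} → τ ∈ Ω → E τ ⊆ Z → E (canon Z) ⊆ Z
    canon⊆ {Z} τ∈Ω Eτ⊆Z with any? (λ τ → E τ ⊆? Z) Ω
    ... | yes some = proj₂ (proj₂ (find some))
    ... | no  none = contradiction (lose {P = λ τ → E τ ⊆ Z} τ∈Ω Eτ⊆Z) none

    frag⊆canon : ∀ {ω} → ω ∈ Ω → ∀ W → frag ω W ⊆ E (canon (W ∪ frag ω W))
    frag⊆canon {ω} ω∈Ω W = frag-minimal ω∈Ω (canon∈Ω _) W (canon⊆ (proj₁ (best-spec ω∈Ω W)) (E-best⊆ ω W))

    good : ℕ → A → Subset N → ℚ
    good k ω W = 𝟙 (does (∣ frag ω W ∣ ℕ.≤? k))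

    0≤good : ∀ k ω W → 0ℚ ≤ℚ good k ω W
    0≤good k ω W = 0≤𝟙 _

    good≤1 : ∀ k ω W → good k ω W ≤ℚ 1ℚ
    good≤1 k ω W = 𝟙≤1 _

    module FewBad {q X L M : ℚ} (0≤q : 0ℚ ≤ℚ q) (q≤1 : q ≤ℚ 1ℚ) (1≤qX : 1ℚ ≤ℚ q * X) (0≤X : 0ℚ ≤ℚ X) (1≤L : 1ℚ ≤ℚ L) (k : ℕ)
      (spread : ∀ {τ} → τ ∈ Ω → ∑ Ω (λ ω → (1ℚ + X * L) ^ ∣ E τ ∩ E ω ∣) ≤ℚ h * M) where

      private
        0≤L : 0ℚ ≤ℚ L
        0≤L = ≤-trans 0≤1 1≤L

        g : A → Subset N → Subset N → ℚ
        g ω Z χ = incl L (E (canon Z) ∩ E ω) χ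

        -- `L` tilts the count as in a Chernoff bound: the guess `χ = frag ω W` has weight
        -- `L ^ ∣ χ ∣`, at least `L ^ k` when the fragment is larger than `k`.
        encode : ∀ {ω} → ω ∈ Ω → ∀ W → L ^ k * (1ℚ - good k ω W) ≤ℚ ∑ₛ (λ χ → disj W χ * g ω (W ∪ χ) χ)
        encode {ω} ω∈Ω W = ≤-trans large (term≤∑ₛ _ (λ χ → 0≤* (0≤disj W χ) (0≤incl 0≤L (E (canon (W ∪ χ)) ∩ E ω) χ)) (frag ω W))
          where
          term : disj W (frag ω W) * g ω (W ∪ frag ω W) (frag ω W) ≡ L ^ ∣ frag ω W ∣
          term = trans (cong₂ _*_ (disj-─ (E (best ω W)) W) (incl-⊆ L (λ x∈ → x∈p∩q⁺ (frag⊆canon ω∈Ω W x∈ , frag⊆E ω∈Ω W x∈))))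
            (*-identityˡ _)
          large : L ^ k * (1ℚ - good k ω W) ≤ℚ disj W (frag ω W) * g ω (W ∪ frag ω W) (frag ω W)
          large with 𝟙-does (∣ frag ω W ∣ ℕ.≤? k)
          ... | inj₁ (_ , good≡1) = subst₂ _≤ℚ_ (sym (trans (cong (λ g → L ^ k * (1ℚ - g)) good≡1) (*-zeroʳ (L ^ k)))) (sym term)
            (0≤^ ∣ frag ω W ∣ 0≤L)
          ... | inj₂ (≰k , good≡0) = subst₂ _≤ℚ_ (sym (trans (cong (λ g → L ^ k * (1ℚ - g)) good≡0) (*-identityʳ (L ^ k)))) (sym term)
            (^-monoʳ 1≤L (ℕₚ.<⇒≤ (ℕₚ.≰⇒> ≰k)))

        -- The factor `X` from the change of measure and the tilt `L` merge into the single
        -- parameter `X * L` of the spread bound.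
        weights : ∀ ω Z → ∑ₛ (λ χ → X ^ ∣ χ ∣ * g ω Z χ) ≡ (1ℚ + X * L) ^ ∣ E (canon Z) ∩ E ω ∣
        weights ω Z = trans (∑ₛ-cong (^*incl X L (E (canon Z) ∩ E ω))) (∑ₛ-incl (X * L) (E (canon Z) ∩ E ω))

      few-bad : L ^ k * 𝔼 q (λ W → ∑ Ω (λ ω → 1ℚ - good k ω W)) ≤ℚ h * M
      few-bad = begin
        L ^ k * 𝔼 q (λ W → ∑ Ω (λ ω → 1ℚ - good k ω W))
          ≡⟨ 𝔼-*ˡ (L ^ k) (λ W → ∑ Ω (λ ω → 1ℚ - good k ω W)) ⟨
        𝔼 q (λ W → L ^ k * ∑ Ω (λ ω → 1ℚ - good k ω W))
          ≡⟨ 𝔼-cong (λ W → ∑-*ˡ Ω (L ^ k) (λ ω → 1ℚ - good k ω W)) ⟨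
        𝔼 q (λ W → ∑ Ω (λ ω → L ^ k * (1ℚ - good k ω W)))
          ≤⟨ 𝔼-mono 0≤q q≤1 (λ W → ∑-mono Ω (λ ω∈Ω → encode ω∈Ω W)) ⟩
        𝔼 q (λ W → ∑ Ω (λ ω → ∑ₛ (λ χ → disj W χ * g ω (W ∪ χ) χ)))
          ≡⟨ 𝔼-∑ Ω (λ ω W → ∑ₛ (λ χ → disj W χ * g ω (W ∪ χ) χ)) ⟩
        ∑ Ω (λ ω → 𝔼 q (λ W → ∑ₛ (λ χ → disj W χ * g ω (W ∪ χ) χ)))
          ≤⟨ ∑-mono Ω (λ {ω} _ → 𝔼-shift 0≤q q≤1 1≤qX 0≤X (g ω) (λ Z χ → 0≤incl 0≤L (E (canon Z) ∩ E ω) χ)) ⟩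
        ∑ Ω (λ ω → 𝔼 q (λ Z → ∑ₛ (λ χ → X ^ ∣ χ ∣ * g ω Z χ)))
          ≡⟨ ∑-cong Ω (λ ω → 𝔼-cong (weights ω)) ⟩
        ∑ Ω (λ ω → 𝔼 q (λ Z → (1ℚ + X * L) ^ ∣ E (canon Z) ∩ E ω ∣))
          ≡⟨ 𝔼-∑ Ω (λ ω Z → (1ℚ + X * L) ^ ∣ E (canon Z) ∩ E ω ∣) ⟨
        𝔼 q (λ Z → ∑ Ω (λ ω → (1ℚ + X * L) ^ ∣ E (canon Z) ∩ E ω ∣))
          -- For fixed `Z` the set `E (canon Z)` is the same for all `ω`, so spreadness is applied
          -- to this one set.
          ≤⟨ 𝔼-mono 0≤q q≤1 (λ Z → spread (canon∈Ω Z)) ⟩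
        𝔼 q {N} (λ Z → h * M)
          ≡⟨ 𝔼-const {N = N} (h * M) ⟩
        h * M ∎
        where open ≤-Reasoning

    module SecondMoment {q Q x β : ℚ} (0≤q : 0ℚ ≤ℚ q) (q≤1 : q ≤ℚ 1ℚ) (qQ≡1 : q * Q ≡ 1ℚ) (0≤Q : 0ℚ ≤ℚ Q)
      (0≤x : 0ℚ ≤ℚ x) (Q≤1+x : Q ≤ℚ 1ℚ + x) (0≤β : 0ℚ ≤ℚ β) (k : ℕ)
      (spread : ∀ {τ F} → τ ∈ Ω → F ⊆ E τ → ∣ F ∣ ℕ.≤ k → ∑ Ω (λ ω → (1ℚ + x) ^ ∣ F ∩ E ω ∣) ≤ℚ h * (1ℚ + β))
      (fail : Subset N → ℚ) (fail≤1 : ∀ G → fail G ≤ℚ 1ℚ) (fail≡0 : ∀ {G ω} → ω ∈ Ω → E ω ⊆ G → fail G ≡ 0ℚ)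
      (W : Subset N) where

      private
        1≤1+x : 1ℚ ≤ℚ 1ℚ + x
        1≤1+x = x≤x+ 0≤x

        γ : A → ℚ
        γ ω = good k ω W

        -- Counts the good fragments inside `W′`, each weighted by the inverse of its probability,
        -- so that the mean is the number of good `ω`.
        Y : Subset N → ℚ
        Y W′ = ∑ Ω (λ ω → γ ω * incl Q W′ (frag ω W))

        #good #bad : ℚ
        #good = ∑ Ω γ
        #bad  = ∑ Ω (λ ω → 1ℚ - γ ω)

        #good+#bad : #good + #bad ≡ h
        #good+#bad = trans (sym (∑-+ Ω γ (λ ω → 1ℚ - γ ω))) (trans (∑-cong Ω (λ ω → ring (γ ω))) (trans (∑-const Ω 1ℚ) (*-identityʳ h)))
          where
          ring : ∀ a → a + (1ℚ - a) ≡ 1ℚ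
          ring = solve-∀ ℚ-ring

        0≤#good : 0ℚ ≤ℚ #good
        0≤#good = 0≤∑ Ω (λ ω → 0≤good k ω W)

        0≤#bad : 0ℚ ≤ℚ #bad
        0≤#bad = 0≤∑ Ω (λ ω → 0≤- (good≤1 k ω W))

        #good≤h : #good ≤ℚ h
        #good≤h = subst (#good ≤ℚ_) #good+#bad (x≤x+ 0≤#bad)

        #bad≤h : #bad ≤ℚ h
        #bad≤h = subst (#bad ≤ℚ_) #good+#bad (x≤+x 0≤#good)

        -- If some `E ω` lies in `W ∪ W′`, then `fail` vanishes. Otherwise no fragment lies in `W′`,
        -- as it would complete `best ω W`; then `Y W′` is 0 and misses `h` by the whole of `h`.
        fail≤deviation : ∀ W′ → h * h * fail (W ∪ W′) ≤ℚ (Y W′ - h) * (Y W′ - h)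
        fail≤deviation W′ with any? (λ ω → E ω ⊆? W ∪ W′) Ω
        ... | yes some = let (ω , ω∈Ω , Eω⊆) = find some in
          subst (_≤ℚ (Y W′ - h) * (Y W′ - h)) (sym (trans (cong (h * h *_) (fail≡0 ω∈Ω Eω⊆)) (*-zeroʳ (h * h)))) (0≤sq (Y W′ - h))
        ... | no none = begin
          h * h * fail (W ∪ W′) ≤⟨ *-monoˡ (0≤sq h) (fail≤1 (W ∪ W′)) ⟩
          h * h * 1ℚ ≡⟨ ring h ⟩
          (0ℚ - h) * (0ℚ - h) ≡⟨ cong (λ y → (y - h) * (y - h)) Y≡0 ⟨
          (Y W′ - h) * (Y W′ - h) ∎
          where
          open ≤-Reasoning
          ring : ∀ h → h * h * 1ℚ ≡ (0ℚ - h) * (0ℚ - h)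
          ring = solve-∀ ℚ-ring
          term≡0 : ∀ {ω} → ω ∈ Ω → γ ω * incl Q W′ (frag ω W) ≡ 0ℚ
          term≡0 {ω} ω∈Ω = trans (cong (γ ω *_) (incl-⊈ Q frag⊈)) (*-zeroʳ (γ ω))
            where
            frag⊈ : ¬ (frag ω W ⊆ W′)
            frag⊈ f⊆ = none (lose {P = λ ω → E ω ⊆ W ∪ W′} (proj₁ (best-spec ω∈Ω W)) (λ x∈ → x∈p∪q⁺ ([ inj₁ , inj₂ ∘ f⊆ ]′ (x∈p∪q⁻ W (frag ω W) (E-best⊆ ω W x∈)))))
          Y≡0 : Y W′ ≡ 0ℚ
          Y≡0 = ≤-antisym (subst (Y W′ ≤ℚ_) ∑0 (∑-mono Ω (≤-reflexive ∘ term≡0)))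
                          (subst (_≤ℚ Y W′) ∑0 (∑-mono Ω (≤-reflexive ∘ sym ∘ term≡0)))
            where
            ∑0 : ∑ Ω (λ _ → 0ℚ) ≡ 0ℚ
            ∑0 = trans (∑-const Ω 0ℚ) (*-zeroʳ h)

        𝔼Y : 𝔼 q Y ≡ #good
        𝔼Y = trans (𝔼-∑ Ω (λ ω W′ → γ ω * incl Q W′ (frag ω W)))
          (∑-cong Ω (λ ω → trans (𝔼-*ˡ (γ ω) (λ W′ → incl Q W′ (frag ω W))) (trans (cong (γ ω *_) (𝔼-incl qQ≡1 (frag ω W))) (*-identityʳ (γ ω)))))

        pair : A → A → ℚ
        pair ω ω′ = Q ^ ∣ frag ω W ∩ frag ω′ W ∣

        𝔼YY : 𝔼 q (λ W′ → Y W′ * Y W′) ≡ ∑ Ω (λ ω → γ ω * ∑ Ω (λ ω′ → γ ω′ * pair ω ω′))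
        𝔼YY = begin
          𝔼 q (λ W′ → Y W′ * Y W′)
            ≡⟨ 𝔼-cong (λ W′ → ∑-*ʳ Ω (Y W′) (λ ω → γ ω * I W′ ω)) ⟨
          𝔼 q (λ W′ → ∑ Ω (λ ω → γ ω * I W′ ω * Y W′))
            ≡⟨ 𝔼-cong (λ W′ → ∑-cong Ω (λ ω → ∑-*ˡ Ω (γ ω * I W′ ω) (λ ω′ → γ ω′ * I W′ ω′))) ⟨
          𝔼 q (λ W′ → ∑ Ω (λ ω → ∑ Ω (λ ω′ → γ ω * I W′ ω * (γ ω′ * I W′ ω′))))
            ≡⟨ 𝔼-∑ Ω (λ ω W′ → ∑ Ω (λ ω′ → γ ω * I W′ ω * (γ ω′ * I W′ ω′))) ⟩
          ∑ Ω (λ ω → 𝔼 q (λ W′ → ∑ Ω (λ ω′ → γ ω * I W′ ω * (γ ω′ * I W′ ω′))))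
            ≡⟨ ∑-cong Ω (λ ω → 𝔼-∑ Ω (λ ω′ W′ → γ ω * I W′ ω * (γ ω′ * I W′ ω′))) ⟩
          ∑ Ω (λ ω → ∑ Ω (λ ω′ → 𝔼 q (λ W′ → γ ω * I W′ ω * (γ ω′ * I W′ ω′))))
            ≡⟨ ∑-cong Ω (λ ω → ∑-cong Ω (λ ω′ → expect ω ω′)) ⟩
          ∑ Ω (λ ω → ∑ Ω (λ ω′ → γ ω * (γ ω′ * pair ω ω′)))
            ≡⟨ ∑-cong Ω (λ ω → ∑-*ˡ Ω (γ ω) (λ ω′ → γ ω′ * pair ω ω′)) ⟩
          ∑ Ω (λ ω → γ ω * ∑ Ω (λ ω′ → γ ω′ * pair ω ω′)) ∎
          where
          open ≡-Reasoning
          I : Subset N → A → ℚ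
          I W′ ω = incl Q W′ (frag ω W)
          ring : ∀ a b c d → a * b * (c * d) ≡ a * c * (b * d)
          ring = solve-∀ ℚ-ring
          expect : ∀ ω ω′ → 𝔼 q (λ W′ → γ ω * I W′ ω * (γ ω′ * I W′ ω′)) ≡ γ ω * (γ ω′ * pair ω ω′)
          expect ω ω′ = trans (𝔼-cong (λ W′ → ring (γ ω) (I W′ ω) (γ ω′) (I W′ ω′)))
            (trans (𝔼-*ˡ (γ ω * γ ω′) (λ W′ → I W′ ω * I W′ ω′))
            (trans (cong (γ ω * γ ω′ *_) (𝔼-incl-incl qQ≡1 (frag ω W) (frag ω′ W))) (*-assoc (γ ω) (γ ω′) (pair ω ω′))))

        -- Rearranged, `γ ω′ * (pair ω ω′ - 1) ≤ (1 + x) ^ ∣ frag ω W ∩ E ω′ ∣ - 1` compares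
        -- excesses over 1. The right side is nonnegative, so the sum over good `ω′` may be extended
        -- to all of `Ω`, where spreadness is available.
        pair≤ : ∀ ω {ω′} → ω′ ∈ Ω → γ ω′ * pair ω ω′ + 1ℚ ≤ℚ γ ω′ + (1ℚ + x) ^ ∣ frag ω W ∩ E ω′ ∣
        pair≤ ω {ω′} ω′∈Ω = 0≤-⇒≤ (subst (0ℚ ≤ℚ_) (ring (γ ω′) (pair ω ω′) Z)
          (0≤+ (0≤* (0≤good k ω′ W) (0≤- pair≤Z)) (0≤* (0≤- (good≤1 k ω′ W)) (0≤- (1≤^ ∣ frag ω W ∩ E ω′ ∣ 1≤1+x)))))
          where
          Z : ℚ
          Z = (1ℚ + x) ^ ∣ frag ω W ∩ E ω′ ∣
          ring : ∀ g p z → g * (z - p) + (1ℚ - g) * (z - 1ℚ) ≡ g + z - (g * p + 1ℚ)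
          ring = solve-∀ ℚ-ring
          pair≤Z : pair ω ω′ ≤ℚ Z
          pair≤Z = ≤-trans (^-monoˡ ∣ frag ω W ∩ frag ω′ W ∣ 0≤Q Q≤1+x)
            (^-monoʳ 1≤1+x (p⊆q⇒∣p∣≤∣q∣ (λ x∈ → x∈p∩q⁺ (p∩q⊆p (frag ω W) (frag ω′ W) x∈ , frag⊆E ω′∈Ω W (p∩q⊆q (frag ω W) (frag ω′ W) x∈)))))

        -- Spreadness is available only for fragments of at most `k` elements; for larger ones the
        -- factor `γ ω` makes both sides 0.
        inner : ∀ {ω} → ω ∈ Ω → γ ω * ∑ Ω (λ ω′ → γ ω′ * pair ω ω′) ≤ℚ γ ω * (#good + h * β)
        inner {ω} ω∈Ω with 𝟙-does (∣ frag ω W ∣ ℕ.≤? k)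
        ... | inj₂ (_ , γ≡0) = ≤-reflexive (trans (cong (_* S) γ≡0) (trans (*-zeroˡ S) (trans (sym (*-zeroˡ G)) (cong (_* G) (sym γ≡0)))))
          where
          S G : ℚ
          S = ∑ Ω (λ ω′ → γ ω′ * pair ω ω′)
          G = #good + h * β
        ... | inj₁ (≤k , _) = *-monoˡ (0≤good k ω W) (0≤-⇒≤ (subst (0ℚ ≤ℚ_) (ring h β #good S) (0≤- bound)))
          where
          S : ℚ
          S = ∑ Ω (λ ω′ → γ ω′ * pair ω ω′)
          ring : ∀ h β g s → g + h * (1ℚ + β) - (s + h * 1ℚ) ≡ g + h * β - s
          ring = solve-∀ ℚ-ring
          bound : S + h * 1ℚ ≤ℚ #good + h * (1ℚ + β)
          bound = begin
            S + h * 1ℚ ≡⟨ cong (_+_ S) (∑-const Ω 1ℚ) ⟨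
            S + ∑ Ω (λ _ → 1ℚ) ≡⟨ ∑-+ Ω (λ ω′ → γ ω′ * pair ω ω′) (λ _ → 1ℚ) ⟨
            ∑ Ω (λ ω′ → γ ω′ * pair ω ω′ + 1ℚ) ≤⟨ ∑-mono Ω (pair≤ ω) ⟩
            ∑ Ω (λ ω′ → γ ω′ + (1ℚ + x) ^ ∣ frag ω W ∩ E ω′ ∣) ≡⟨ ∑-+ Ω γ (λ ω′ → (1ℚ + x) ^ ∣ frag ω W ∩ E ω′ ∣) ⟩
            #good + ∑ Ω (λ ω′ → (1ℚ + x) ^ ∣ frag ω W ∩ E ω′ ∣) ≤⟨ +-monoʳ-≤ #good (spread ω∈Ω (frag⊆E ω∈Ω W) ≤k) ⟩
            #good + h * (1ℚ + β) ∎
            where open ≤-Reasoning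

        𝔼YY≤ : 𝔼 q (λ W′ → Y W′ * Y W′) ≤ℚ #good * #good + h * h * β
        𝔼YY≤ = begin
          𝔼 q (λ W′ → Y W′ * Y W′) ≡⟨ 𝔼YY ⟩
          ∑ Ω (λ ω → γ ω * ∑ Ω (λ ω′ → γ ω′ * pair ω ω′)) ≤⟨ ∑-mono Ω inner ⟩
          ∑ Ω (λ ω → γ ω * (#good + h * β)) ≡⟨ ∑-*ʳ Ω (#good + h * β) γ ⟩
          #good * (#good + h * β) ≡⟨ *-distribˡ-+ #good #good (h * β) ⟩
          #good * #good + #good * (h * β) ≤⟨ +-monoʳ-≤ (#good * #good) (*-monoʳ (0≤* (<⇒≤ 0<h) 0≤β) #good≤h) ⟩
          #good * #good + h * (h * β) ≡⟨ cong (_+_ (#good * #good)) (*-assoc h h β) ⟨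
          #good * #good + h * h * β ∎
          where open ≤-Reasoning

        deviation : 𝔼 q (λ W′ → (Y W′ - h) * (Y W′ - h)) ≡ 𝔼 q (λ W′ → Y W′ * Y W′) + (- (h + h) * #good + h * h)
        deviation = begin
          𝔼 q (λ W′ → (Y W′ - h) * (Y W′ - h)) ≡⟨ 𝔼-cong (λ W′ → ring (Y W′) h) ⟩
          𝔼 q (λ W′ → Y W′ * Y W′ + (- (h + h) * Y W′ + h * h)) ≡⟨ 𝔼-+ (λ W′ → Y W′ * Y W′) (λ W′ → - (h + h) * Y W′ + h * h) ⟩
          𝔼 q (λ W′ → Y W′ * Y W′) + 𝔼 q (λ W′ → - (h + h) * Y W′ + h * h)
            ≡⟨ cong (_+_ (𝔼 q (λ W′ → Y W′ * Y W′))) (trans (𝔼-+ (λ W′ → - (h + h) * Y W′) (λ _ → h * h))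
                 (cong₂ _+_ (trans (𝔼-*ˡ (- (h + h)) Y) (cong (- (h + h) *_) 𝔼Y)) (𝔼-const {N = N} (h * h)))) ⟩
          𝔼 q (λ W′ → Y W′ * Y W′) + (- (h + h) * #good + h * h) ∎
          where
          open ≡-Reasoning
          ring : ∀ y h → (y - h) * (y - h) ≡ y * y + (- (h + h) * y + h * h)
          ring = solve-∀ ℚ-ring

      -- Chebyshev around h instead of the mean #good, which trades the variance for the number of bad ω.
      second-moment : h * 𝔼 q (λ W′ → fail (W ∪ W′)) ≤ℚ ∑ Ω (λ ω → 1ℚ - good k ω W) + h * β
      second-moment = *-cancelˡ 0<h (begin
        h * (h * 𝔼 q (λ W′ → fail (W ∪ W′))) ≡⟨ *-assoc h h _ ⟨
        h * h * 𝔼 q (λ W′ → fail (W ∪ W′)) ≡⟨ 𝔼-*ˡ (h * h) (λ W′ → fail (W ∪ W′)) ⟨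
        𝔼 q (λ W′ → h * h * fail (W ∪ W′)) ≤⟨ 𝔼-mono 0≤q q≤1 fail≤deviation ⟩
        𝔼 q (λ W′ → (Y W′ - h) * (Y W′ - h)) ≡⟨ deviation ⟩
        𝔼 q (λ W′ → Y W′ * Y W′) + (- (h + h) * #good + h * h) ≤⟨ +-monoˡ-≤ _ 𝔼YY≤ ⟩
        -- With `h` written as `#good + #bad`, the square of `#good` cancels and only `#bad * #bad`
        -- remains.
        #good * #good + h * h * β + (- (h + h) * #good + h * h) ≡⟨ cong (λ h′ → #good * #good + h * h * β + (- (h′ + h′) * #good + h′ * h′)) (sym #good+#bad) ⟩
        #good * #good + h * h * β + (- (#good + #bad + (#good + #bad)) * #good + (#good + #bad) * (#good + #bad)) ≡⟨ ring #good #bad (h * h * β) ⟩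
        #bad * #bad + h * h * β ≤⟨ +-monoˡ-≤ (h * h * β) (*-monoʳ 0≤#bad #bad≤h) ⟩
        h * #bad + h * h * β ≡⟨ ring₂ h #bad β ⟩
        h * (#bad + h * β) ∎)
        where
        open ≤-Reasoning
        ring : ∀ g b c → g * g + c + (- (g + b + (g + b)) * g + (g + b) * (g + b)) ≡ b * b + c
        ring = solve-∀ ℚ-ring
        ring₂ : ∀ h b β → h * b + h * h * β ≡ h * (b + h * β)
        ring₂ = solve-∀ ℚ-ring

    module TwoRounds {p q q′ X L Q M β δ : ℚ} (k : ℕ) (split : p ≡ q + (1ℚ - q) * q′)
      (0≤q : 0ℚ ≤ℚ q) (q≤1 : q ≤ℚ 1ℚ) (1≤qX : 1ℚ ≤ℚ q * X) (0≤X : 0ℚ ≤ℚ X) (1≤L : 1ℚ ≤ℚ L)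
      (0≤q′ : 0ℚ ≤ℚ q′) (q′≤1 : q′ ≤ℚ 1ℚ) (q′Q≡1 : q′ * Q ≡ 1ℚ) (0≤Q : 0ℚ ≤ℚ Q) (Q≤1+x : Q ≤ℚ 1ℚ + X * L) (0≤β : 0ℚ ≤ℚ β)
      (spread-full : ∀ {τ} → τ ∈ Ω → ∑ Ω (λ ω → (1ℚ + X * L) ^ ∣ E τ ∩ E ω ∣) ≤ℚ h * M)
      (spread-small : ∀ {τ F} → τ ∈ Ω → F ⊆ E τ → ∣ F ∣ ℕ.≤ k → ∑ Ω (λ ω → (1ℚ + X * L) ^ ∣ F ∩ E ω ∣) ≤ℚ h * (1ℚ + β))
      (M-small : ∀ {b} → 0ℚ ≤ℚ b → L ^ k * b ≤ℚ h * M → b ≤ℚ h * δ) where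

      -- The second moment is taken for each fixed `W`, with an error linear in the number of bad
      -- `ω`. So only the mean of that number over `W` is required, and this is what the first round
      -- bounds.
      two-rounds : (fail : Subset N → ℚ) → (∀ G → fail G ≤ℚ 1ℚ) → (∀ {G ω} → ω ∈ Ω → E ω ⊆ G → fail G ≡ 0ℚ) → 𝔼 p fail ≤ℚ δ + β
      two-rounds fail fail≤1 fail≡0 = *-cancelˡ 0<h (begin
        h * 𝔼 p fail ≡⟨ cong (h *_) (𝔼-∪ split fail) ⟩
        h * 𝔼 q (λ W → 𝔼 q′ (λ W′ → fail (W ∪ W′))) ≡⟨ 𝔼-*ˡ h (λ W → 𝔼 q′ (λ W′ → fail (W ∪ W′))) ⟨
        𝔼 q (λ W → h * 𝔼 q′ (λ W′ → fail (W ∪ W′)))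
          ≤⟨ 𝔼-mono 0≤q q≤1 (SecondMoment.second-moment 0≤q′ q′≤1 q′Q≡1 0≤Q (0≤* 0≤X (≤-trans 0≤1 1≤L)) Q≤1+x 0≤β k spread-small fail fail≤1 fail≡0) ⟩
        𝔼 q (λ W → #bad W + h * β) ≡⟨ 𝔼-+ #bad (λ _ → h * β) ⟩
        𝔼 q #bad + 𝔼 q {N} (λ _ → h * β) ≡⟨ cong (_+_ (𝔼 q #bad)) (𝔼-const {N = N} (h * β)) ⟩
        𝔼 q #bad + h * β ≤⟨ +-monoˡ-≤ (h * β) (M-small 0≤𝔼bad (FewBad.few-bad 0≤q q≤1 1≤qX 0≤X 1≤L k spread-full)) ⟩
        h * δ + h * β ≡⟨ *-distribˡ-+ h δ β ⟨
        h * (δ + β) ∎)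
        where
        open ≤-Reasoning
        #bad : Subset N → ℚ
        #bad W = ∑ Ω (λ ω → 1ℚ - good k ω W)
        0≤𝔼bad : 0ℚ ≤ℚ 𝔼 q #bad
        0≤𝔼bad = subst (_≤ℚ 𝔼 q #bad) (𝔼-const {p = q} {N = N} 0ℚ) (𝔼-mono 0≤q q≤1 (λ W → 0≤∑ Ω (λ ω → 0≤- (good≤1 k ω W))))

-- Permutations as pairs of tables, and the exchange argument.

module Permutations where

  open import Data.Nat using (ℕ; zero; suc; _+_; _*_; _≤_; z≤n)
  open import Data.Nat.Properties
  open import Data.Nat.Tactic.RingSolver using (solve-∀)
  open import Data.Fin using (Fin)
  import Data.Fin.Properties as Finₚ
  open import Data.Fin.Permutation.Components using (transpose; transpose-inverse)
  open import Data.List using (List; []; _∷_; map; length; _++_; filter; allFin; cartesianProduct; cartesianProductWith)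
  open import Data.List.Membership.Propositional using (_∈_; _∉_)
  open import Data.List.Membership.Propositional.Properties using (∈-filter⁺; ∈-filter⁻; ∈-∃++; ∈-++⁺ˡ; ∈-++⁺ʳ; ∈-++⁻; ∈-map⁻; ∈-allFin; ∈-cartesianProduct⁺; ∈-cartesianProductWith⁺)
  open import Data.List.Relation.Unary.Any using (here; there)
  open import Data.List.Relation.Unary.All as All using (All; []; _∷_)
  open import Data.List.Relation.Unary.AllPairs using ([]; _∷_)
  open import Data.List.Relation.Unary.Unique.Propositional using (Unique)
  import Data.List.Relation.Unary.Unique.Propositional.Properties as Uniqueₚ
  open import Data.Vec using (Vec; []; _∷_; lookup; tabulate)
  import Data.Vec.Properties as Vecₚ

  private variable
    A B : Set

  ∑ℕ : List A → (A → ℕ) → ℕ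
  ∑ℕ []       f = 0
  ∑ℕ (x ∷ xs) f = f x + ∑ℕ xs f

  ∑ℕ-mono : ∀ (xs : List A) {f g : A → ℕ} → (∀ {a} → a ∈ xs → f a ≤ g a) → ∑ℕ xs f ≤ ∑ℕ xs g
  ∑ℕ-mono []       h = z≤n
  ∑ℕ-mono (x ∷ xs) h = +-mono-≤ (h (here refl)) (∑ℕ-mono xs (h ∘ there))

  ∑ℕ-cong : ∀ (xs : List A) {f g : A → ℕ} → (∀ a → f a ≡ g a) → ∑ℕ xs f ≡ ∑ℕ xs g
  ∑ℕ-cong []       h = refl
  ∑ℕ-cong (x ∷ xs) h = cong₂ _+_ (h x) (∑ℕ-cong xs h)

  ∑ℕ-+ : ∀ (xs : List A) (f g : A → ℕ) → ∑ℕ xs (λ a → f a + g a) ≡ ∑ℕ xs f + ∑ℕ xs g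
  ∑ℕ-+ []       f g = refl
  ∑ℕ-+ (x ∷ xs) f g = trans (cong (f x + g x +_) (∑ℕ-+ xs f g)) (ring (f x) (g x) (∑ℕ xs f) (∑ℕ xs g))
    where
    ring : ∀ a b c d → a + b + (c + d) ≡ a + c + (b + d)
    ring = solve-∀

  ∑ℕ-*ˡ : ∀ (xs : List A) c (f : A → ℕ) → ∑ℕ xs (λ a → c * f a) ≡ c * ∑ℕ xs f
  ∑ℕ-*ˡ []       c f = sym (*-zeroʳ c)
  ∑ℕ-*ˡ (x ∷ xs) c f = trans (cong (c * f x +_) (∑ℕ-*ˡ xs c f)) (sym (*-distribˡ-+ c (f x) (∑ℕ xs f)))

  ∑ℕ-const : ∀ (xs : List A) c → ∑ℕ xs (λ _ → c) ≡ length xs * c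
  ∑ℕ-const []       c = refl
  ∑ℕ-const (x ∷ xs) c = cong (c +_) (∑ℕ-const xs c)

  ∑ℕ-swap : ∀ (xs : List A) (ys : List B) (f : A → B → ℕ) →
    ∑ℕ xs (λ a → ∑ℕ ys (f a)) ≡ ∑ℕ ys (λ b → ∑ℕ xs (λ a → f a b))
  ∑ℕ-swap []       ys f = sym (trans (∑ℕ-const ys 0) (*-zeroʳ (length ys)))
  ∑ℕ-swap (x ∷ xs) ys f = trans (cong (∑ℕ ys (f x) +_) (∑ℕ-swap xs ys f)) (sym (∑ℕ-+ ys (f x) (λ b → ∑ℕ xs (λ a → f a b))))

  ∑ℕ-++ : ∀ (xs ys : List A) (f : A → ℕ) → ∑ℕ (xs ++ ys) f ≡ ∑ℕ xs f + ∑ℕ ys f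
  ∑ℕ-++ []       ys f = refl
  ∑ℕ-++ (x ∷ xs) ys f = trans (cong (f x +_) (∑ℕ-++ xs ys f)) (sym (+-assoc (f x) _ _))

  ∑ℕ-map : ∀ (g : A → B) (xs : List A) (f : B → ℕ) → ∑ℕ (map g xs) f ≡ ∑ℕ xs (f ∘ g)
  ∑ℕ-map g []       f = refl
  ∑ℕ-map g (x ∷ xs) f = cong (f (g x) +_) (∑ℕ-map g xs f)

  ∑ℕ-⊆ : ∀ {xs ys : List A} (f : A → ℕ) → Unique ys → (∀ {y} → y ∈ ys → y ∈ xs) → ∑ℕ ys f ≤ ∑ℕ xs f
  ∑ℕ-⊆ {ys = []} f uniq ys⊆xs = z≤n
  ∑ℕ-⊆ {xs = xs} {y ∷ ys} f (y∉ys ∷ uniq) ys⊆xs with ∈-∃++ (ys⊆xs (here refl))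
  ... | as , bs , refl = begin
    f y + ∑ℕ ys f ≤⟨ +-monoʳ-≤ (f y) (∑ℕ-⊆ f uniq ys⊆as++bs) ⟩
    f y + ∑ℕ (as ++ bs) f ≡⟨ cong (f y +_) (∑ℕ-++ as bs f) ⟩
    f y + (∑ℕ as f + ∑ℕ bs f) ≡⟨ ring (f y) (∑ℕ as f) (∑ℕ bs f) ⟩
    ∑ℕ as f + (f y + ∑ℕ bs f) ≡⟨ ∑ℕ-++ as (y ∷ bs) f ⟨
    ∑ℕ (as ++ y ∷ bs) f ∎
    where
    open ≤-Reasoning
    ring : ∀ a b c → a + (b + c) ≡ b + (a + c)
    ring = solve-∀
    ys⊆as++bs : ∀ {x} → x ∈ ys → x ∈ as ++ bs
    ys⊆as++bs x∈ys with ∈-++⁻ as (ys⊆xs (there x∈ys))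
    ... | inj₁ x∈as         = ∈-++⁺ˡ x∈as
    ... | inj₂ (here refl)  = contradiction refl (All.lookup y∉ys x∈ys)
    ... | inj₂ (there x∈bs) = ∈-++⁺ʳ as x∈bs

  -- Injectivity sends the entries of `xs` to distinct entries of `ys`. Applied with `φ` an exchange
  -- of two vertices, and with `φ` the positions of a permutation.
  ∑ℕ-reindex : ∀ {xs : List A} {ys : List B} (φ : A → B) (f : B → ℕ) → Unique xs →
    (∀ {a a′} → a ∈ xs → a′ ∈ xs → φ a ≡ φ a′ → a ≡ a′) → (∀ {a} → a ∈ xs → φ a ∈ ys) →
    ∑ℕ xs (f ∘ φ) ≤ ∑ℕ ys f
  ∑ℕ-reindex {xs = xs} {ys} φ f uniq inj into = subst (_≤ ∑ℕ ys f) (∑ℕ-map φ xs f)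
    (∑ℕ-⊆ f (unique-map uniq inj) (λ y∈ → let (a , a∈ , y≡) = ∈-map⁻ φ y∈ in subst (_∈ ys) (sym y≡) (into a∈)))
    where
    unique-map : ∀ {xs} → Unique xs → (∀ {a a′} → a ∈ xs → a′ ∈ xs → φ a ≡ φ a′ → a ≡ a′) → Unique (map φ xs)
    unique-map []             inj = []
    unique-map (x∉xs ∷ uniq) inj =
      All.tabulate (λ y∈ φx≡y → let (a , a∈ , y≡) = ∈-map⁻ φ y∈ in All.lookup x∉xs a∈ (inj (here refl) (there a∈) (trans φx≡y y≡)))
      ∷ unique-map uniq (λ a∈ a′∈ → inj (there a∈) (there a′∈))

  -- A table of the positions of vertices together with a table of the vertices at positions. The
  -- inverse is kept as data, and vectors make pointwise equal permutations equal.
  Perm : ℕ → Set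
  Perm n = Vec (Fin n) n × Vec (Fin n) n

  pos vert : ∀ {n} → Perm n → Fin n → Fin n
  pos  (π , σ) = lookup π
  vert (π , σ) = lookup σ

  Inverse : ∀ {n} → Perm n → Set
  Inverse ω = (∀ v → vert ω (pos ω v) ≡ v) × (∀ i → pos ω (vert ω i) ≡ i)

  inverse? : ∀ {n} (ω : Perm n) → Dec (Inverse ω)
  inverse? ω = Finₚ.all? (λ v → vert ω (pos ω v) Finₚ.≟ v) ×-dec Finₚ.all? (λ i → pos ω (vert ω i) Finₚ.≟ i)

  allVecs : ∀ n k → List (Vec (Fin n) k)
  allVecs n zero    = [] ∷ []
  allVecs n (suc k) = cartesianProductWith _∷_ (allFin n) (allVecs n k)

  allVecs-unique : ∀ n k → Unique (allVecs n k)
  allVecs-unique n zero    = [] ∷ []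
  allVecs-unique n (suc k) = Uniqueₚ.cartesianProductWith⁺ _∷_ Vecₚ.∷-injective (Uniqueₚ.allFin⁺ n) (allVecs-unique n k)

  ∈-allVecs : ∀ {n k} (v : Vec (Fin n) k) → v ∈ allVecs n k
  ∈-allVecs []      = here refl
  ∈-allVecs (x ∷ v) = ∈-cartesianProductWith⁺ _∷_ (∈-allFin x) (∈-allVecs v)

  perms : ∀ n → List (Perm n)
  perms n = filter inverse? (cartesianProduct (allVecs n n) (allVecs n n))

  perms-unique : ∀ n → Unique (perms n)
  perms-unique n = Uniqueₚ.filter⁺ inverse? (Uniqueₚ.cartesianProduct⁺ (allVecs-unique n n) (allVecs-unique n n))

  ∈-perms⁺ : ∀ {n} {ω : Perm n} → Inverse ω → ω ∈ perms n
  ∈-perms⁺ {ω = π , σ} = ∈-filter⁺ inverse? (∈-cartesianProduct⁺ (∈-allVecs π) (∈-allVecs σ))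

  ∈-perms⁻ : ∀ {n} {ω : Perm n} → ω ∈ perms n → Inverse ω
  ∈-perms⁻ {n} ω∈ = proj₂ (∈-filter⁻ inverse? {xs = cartesianProduct (allVecs n n) (allVecs n n)} ω∈)

  pos-injective : ∀ {n} {ω : Perm n} → ω ∈ perms n → ∀ {v w} → pos ω v ≡ pos ω w → v ≡ w
  pos-injective {ω = ω} ω∈ {v} {w} e = trans (sym (proj₁ (∈-perms⁻ ω∈) v)) (trans (cong (vert ω) e) (proj₁ (∈-perms⁻ ω∈) w))

  idPerm : ∀ n → Perm n
  idPerm n = tabulate id , tabulate id

  idPerm∈ : ∀ n → idPerm n ∈ perms n
  idPerm∈ n = ∈-perms⁺ {ω = idPerm n} (both , both)
    where
    both : ∀ i → lookup (tabulate id) (lookup (tabulate id) i) ≡ i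
    both i = trans (Vecₚ.lookup∘tabulate id _) (Vecₚ.lookup∘tabulate id i)

  -- The vertices `u` and `w` trade places: the transposition acts before looking up a position and
  -- after looking up a vertex.
  exchange : ∀ {n} → Fin n → Fin n → Perm n → Perm n
  exchange u w (π , σ) = tabulate (lookup π ∘ transpose u w) , tabulate (transpose w u ∘ lookup σ)

  pos-exchange : ∀ {n} (u w : Fin n) ω v → pos (exchange u w ω) v ≡ pos ω (transpose u w v)
  pos-exchange u w (π , σ) = Vecₚ.lookup∘tabulate (lookup π ∘ transpose u w)

  vert-exchange : ∀ {n} (u w : Fin n) ω i → vert (exchange u w ω) i ≡ transpose w u (vert ω i)
  vert-exchange u w (π , σ) = Vecₚ.lookup∘tabulate (transpose w u ∘ lookup σ)

  exchange∈ : ∀ {n} (u w : Fin n) {ω} → ω ∈ perms n → exchange u w ω ∈ perms n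
  exchange∈ {n} u w {ω} ω∈ = ∈-perms⁺ {ω = exchange u w ω} (vp , pv)
    where
    vp : ∀ v → vert (exchange u w ω) (pos (exchange u w ω) v) ≡ v
    vp v = trans (vert-exchange u w ω _) (trans (cong (transpose w u ∘ vert ω) (pos-exchange u w ω v))
      (trans (cong (transpose w u) (proj₁ (∈-perms⁻ ω∈) _)) (transpose-inverse w u)))
    pv : ∀ i → pos (exchange u w ω) (vert (exchange u w ω) i) ≡ i
    pv i = trans (pos-exchange u w ω _) (trans (cong (pos ω ∘ transpose u w) (vert-exchange u w ω i))
      (trans (cong (pos ω) (transpose-inverse u w)) (proj₂ (∈-perms⁻ ω∈) i)))

  perm-ext : ∀ {n} {ω ω′ : Perm n} → ω ∈ perms n → ω′ ∈ perms n → (∀ v → pos ω v ≡ pos ω′ v) → ω ≡ ω′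
  perm-ext {ω = ω@(π , σ)} {ω′@(π′ , σ′)} ω∈ ω′∈ e = cong₂ _,_ (vec-ext e) (vec-ext σ≡)
    where
    vec-ext : ∀ {k n} {v w : Vec (Fin k) n} → (∀ i → lookup v i ≡ lookup w i) → v ≡ w
    vec-ext {v = v} {w} e = trans (sym (Vecₚ.tabulate∘lookup v)) (trans (Vecₚ.tabulate-cong e) (Vecₚ.tabulate∘lookup w))
    σ≡ : ∀ i → lookup σ i ≡ lookup σ′ i
    σ≡ i = trans (sym (proj₁ (∈-perms⁻ ω′∈) _)) (cong (lookup σ′) (trans (sym (e _)) (proj₂ (∈-perms⁻ ω∈) i)))

  exchange-injective : ∀ {n} (u w : Fin n) {ω ω′} → ω ∈ perms n → ω′ ∈ perms n → exchange u w ω ≡ exchange u w ω′ → ω ≡ ω′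
  exchange-injective u w {ω} {ω′} ω∈ ω′∈ e = perm-ext ω∈ ω′∈ λ v →
    trans (cong (pos ω) (sym (transpose-inverse u w)))
      (trans (sym (pos-exchange u w ω _)) (trans (cong (λ ρ → pos ρ (transpose w u v)) e)
      (trans (pos-exchange u w ω′ _) (cong (pos ω′) (transpose-inverse u w)))))

  transpose-fixes : ∀ {n} {u w v : Fin n} → v ≢ u → v ≢ w → transpose u w v ≡ v
  transpose-fixes {u = u} {w} {v} v≢u v≢w rewrite dec-false (v Finₚ.≟ u) v≢u | dec-false (v Finₚ.≟ w) v≢w = refl

  transpose-swaps : ∀ {n} (u w : Fin n) → transpose u w w ≡ u
  transpose-swaps u w with w Finₚ.≟ u
  ... | yes refl = refl
  ... | no w≢u rewrite dec-true (w Finₚ.≟ w) refl = refl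

  module Exchange {n : ℕ} (κ : Fin n → Fin n → ℕ) (D : ℕ) (rows : ∀ i → ∑ℕ (allFin n) (κ i) ≤ D) where

    -- Exchanging u with any vertex of us preserves F and the position of v, so all these vertices
    -- are equally likely to be related to v, and at most D vertices are.
    exchange-bound : (F : Perm n → ℕ) {us : List (Fin n)} {u v : Fin n} → Unique us → u ∈ us → v ∉ us →
      (∀ {w} → w ∈ us → ∀ ω → F (exchange u w ω) ≡ F ω) →
      length us * ∑ℕ (perms n) (λ ω → κ (pos ω v) (pos ω u) * F ω) ≤ D * ∑ℕ (perms n) F
    exchange-bound F {us} {u} {v} uniq u∈us v∉us invariant = begin
      length us * S u ≡⟨ ∑ℕ-const us (S u) ⟨
      ∑ℕ us (λ _ → S u) ≤⟨ ∑ℕ-mono us S-mono ⟩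
      ∑ℕ us S ≡⟨ ∑ℕ-swap us (perms n) (λ w ω → κ (pos ω v) (pos ω w) * F ω) ⟩
      ∑ℕ (perms n) (λ ω → ∑ℕ us (λ w → κ (pos ω v) (pos ω w) * F ω)) ≤⟨ ∑ℕ-mono (perms n) row ⟩
      ∑ℕ (perms n) (λ ω → D * F ω) ≡⟨ ∑ℕ-*ˡ (perms n) D F ⟩
      D * ∑ℕ (perms n) F ∎
      where
      open ≤-Reasoning
      S : Fin n → ℕ
      S w = ∑ℕ (perms n) (λ ω → κ (pos ω v) (pos ω w) * F ω)
      ≢v : ∀ {w} → w ∈ us → v ≢ w
      ≢v w∈ refl = v∉us w∈
      S-mono : ∀ {w} → w ∈ us → S u ≤ S w
      S-mono {w} w∈ = subst (_≤ S w)
        (∑ℕ-cong (perms n) (λ ω → cong₂ _*_ (cong₂ κ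
          (trans (pos-exchange u w ω v) (cong (pos ω) (transpose-fixes (≢v u∈us) (≢v w∈))))
          (trans (pos-exchange u w ω w) (cong (pos ω) (transpose-swaps u w)))) (invariant w∈ ω)))
        (∑ℕ-reindex (exchange u w) (λ ω → κ (pos ω v) (pos ω w) * F ω) (perms-unique n) (exchange-injective u w) (exchange∈ u w))
      row : ∀ {ω} → ω ∈ perms n → ∑ℕ us (λ w → κ (pos ω v) (pos ω w) * F ω) ≤ D * F ω
      row {ω} ω∈ = begin
        ∑ℕ us (λ w → κ (pos ω v) (pos ω w) * F ω) ≡⟨ ∑ℕ-cong us (λ w → *-comm (κ (pos ω v) (pos ω w)) (F ω)) ⟩
        ∑ℕ us (λ w → F ω * κ (pos ω v) (pos ω w)) ≡⟨ ∑ℕ-*ˡ us (F ω) (λ w → κ (pos ω v) (pos ω w)) ⟩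
        -- Distinct vertices have distinct positions, so the sum over `us` is dominated by a full
        -- row of `κ`.
        F ω * ∑ℕ us (λ w → κ (pos ω v) (pos ω w)) ≤⟨ *-monoʳ-≤ (F ω) (∑ℕ-reindex (pos ω) (κ (pos ω v)) uniq (λ _ _ → pos-injective ω∈) (λ _ → ∈-allFin _)) ⟩
        F ω * ∑ℕ (allFin n) (κ (pos ω v)) ≤⟨ *-monoʳ-≤ (F ω) (rows (pos ω v)) ⟩
        F ω * D ≡⟨ *-comm (F ω) D ⟩
        D * F ω ∎

-- The probability that a chain of links is realised.

module LinkCounting where

  open import Data.Nat using (ℕ; zero; suc; _+_; _*_; _^_; _≤_; _<_; z≤n; s≤s; ⌊_/2⌋; ⌈_/2⌉)
  open import Data.Nat.Properties
  open import Data.Nat.Tactic.RingSolver using (solve-∀)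
  open import Data.Fin using (Fin)
  import Data.Fin.Properties as Finₚ
  open import Data.List using (List; []; _∷_; map; length; filter; allFin)
  import Data.List.Properties as Listₚ
  open import Data.List.Membership.Propositional using (_∈_; _∉_)
  open import Data.List.Membership.Propositional.Properties using (∈-filter⁻)
  open import Data.List.Relation.Unary.Any using (here; there)
  open import Data.List.Relation.Unary.All as All using (All; []; _∷_)
  open import Data.List.Relation.Unary.AllPairs using ([]; _∷_)
  open import Data.List.Relation.Unary.Unique.Propositional using (Unique)
  import Data.List.Relation.Unary.Unique.Propositional.Properties as Uniqueₚ
  open import Data.Vec using (Vec; []; _∷_; tabulate)
  open Permutations

  ^-distribʳ-* : ∀ r m n → (m * n) ^ r ≡ m ^ r * n ^ r
  ^-distribʳ-* zero    m n = refl
  ^-distribʳ-* (suc r) m n = trans (cong (m * n *_) (^-distribʳ-* r m n)) (ring m n (m ^ r) (n ^ r))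
    where
    ring : ∀ m n a b → m * n * (a * b) ≡ m * a * (n * b)
    ring = solve-∀

  -- The product of `z + 1` up to `z + r`. Each link removed from a chain frees its upper vertex and
  -- lengthens the list of exchangeable vertices by one, so the factors increase.
  rising : ℕ → ℕ → ℕ
  rising z zero    = 1
  rising z (suc r) = suc z * rising (suc z) r

  rising-last : ∀ z r → rising z (suc r) ≡ rising z r * suc (z + r)
  rising-last z zero    = trans (*-identityʳ (suc z)) (trans (cong suc (sym (+-identityʳ z))) (sym (*-identityˡ (suc (z + 0)))))
  rising-last z (suc r) = begin
    suc z * rising (suc z) (suc r) ≡⟨ cong (suc z *_) (rising-last (suc z) r) ⟩
    suc z * (rising (suc z) r * suc (suc z + r)) ≡⟨ *-assoc (suc z) (rising (suc z) r) (suc (suc z + r)) ⟨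
    rising z (suc r) * suc (suc z + r) ≡⟨ cong (λ k → rising z (suc r) * suc k) (+-suc z r) ⟨
    rising z (suc r) * suc (z + suc r) ∎
    where open ≡-Reasoning

  -- Bernoulli's inequality for `(1 - 1 / (m + 1)) ^ r`, multiplied by `suc m ^ suc r`.
  bernoulli : ∀ m r → suc m ^ r * suc m ≤ m ^ r * suc m + r * suc m ^ r
  bernoulli m zero    = ≤-reflexive (sym (+-identityʳ _))
  bernoulli m (suc r) = begin
    suc m * P * suc m ≡⟨ ring₁ m P ⟩
    m * (P * suc m) + P * suc m ≤⟨ +-monoˡ-≤ (P * suc m) (*-monoʳ-≤ m (bernoulli m r)) ⟩
    m * (M * suc m + r * P) + P * suc m ≤⟨ m≤m+n _ (r * P) ⟩
    m * (M * suc m + r * P) + P * suc m + r * P ≡⟨ ring₂ m r P M ⟩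
    m * M * suc m + suc r * (suc m * P) ∎
    where
    open ≤-Reasoning
    P = suc m ^ r
    M = m ^ r
    ring₁ : ∀ m P → (1 + m) * P * (1 + m) ≡ m * (P * (1 + m)) + P * (1 + m)
    ring₁ = solve-∀
    ring₂ : ∀ m r P M → m * (M * (1 + m) + r * P) + P * (1 + m) + r * P ≡ m * M * (1 + m) + (1 + r) * ((1 + m) * P)
    ring₂ = solve-∀

  suc-^-≤2 : ∀ m r → 2 * r ≤ suc m → suc m ^ r ≤ 2 * m ^ r
  suc-^-≤2 m r 2r≤ = *-cancelʳ-≤ P (2 * M) (suc m) (+-cancelʳ-≤ (P * suc m) (P * suc m) (2 * M * suc m) (begin
    P * suc m + P * suc m ≡⟨ ring₁ (P * suc m) ⟩
    2 * (P * suc m) ≤⟨ *-monoʳ-≤ 2 (bernoulli m r) ⟩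
    2 * (M * suc m + r * P) ≡⟨ ring₂ M (suc m) r P ⟩
    2 * M * suc m + P * (2 * r) ≤⟨ +-monoʳ-≤ (2 * M * suc m) (*-monoʳ-≤ P 2r≤) ⟩
    2 * M * suc m + P * suc m ∎))
    where
    open ≤-Reasoning
    P = suc m ^ r
    M = m ^ r
    ring₁ : ∀ a → a + a ≡ 2 * a
    ring₁ = solve-∀
    ring₂ : ∀ M k r P → 2 * (M * k + r * P) ≡ 2 * M * k + P * (2 * r)
    ring₂ = solve-∀

  -- Plays the role of `(1 + 1 / m) ^ m ≤ e`. Bernoulli's inequality yields the factor 2 for
  -- exponents up to half of `m + 1`, so the exponent is cut into two halves.
  suc-^-≤4 : ∀ m r → r ≤ m → suc m ^ r ≤ 4 * m ^ r
  suc-^-≤4 m r r≤m = begin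
    suc m ^ r ≡⟨ cong (suc m ^_) (⌊n/2⌋+⌈n/2⌉≡n r) ⟨
    suc m ^ (⌊ r /2⌋ + ⌈ r /2⌉) ≡⟨ ^-distribˡ-+-* (suc m) ⌊ r /2⌋ ⌈ r /2⌉ ⟩
    suc m ^ ⌊ r /2⌋ * suc m ^ ⌈ r /2⌉ ≤⟨ *-mono-≤ (suc-^-≤2 m ⌊ r /2⌋ (≤-trans (halves r) (≤-trans r≤m (n≤1+n m))))
                                                            (suc-^-≤2 m ⌈ r /2⌉ (≤-trans (halves (suc r)) (s≤s r≤m))) ⟩
    2 * m ^ ⌊ r /2⌋ * (2 * m ^ ⌈ r /2⌉) ≡⟨ ring (m ^ ⌊ r /2⌋) (m ^ ⌈ r /2⌉) ⟩
    4 * (m ^ ⌊ r /2⌋ * m ^ ⌈ r /2⌉) ≡⟨ cong (4 *_) (^-distribˡ-+-* m ⌊ r /2⌋ ⌈ r /2⌉) ⟨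
    4 * m ^ (⌊ r /2⌋ + ⌈ r /2⌉) ≡⟨ cong (λ k → 4 * m ^ k) (⌊n/2⌋+⌈n/2⌉≡n r) ⟩
    4 * m ^ r ∎
    where
    open ≤-Reasoning
    halves : ∀ r → 2 * ⌊ r /2⌋ ≤ r
    halves r = subst (2 * ⌊ r /2⌋ ≤_) (⌊n/2⌋+⌈n/2⌉≡n r)
      (+-monoʳ-≤ ⌊ r /2⌋ (subst (_≤ ⌈ r /2⌉) (sym (+-identityʳ ⌊ r /2⌋)) (⌊n/2⌋≤⌈n/2⌉ r)))
    ring : ∀ a b → 2 * a * (2 * b) ≡ 4 * (a * b)
    ring = solve-∀

  -- The analogue of `r ^ r ≤ 4 ^ r * r!`. In the induction, raising the base by one costs at most a
  -- factor 4, and the new last factor of `rising` is the new base.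
  ^≤4^*rising : ∀ z r → (z + r) ^ r ≤ 4 ^ r * rising z r
  ^≤4^*rising z zero    = ≤-refl
  ^≤4^*rising z (suc r) = begin
    (z + suc r) ^ suc r ≡⟨ cong (_^ suc r) (+-suc z r) ⟩
    suc (z + r) * suc (z + r) ^ r ≤⟨ *-monoʳ-≤ (suc (z + r)) (suc-^-≤4 (z + r) r (m≤n+m r z)) ⟩
    suc (z + r) * (4 * (z + r) ^ r) ≤⟨ *-monoʳ-≤ (suc (z + r)) (*-monoʳ-≤ 4 (^≤4^*rising z r)) ⟩
    suc (z + r) * (4 * (4 ^ r * rising z r)) ≡⟨ ring (suc (z + r)) (4 ^ r) (rising z r) ⟩
    4 * 4 ^ r * (rising z r * suc (z + r)) ≡⟨ cong (4 ^ suc r *_) (rising-last z r) ⟨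
    4 ^ suc r * rising z (suc r) ∎
    where
    open ≤-Reasoning
    ring : ∀ a b c → a * (4 * (b * c)) ≡ 4 * b * (c * a)
    ring = solve-∀

  -- Since `r` links touch at most `2 * r` vertices, `z + 2 * r ≥ n`, so `z + r` is at least half of
  -- `n` even when the links leave no vertex free.
  ^≤8^*rising : ∀ {n} z r → n ≤ 2 * (z + r) → n ^ r ≤ 8 ^ r * rising z r
  ^≤8^*rising {n} z r n≤ = begin
    n ^ r ≤⟨ ^-monoˡ-≤ r n≤ ⟩
    (2 * (z + r)) ^ r ≡⟨ ^-distribʳ-* r 2 (z + r) ⟩
    2 ^ r * (z + r) ^ r ≤⟨ *-monoʳ-≤ (2 ^ r) (^≤4^*rising z r) ⟩
    2 ^ r * (4 ^ r * rising z r) ≡⟨ *-assoc (2 ^ r) (4 ^ r) (rising z r) ⟨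
    2 ^ r * 4 ^ r * rising z r ≡⟨ cong (_* rising z r) (^-distribʳ-* r 2 4) ⟨
    8 ^ r * rising z r ∎
    where
    open ≤-Reasoning

  -- The state of a vertex u ≥ 2 records which of its back edges (u , u - 1) and (u , u - 2) are present.
  -- If the vertex above u has both of them, then u is forced within two steps of u - 1 even when its own state is none;
  -- the Boolean b passed down along a state vector records this.
  data State : Set where
    none one two both : State

  linked : Bool → State → Bool
  linked true  _    = true
  linked false none = false
  linked false _    = true

  isBoth : State → Bool
  isBoth both = true
  isBoth _    = false

  -- The lower end of the link made for vertex `2 + m`. A vertex in state `none` that is forced from
  -- above is linked to the vertex just below it, which is the other back neighbour of the vertex
  -- above.
  parent : ℕ → State → ℕ
  parent m two = m
  parent m _   = suc m

  parent< : ∀ m s → parent m s < 2 + m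
  parent< m none = ≤-refl
  parent< m one  = ≤-refl
  parent< m two  = n≤1+n (suc m)
  parent< m both = ≤-refl

  rank : ∀ {m} → Bool → Vec State m → ℕ
  -- Vertices 0 and 1 carry no state; they become linked when vertex 2 has both back edges.
  rank b []      = if b then 1 else 0
  rank b (s ∷ ss) = if linked b s then suc (rank (isBoth s) ss) else rank (isBoth s) ss

  without : ∀ {n} → List (Fin n) → List (Fin n) → List (Fin n)
  without []       xs = xs
  without (t ∷ ts) xs = filter (λ x → ¬? (x Finₚ.≟ t)) (without ts xs)

  without-unique : ∀ {n} ts {xs : List (Fin n)} → Unique xs → Unique (without ts xs)
  without-unique []       uniq = uniq
  without-unique (t ∷ ts) uniq = Uniqueₚ.filter⁺ (λ x → ¬? (x Finₚ.≟ t)) (without-unique ts uniq)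

  without-∉ : ∀ {n} ts {xs : List (Fin n)} {t} → t ∈ ts → t ∉ without ts xs
  without-∉ (t ∷ ts) {xs} (here refl) t∈′ = proj₂ (∈-filter⁻ (λ x → ¬? (x Finₚ.≟ t)) {xs = without ts xs} t∈′) refl
  without-∉ (t ∷ ts) {xs} (there t∈)  t∈′ = without-∉ ts t∈ (proj₁ (∈-filter⁻ (λ x → ¬? (x Finₚ.≟ t)) {xs = without ts xs} t∈′))

  length-without : ∀ {n} ts {xs : List (Fin n)} → Unique xs → length xs ≤ length (without ts xs) + length ts
  length-without []       uniq = m≤m+n _ 0
  length-without (t ∷ ts) {xs} uniq = begin
    length xs ≤⟨ length-without ts uniq ⟩
    length (without ts xs) + length ts ≤⟨ +-monoˡ-≤ (length ts) (remove (without-unique ts uniq)) ⟩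
    suc (length (without (t ∷ ts) xs)) + length ts ≡⟨ +-suc _ (length ts) ⟨
    length (without (t ∷ ts) xs) + suc (length ts) ∎
    where
    open ≤-Reasoning
    remove : ∀ {ys} → Unique ys → length ys ≤ suc (length (filter (λ x → ¬? (x Finₚ.≟ t)) ys))
    remove [] = z≤n
    remove {y ∷ ys} (y∉ ∷ uniq) with y Finₚ.≟ t
    ... | no  _    = s≤s (remove uniq)
    ... | yes refl = s≤s (≤-reflexive (cong length (sym (Listₚ.filter-all (λ x → ¬? (x Finₚ.≟ y)) (All.map (λ y≢x → y≢x ∘ sym) y∉)))))

  module Chains {n : ℕ} (κ : Fin n → Fin n → ℕ) (D : ℕ) (rows : ∀ i → ∑ℕ (allFin n) (κ i) ≤ D)
    (a : ℕ → Fin n) (a-injective : ∀ {u v} → u < n → v < n → a u ≡ a v → u ≡ v) where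

    open Exchange κ D rows

    -- The upper vertex `a u` supplies the second argument of `κ`, so that a sum over its
    -- replacements is part of a row.
    link : ℕ → ℕ → Perm n → ℕ
    link u v ω = κ (pos ω (a v)) (pos ω (a u))

    -- A product of counts that dominates the indicator of all chosen edges being present. Every
    -- vertex is the upper end of at most one link, so the links form a forest.
    chain : ∀ {m} → Bool → Vec State m → Perm n → ℕ
    chain b []              ω = if b then link 1 0 ω * 1 else 1
    chain {suc m} b (s ∷ ss) ω = if linked b s then link (2 + m) (parent m s) ω * chain (isBoth s) ss ω else chain (isBoth s) ss ω

    touched : ∀ {m} → Bool → Vec State m → List (Fin n)
    touched b []               = if b then a 1 ∷ a 0 ∷ [] else []
    touched {suc m} b (s ∷ ss) = if linked b s then a (2 + m) ∷ a (parent m s) ∷ touched (isBoth s) ss else touched (isBoth s) ss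

    length-touched : ∀ {m} b (ss : Vec State m) → length (touched b ss) ≡ 2 * rank b ss
    length-touched true  [] = refl
    length-touched false [] = refl
    length-touched b (s ∷ ss) with linked b s
    ... | true  = trans (cong (2 +_) (length-touched (isBoth s) ss)) (sym (*-suc 2 (rank (isBoth s) ss)))
    ... | false = length-touched (isBoth s) ss

    touched-below : ∀ {m} b (ss : Vec State m) {v} → v ∈ touched b ss → ∃ λ i → i < 2 + m × v ≡ a i
    touched-below true  [] (here refl)         = 1 , ≤-refl , refl
    touched-below true  [] (there (here refl)) = 0 , s≤s z≤n , refl
    touched-below {suc m} b (s ∷ ss) v∈ with linked b s
    touched-below {suc m} b (s ∷ ss) (here refl)         | true = 2 + m , ≤-refl , refl
    touched-below {suc m} b (s ∷ ss) (there (here refl)) | true = parent m s , ≤-trans (parent< m s) (n≤1+n _) , refl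
    touched-below {suc m} b (s ∷ ss) (there (there v∈))  | true =
      let (i , i< , v≡) = touched-below (isBoth s) ss v∈ in i , ≤-trans i< (n≤1+n _) , v≡
    touched-below {suc m} b (s ∷ ss) v∈                  | false =
      let (i , i< , v≡) = touched-below (isBoth s) ss v∈ in i , ≤-trans i< (n≤1+n _) , v≡

    link-exchange : ∀ {x y u w} i j → x ≡ a i → y ≡ a j → u ≢ x → w ≢ x → u ≢ y → w ≢ y → ∀ ω →
      link i j (exchange u w ω) ≡ link i j ω
    link-exchange {u = u} {w} i j refl refl u≢x w≢x u≢y w≢y ω = cong₂ κ
      (trans (pos-exchange u w ω (a j)) (cong (pos ω) (transpose-fixes (u≢y ∘ sym) (w≢y ∘ sym))))
      (trans (pos-exchange u w ω (a i)) (cong (pos ω) (transpose-fixes (u≢x ∘ sym) (w≢x ∘ sym))))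

    ∉⇒≢ : ∀ {u t : Fin n} {ts} → u ∉ ts → t ∈ ts → u ≢ t
    ∉⇒≢ u∉ t∈ refl = u∉ t∈

    chain-exchange : ∀ {m} b (ss : Vec State m) {u w} → u ∉ touched b ss → w ∉ touched b ss → ∀ ω →
      chain b ss (exchange u w ω) ≡ chain b ss ω
    chain-exchange true  [] u∉ w∉ ω = cong (_* 1) (link-exchange 1 0 refl refl
      (∉⇒≢ u∉ (here refl)) (∉⇒≢ w∉ (here refl)) (∉⇒≢ u∉ (there (here refl))) (∉⇒≢ w∉ (there (here refl))) ω)
    chain-exchange false [] u∉ w∉ ω = refl
    chain-exchange {suc m} b (s ∷ ss) u∉ w∉ ω with linked b s
    ... | true  = cong₂ _*_ (link-exchange (2 + m) (parent m s) refl refl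
      (∉⇒≢ u∉ (here refl)) (∉⇒≢ w∉ (here refl)) (∉⇒≢ u∉ (there (here refl))) (∉⇒≢ w∉ (there (here refl))) ω)
      (chain-exchange (isBoth s) ss (u∉ ∘ there ∘ there) (w∉ ∘ there ∘ there) ω)
    ... | false = chain-exchange (isBoth s) ss u∉ w∉ ω

    -- The top vertex `a (suc m)` occurs in no link of `F`, so it can be exchanged with every vertex
    -- of `us`. After its link is removed it joins the free vertices, which accounts for the next
    -- factor of `rising`.
    add-link : ∀ {m} (F : Perm n → ℕ) (ts : List (Fin n)) (r : ℕ) {us} j → 2 + m ≤ n → j < suc m →
      (∀ {v} → v ∈ ts → ∃ λ i → i < suc m × v ≡ a i) →
      (∀ {u w} → u ∉ ts → w ∉ ts → ∀ ω → F (exchange u w ω) ≡ F ω) →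
      (∀ {us′} → Unique us′ → (∀ {w} → w ∈ us′ → w ∉ ts) → ∑ℕ (perms n) F * rising (length us′) r ≤ D ^ r * length (perms n)) →
      Unique us → (∀ {w} → w ∈ us → w ∉ a (suc m) ∷ a j ∷ ts) →
      ∑ℕ (perms n) (λ ω → link (suc m) j ω * F ω) * rising (length us) (suc r) ≤ D ^ suc r * length (perms n)
    add-link {m} F ts r {us} j m<n j<m below invariant bound uniq free = begin
      S * (suc z * rising (suc z) r) ≡⟨ ring₁ S (suc z) (rising (suc z) r) ⟩
      suc z * S * rising (suc z) r ≤⟨ *-monoˡ-≤ (rising (suc z) r) (exchange-bound F uniq′ (here refl) v∉ (λ w∈ → invariant (free′ (here refl)) (free′ w∈))) ⟩
      D * ∑ℕ (perms n) F * rising (suc z) r ≡⟨ *-assoc D (∑ℕ (perms n) F) _ ⟩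
      D * (∑ℕ (perms n) F * rising (suc z) r) ≤⟨ *-monoʳ-≤ D (bound uniq′ free′) ⟩
      D * (D ^ r * length (perms n)) ≡⟨ *-assoc D (D ^ r) _ ⟨
      D ^ suc r * length (perms n) ∎
      where
      open ≤-Reasoning
      z = length us
      S = ∑ℕ (perms n) (λ ω → link (suc m) j ω * F ω)
      ring₁ : ∀ a b c → a * (b * c) ≡ b * a * c
      ring₁ = solve-∀
      distinct : ∀ {i} → i < suc m → a (suc m) ≢ a i
      distinct i<m e = <⇒≢ i<m (sym (a-injective m<n (<-trans i<m m<n) e))
      uniq′ : Unique (a (suc m) ∷ us)
      uniq′ = All.tabulate (λ w∈ e → free w∈ (here (sym e))) ∷ uniq
      free′ : ∀ {w} → w ∈ a (suc m) ∷ us → w ∉ ts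
      free′ (here refl) w∈ts = let (i , i< , e) = below w∈ts in distinct i< e
      free′ (there w∈)  w∈ts = free w∈ (there (there w∈ts))
      v∉ : a j ∉ a (suc m) ∷ us
      v∉ (here e)   = distinct j<m (sym e)
      v∉ (there v∈) = free v∈ (there (here refl))

    chain-rising : ∀ {m} b (ss : Vec State m) {us} → 2 + m ≤ n → Unique us → (∀ {w} → w ∈ us → w ∉ touched b ss) →
      ∑ℕ (perms n) (chain b ss) * rising (length us) (rank b ss) ≤ D ^ rank b ss * length (perms n)
    chain-rising true [] 2≤n uniq free =
      add-link (λ _ → 1) [] 0 0 2≤n (s≤s z≤n) (λ ()) (λ _ _ _ → refl)
        (λ _ _ → ≤-reflexive (trans (cong (_* 1) (∑ℕ-const (perms n) 1)) (ring (length (perms n))))) uniq free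
      where
      ring : ∀ l → l * 1 * 1 ≡ 1 * l
      ring = solve-∀
    chain-rising false [] 2≤n uniq free = ≤-reflexive (trans (cong (_* 1) (∑ℕ-const (perms n) 1)) (ring (length (perms n))))
      where
      ring : ∀ l → l * 1 * 1 ≡ 1 * l
      ring = solve-∀
    chain-rising {suc m} b (s ∷ ss) m≤n uniq free with linked b s
    ... | true  = add-link (chain (isBoth s) ss) (touched (isBoth s) ss) (rank (isBoth s) ss) (parent m s) m≤n (parent< m s)
      (touched-below (isBoth s) ss) (chain-exchange (isBoth s) ss) (chain-rising (isBoth s) ss (≤-trans (n≤1+n _) m≤n)) uniq free
    ... | false = chain-rising (isBoth s) ss (≤-trans (n≤1+n _) m≤n) uniq free

    chain-bound : ∀ {m} b (ss : Vec State m) → 2 + m ≤ n →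
      ∑ℕ (perms n) (chain b ss) * n ^ rank b ss ≤ (8 * D) ^ rank b ss * length (perms n)
    chain-bound b ss m≤n = begin
      S * n ^ r ≤⟨ *-monoʳ-≤ S (^≤8^*rising (length us) r n≤) ⟩
      S * (8 ^ r * rising (length us) r) ≡⟨ ring₁ S (8 ^ r) _ ⟩
      8 ^ r * (S * rising (length us) r) ≤⟨ *-monoʳ-≤ (8 ^ r) (chain-rising b ss m≤n (without-unique ts (Uniqueₚ.allFin⁺ n)) (λ w∈ t∈ → without-∉ ts t∈ w∈)) ⟩
      8 ^ r * (D ^ r * length (perms n)) ≡⟨ *-assoc (8 ^ r) (D ^ r) _ ⟨
      8 ^ r * D ^ r * length (perms n) ≡⟨ cong (_* length (perms n)) (^-distribʳ-* r 8 D) ⟨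
      (8 * D) ^ r * length (perms n) ∎
      where
      open ≤-Reasoning
      r = rank b ss
      S = ∑ℕ (perms n) (chain b ss)
      ts = touched b ss
      us = without ts (allFin n)
      ring₁ : ∀ a b c → a * (b * c) ≡ b * (a * c)
      ring₁ = solve-∀
      n≤ : n ≤ 2 * (length us + r)
      n≤ = begin
        n ≡⟨ Listₚ.length-tabulate {n = n} id ⟨
        length (allFin n) ≤⟨ length-without ts (Uniqueₚ.allFin⁺ n) ⟩
        length us + length ts ≡⟨ cong (length us +_) (length-touched b ss) ⟩
        length us + 2 * r ≤⟨ +-monoˡ-≤ (2 * r) (m≤m+n (length us) (1 * length us)) ⟩
        2 * length us + 2 * r ≡⟨ *-distribˡ-+ 2 (length us) r ⟨
        2 * (length us + r) ∎

-- Summation over the subsets of a squared path by a two-valued transfer recursion.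

module TransferMatrix where

  open import Data.Nat as ℕ using (ℕ; zero; suc)
  import Data.Nat.Properties as ℕₚ
  open import Data.List using (List; []; _∷_)
  open import Data.Vec using (Vec; []; _∷_)
  open import Data.Rational using (ℚ; 0ℚ; 1ℚ; _+_; _*_; _-_; -_) renaming (_≤_ to _≤ℚ_)
  open import Data.Rational.Properties using (module ≤-Reasoning; ≤-refl; ≤-trans; ≤-reflexive; +-mono-≤; +-monoʳ-≤; *-zeroˡ; *-identityˡ; *-identityʳ)
  open import Tactic.RingSolver using (solve-∀)
  open Expectation
  open FragmentMethod using (0≤𝟙; 𝟙≤1)
  open Permutations
  open LinkCounting

  private variable
    A : Set

  ∑ι : ∀ (xs : List A) (f : A → ℕ) → ∑ xs (ι ∘ f) ≡ ι (∑ℕ xs f)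
  ∑ι []       f = sym ι-0
  ∑ι (x ∷ xs) f = trans (cong (_+_ (ι (f x))) (∑ι xs f)) (sym (ι-+ (f x) (∑ℕ xs f)))

  ∑S : ∀ {m} → (Vec State m → ℚ) → ℚ
  ∑S {zero}  f = f []
  ∑S {suc m} f = ∑S (f ∘ (none ∷_)) + ∑S (f ∘ (one ∷_)) + ∑S (f ∘ (two ∷_)) + ∑S (f ∘ (both ∷_))

  private
    cong₄ : ∀ {a a′ b b′ c c′ d d′ : ℚ} → a ≡ a′ → b ≡ b′ → c ≡ c′ → d ≡ d′ → a + b + c + d ≡ a′ + b′ + c′ + d′
    cong₄ refl refl refl refl = refl

  ∑S-cong : ∀ {m} {f g : Vec State m → ℚ} → (∀ ss → f ss ≡ g ss) → ∑S f ≡ ∑S g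
  ∑S-cong {zero}  h = h []
  ∑S-cong {suc m} h = cong₄ (∑S-cong (h ∘ (none ∷_))) (∑S-cong (h ∘ (one ∷_))) (∑S-cong (h ∘ (two ∷_))) (∑S-cong (h ∘ (both ∷_)))

  ∑S-mono : ∀ {m} {f g : Vec State m → ℚ} → (∀ ss → f ss ≤ℚ g ss) → ∑S f ≤ℚ ∑S g
  ∑S-mono {zero}  h = h []
  ∑S-mono {suc m} h = +-mono-≤ (+-mono-≤ (+-mono-≤ (∑S-mono (h ∘ (none ∷_))) (∑S-mono (h ∘ (one ∷_)))) (∑S-mono (h ∘ (two ∷_)))) (∑S-mono (h ∘ (both ∷_)))

  ∑S-*ˡ : ∀ {m} c (f : Vec State m → ℚ) → ∑S (λ ss → c * f ss) ≡ c * ∑S f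
  ∑S-*ˡ {zero}  c f = refl
  ∑S-*ˡ {suc m} c f = trans (cong₄ (∑S-*ˡ c (f ∘ (none ∷_))) (∑S-*ˡ c (f ∘ (one ∷_))) (∑S-*ˡ c (f ∘ (two ∷_))) (∑S-*ˡ c (f ∘ (both ∷_))))
    (ring c _ _ _ _)
    where
    ring : ∀ c a b d e → c * a + c * b + c * d + c * e ≡ c * (a + b + d + e)
    ring = solve-∀ ℚ-ring

  ∑S-∑ : ∀ {m} (xs : List A) (f : A → Vec State m → ℚ) → ∑ xs (λ a → ∑S (f a)) ≡ ∑S (λ ss → ∑ xs (λ a → f a ss))
  ∑S-∑ {m = zero}  xs f = refl
  ∑S-∑ {m = suc m} xs f = trans
    (trans (∑-+ xs (λ a → F none a + F one a + F two a) (F both))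
      (cong (_+ ∑ xs (F both)) (trans (∑-+ xs (λ a → F none a + F one a) (F two)) (cong (_+ ∑ xs (F two)) (∑-+ xs (F none) (F one))))))
    (cong₄ (∑S-∑ xs (λ a → f a ∘ (none ∷_))) (∑S-∑ xs (λ a → f a ∘ (one ∷_))) (∑S-∑ xs (λ a → f a ∘ (two ∷_))) (∑S-∑ xs (λ a → f a ∘ (both ∷_))))
    where
    F : State → _ → ℚ
    F s a = ∑S (f a ∘ (s ∷_))

  b2n : Bool → ℕ
  b2n b = if b then 1 else 0

  𝟙-∧ : ∀ b c → 𝟙 (b ∧ c) ≡ 𝟙 b * 𝟙 c
  𝟙-∧ true  c = sym (*-identityˡ (𝟙 c))
  𝟙-∧ false c = sym (*-zeroˡ (𝟙 c))

  ^b2n : ∀ x b → (1ℚ + x) ^ b2n b ≡ 1ℚ + x * 𝟙 b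
  ^b2n x true  = ring x
    where
    ring : ∀ x → (1ℚ + x) * 1ℚ ≡ 1ℚ + x * 1ℚ
    ring = solve-∀ ℚ-ring
  ^b2n x false = ring x
    where
    ring : ∀ x → 1ℚ ≡ 1ℚ + x * 0ℚ
    ring = solve-∀ ℚ-ring

  -- c₁ m and c₂ m select the edges from vertex 2 + m back to vertices 1 + m and m.
  module Transfer (c₁ c₂ : ℕ → Bool) (x : ℚ) (0≤x : 0ℚ ≤ℚ x) where

    weightOf : ℕ → State → ℚ
    weightOf m none = 1ℚ
    weightOf m one  = x * 𝟙 (c₁ m)
    weightOf m two  = x * 𝟙 (c₂ m)
    weightOf m both = x * 𝟙 (c₁ m) * (x * 𝟙 (c₂ m))

    wt : ∀ {m} → Vec State m → ℚ
    wt []               = 1ℚ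
    wt {suc m} (s ∷ ss) = weightOf m s * wt ss

    total : ℕ → ℕ
    total zero    = 0
    total (suc m) = b2n (c₁ m) ℕ.+ (b2n (c₂ m) ℕ.+ total m)

    0≤x𝟙 : ∀ b → 0ℚ ≤ℚ x * 𝟙 b
    0≤x𝟙 b = 0≤* 0≤x (0≤𝟙 b)

    0≤weightOf : ∀ m s → 0ℚ ≤ℚ weightOf m s
    0≤weightOf m none = 0≤1
    0≤weightOf m one  = 0≤x𝟙 (c₁ m)
    0≤weightOf m two  = 0≤x𝟙 (c₂ m)
    0≤weightOf m both = 0≤* (0≤x𝟙 (c₁ m)) (0≤x𝟙 (c₂ m))

    0≤wt : ∀ {m} (ss : Vec State m) → 0ℚ ≤ℚ wt ss
    0≤wt []               = 0≤1
    0≤wt {suc m} (s ∷ ss) = 0≤* (0≤weightOf m s) (0≤wt ss)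

    module _ (adj : ℕ → ℕ → Bool) where

      count : ℕ → ℕ
      count zero    = 0
      count (suc m) = b2n (c₁ m ∧ adj (2 ℕ.+ m) (1 ℕ.+ m)) ℕ.+ (b2n (c₂ m ∧ adj (2 ℕ.+ m) m) ℕ.+ count m)

      ok : ℕ → State → Bool
      ok m none = true
      ok m one  = adj (2 ℕ.+ m) (1 ℕ.+ m)
      ok m two  = adj (2 ℕ.+ m) m
      ok m both = adj (2 ℕ.+ m) (1 ℕ.+ m) ∧ adj (2 ℕ.+ m) m

      holds : ∀ {m} → Vec State m → Bool
      holds []               = true
      holds {suc m} (s ∷ ss) = ok m s ∧ holds ss

      -- Multiplying out one factor `1 + x * 𝟙` per pair gives four terms per vertex, one for each
      -- state, so the power becomes a sum over all sets of edges.
      expand : ∀ m → (1ℚ + x) ^ count m ≡ ∑S {m} (λ ss → wt ss * 𝟙 (holds ss))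
      expand zero    = refl
      expand (suc m) = begin
        (1ℚ + x) ^ (b2n (k₁ ∧ a₁) ℕ.+ (b2n (k₂ ∧ a₂) ℕ.+ count m))
          ≡⟨ trans (^-+ (1ℚ + x) (b2n (k₁ ∧ a₁)) _) (cong ((1ℚ + x) ^ b2n (k₁ ∧ a₁) *_) (^-+ (1ℚ + x) (b2n (k₂ ∧ a₂)) (count m))) ⟩
        (1ℚ + x) ^ b2n (k₁ ∧ a₁) * ((1ℚ + x) ^ b2n (k₂ ∧ a₂) * (1ℚ + x) ^ count m)
          ≡⟨ cong₂ (λ u v → u * (v * (1ℚ + x) ^ count m)) (trans (^b2n x (k₁ ∧ a₁)) (cong (λ z → 1ℚ + x * z) (𝟙-∧ k₁ a₁)))
               (trans (^b2n x (k₂ ∧ a₂)) (cong (λ z → 1ℚ + x * z) (𝟙-∧ k₂ a₂))) ⟩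
        (1ℚ + x * (𝟙 k₁ * 𝟙 a₁)) * ((1ℚ + x * (𝟙 k₂ * 𝟙 a₂)) * (1ℚ + x) ^ count m)
          ≡⟨ cong (λ z → (1ℚ + x * (𝟙 k₁ * 𝟙 a₁)) * ((1ℚ + x * (𝟙 k₂ * 𝟙 a₂)) * z)) (expand m) ⟩
        (1ℚ + x * (𝟙 k₁ * 𝟙 a₁)) * ((1ℚ + x * (𝟙 k₂ * 𝟙 a₂)) * S)
          ≡⟨ ring x (𝟙 k₁) (𝟙 a₁) (𝟙 k₂) (𝟙 a₂) S ⟩
        1ℚ * 1ℚ * S + x * 𝟙 k₁ * 𝟙 a₁ * S + x * 𝟙 k₂ * 𝟙 a₂ * S + x * 𝟙 k₁ * (x * 𝟙 k₂) * (𝟙 a₁ * 𝟙 a₂) * S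
          ≡⟨ cong₄ (sym (part none)) (sym (part one)) (sym (part two))
               (trans (cong (λ z → x * 𝟙 k₁ * (x * 𝟙 k₂) * z * S) (sym (𝟙-∧ a₁ a₂))) (sym (part both))) ⟩
        ∑S {suc m} (λ ss → wt ss * 𝟙 (holds ss)) ∎
        where
        open ≡-Reasoning
        k₁ = c₁ m
        k₂ = c₂ m
        a₁ = adj (2 ℕ.+ m) (1 ℕ.+ m)
        a₂ = adj (2 ℕ.+ m) m
        S : ℚ
        S = ∑S {m} (λ ss → wt ss * 𝟙 (holds ss))
        ring : ∀ x k a l b s → (1ℚ + x * (k * a)) * ((1ℚ + x * (l * b)) * s)
          ≡ 1ℚ * 1ℚ * s + x * k * a * s + x * l * b * s + x * k * (x * l) * (a * b) * s
        ring = solve-∀ ℚ-ring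
        ring₂ : ∀ a b c d → a * b * (c * d) ≡ a * c * (b * d)
        ring₂ = solve-∀ ℚ-ring
        part : ∀ s → ∑S {m} (λ ss → weightOf m s * wt ss * 𝟙 (ok m s ∧ holds ss)) ≡ weightOf m s * 𝟙 (ok m s) * S
        part s = trans (∑S-cong {m} (λ ss → trans (cong (weightOf m s * wt ss *_) (𝟙-∧ (ok m s) (holds ss)))
          (ring₂ (weightOf m s) (wt ss) (𝟙 (ok m s)) (𝟙 (holds ss))))) (∑S-*ˡ {m} (weightOf m s * 𝟙 (ok m s)) (λ ss → wt ss * 𝟙 (holds ss)))

    module Bound (y : ℚ) (0≤y : 0ℚ ≤ℚ y) (2x²y≤1 : x * x * y + x * x * y ≤ℚ 1ℚ) where

      -- The expansion with the probability of each set of edges replaced by `y ^ rank`. The Boolean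
      -- closes the recursion: `V true` is the sum below a vertex with both back edges.
      V : Bool → ℕ → ℚ
      V b m = ∑S {m} (λ ss → wt ss * y ^ rank b ss)

      -- `θ` bounds the ratio of `V true` to `V false`. It solves `θ = y + 2 * x * y + θ / 2`, where
      -- the last term comes from `x * x * y ≤ 1 / 2`. `η` is the cost of one edge: the two edges of
      -- a vertex multiply the sum by at most `1 + y + 4 * x * y`, which is below `(1 + η) ^ 2`.
      θ η : ℚ
      θ = (y + x * y + x * y) + (y + x * y + x * y)
      η = y + x * y + x * y + x * y

      private
        0≤xy : 0ℚ ≤ℚ x * y
        0≤xy = 0≤* 0≤x 0≤y

        0≤θ/2 : 0ℚ ≤ℚ y + x * y + x * y
        0≤θ/2 = 0≤+ (0≤+ 0≤y 0≤xy) 0≤xy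

        0≤θ : 0ℚ ≤ℚ θ
        0≤θ = 0≤+ 0≤θ/2 0≤θ/2

        0≤V : ∀ b m → 0ℚ ≤ℚ V b m
        0≤V b m = subst (_≤ℚ V b m) (trans (∑S-*ˡ {m} 0ℚ (λ _ → 0ℚ)) (*-zeroˡ (∑S {m} (λ _ → 0ℚ))))
          (∑S-mono {m} (λ ss → subst (_≤ℚ wt ss * y ^ rank b ss) (sym (*-zeroˡ 0ℚ)) (0≤* (0≤wt ss) (0≤^ (rank b ss) 0≤y))))

        V-step : ∀ b b′ m s → (∀ (ss : Vec State m) → rank b (s ∷ ss) ≡ suc (rank b′ ss)) →
          ∑S {m} (λ ss → weightOf m s * wt ss * y ^ rank b (s ∷ ss)) ≡ weightOf m s * y * V b′ m
        V-step b b′ m s e = trans (∑S-cong {m} (λ ss → trans (cong (λ r → weightOf m s * wt ss * y ^ r) (e ss)) (ring (weightOf m s) (wt ss) y (y ^ rank b′ ss))))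
          (∑S-*ˡ {m} (weightOf m s * y) (λ ss → wt ss * y ^ rank b′ ss))
          where
          ring : ∀ a b c d → a * b * (c * d) ≡ a * c * (b * d)
          ring = solve-∀ ℚ-ring

        rest : ℕ → ℚ
        rest m = x * 𝟙 (c₁ m) * y * V false m + x * 𝟙 (c₂ m) * y * V false m + x * 𝟙 (c₁ m) * (x * 𝟙 (c₂ m)) * y * V true m

        V-true : ∀ m → V true (suc m) ≡ y * V false m + rest m
        V-true m = trans (cong₄ (V-step true false m none (λ _ → refl)) (V-step true false m one (λ _ → refl)) (V-step true false m two (λ _ → refl)) (V-step true true m both (λ _ → refl)))
          (ring y (V false m) _ _ _)
          where
          ring : ∀ y f a b c → 1ℚ * y * f + a + b + c ≡ y * f + (a + b + c)
          ring = solve-∀ ℚ-ring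

        V-false : ∀ m → V false (suc m) ≡ V false m + rest m
        V-false m = trans (cong₄ skip (V-step false false m one (λ _ → refl)) (V-step false false m two (λ _ → refl)) (V-step false true m both (λ _ → refl)))
          (ring (V false m) _ _ _)
          where
          skip : ∑S {m} (λ ss → 1ℚ * wt ss * y ^ rank false ss) ≡ V false m
          skip = ∑S-cong {m} (λ ss → cong (_* y ^ rank false ss) (*-identityˡ (wt ss)))
          ring : ∀ f a b c → f + a + b + c ≡ f + (a + b + c)
          ring = solve-∀ ℚ-ring

        0≤rest : ∀ m → 0ℚ ≤ℚ rest m
        0≤rest m = 0≤+ (0≤+ (0≤* (0≤* (0≤x𝟙 (c₁ m)) 0≤y) (0≤V false m)) (0≤* (0≤* (0≤x𝟙 (c₂ m)) 0≤y) (0≤V false m)))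
          (0≤* (0≤* (0≤* (0≤x𝟙 (c₁ m)) (0≤x𝟙 (c₂ m))) 0≤y) (0≤V true m))

        -- Two edges on one link have weight `x * x * y`, possibly of constant order; the factor `θ`
        -- from the forced second link brings this down to the size of one edge on one link.
        x²yθ≤ : x * x * y * θ ≤ℚ y + x * y + x * y
        x²yθ≤ = subst₂ _≤ℚ_ (ring (x * x * y) (y + x * y + x * y)) (*-identityˡ _) (*-monoʳ 0≤θ/2 2x²y≤1)
          where
          ring : ∀ a b → (a + a) * b ≡ a * (b + b)
          ring = solve-∀ ℚ-ring

        growth : Bool → Bool → ℚ
        growth k₁ k₂ = x * 𝟙 k₁ * y + x * 𝟙 k₂ * y + x * 𝟙 k₁ * (x * 𝟙 k₂) * y * θ

        rest≤ : ∀ m → V true m ≤ℚ θ * V false m → rest m ≤ℚ growth (c₁ m) (c₂ m) * V false m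
        rest≤ m Vt≤ = subst (rest m ≤ℚ_) (ring (x * 𝟙 (c₁ m) * y) (x * 𝟙 (c₂ m) * y) (x * 𝟙 (c₁ m) * (x * 𝟙 (c₂ m)) * y) θ (V false m))
          (+-monoʳ-≤ (x * 𝟙 (c₁ m) * y * V false m + x * 𝟙 (c₂ m) * y * V false m)
            (*-monoˡ (0≤* (0≤* (0≤x𝟙 (c₁ m)) (0≤x𝟙 (c₂ m))) 0≤y) Vt≤))
          where
          ring : ∀ a b c t f → a * f + b * f + c * (t * f) ≡ (a + b + c * t) * f
          ring = solve-∀ ℚ-ring

        x𝟙≤x : ∀ b → x * 𝟙 b ≤ℚ x
        x𝟙≤x b = subst (x * 𝟙 b ≤ℚ_) (*-identityʳ x) (*-monoˡ 0≤x (𝟙≤1 b))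

        growth≤ : ∀ k₁ k₂ → growth k₁ k₂ ≤ℚ x * y + x * y + (y + x * y + x * y)
        growth≤ k₁ k₂ = +-mono-≤ (+-mono-≤ (*-monoʳ 0≤y (x𝟙≤x k₁)) (*-monoʳ 0≤y (x𝟙≤x k₂)))
          (≤-trans (*-monoʳ 0≤θ (*-monoʳ 0≤y (*-mono 0≤x (0≤x𝟙 k₂) (x𝟙≤x k₁) (x𝟙≤x k₂)))) x²yθ≤)

        growth≤^ : ∀ k₁ k₂ → 1ℚ + growth k₁ k₂ ≤ℚ (1ℚ + η) ^ (b2n k₁ ℕ.+ b2n k₂)
        growth≤^ false false = ≤-reflexive (ring x y θ)
          where
          ring : ∀ x y t → 1ℚ + (x * 0ℚ * y + x * 0ℚ * y + x * 0ℚ * (x * 0ℚ) * y * t) ≡ 1ℚ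
          ring = solve-∀ ℚ-ring
        growth≤^ true false = 0≤-⇒≤ (subst (0ℚ ≤ℚ_) (ring x y θ) 0≤θ/2)
          where
          ring : ∀ x y t → y + x * y + x * y ≡ (1ℚ + (y + x * y + x * y + x * y)) * 1ℚ - (1ℚ + (x * 1ℚ * y + x * 0ℚ * y + x * 1ℚ * (x * 0ℚ) * y * t))
          ring = solve-∀ ℚ-ring
        growth≤^ false true = 0≤-⇒≤ (subst (0ℚ ≤ℚ_) (ring x y θ) 0≤θ/2)
          where
          ring : ∀ x y t → y + x * y + x * y ≡ (1ℚ + (y + x * y + x * y + x * y)) * 1ℚ - (1ℚ + (x * 0ℚ * y + x * 1ℚ * y + x * 0ℚ * (x * 1ℚ) * y * t))
          ring = solve-∀ ℚ-ring
        growth≤^ true true = ≤-trans (+-monoʳ-≤ 1ℚ (growth≤ true true))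
          (0≤-⇒≤ (subst (0ℚ ≤ℚ_) (ring x y) (0≤+ (0≤+ (0≤+ 0≤y 0≤xy) 0≤xy) (0≤sq η))))
          where
          ring : ∀ x y → y + x * y + x * y + (y + x * y + x * y + x * y) * (y + x * y + x * y + x * y) ≡
            (1ℚ + (y + x * y + x * y + x * y)) * ((1ℚ + (y + x * y + x * y + x * y)) * 1ℚ) - (1ℚ + (x * y + x * y + (y + x * y + x * y)))
          ring = solve-∀ ℚ-ring

        V-true≤ : ∀ m → V true m ≤ℚ θ * V false m
        V-true≤ zero    = subst₂ _≤ℚ_ (ring₁ y) (ring₂ θ) (≤-trans (≤-trans (x≤x+ 0≤xy) (x≤x+ 0≤xy)) (x≤x+ 0≤θ/2))
          where
          ring₁ : ∀ y → y ≡ 1ℚ * (y * 1ℚ)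
          ring₁ = solve-∀ ℚ-ring
          ring₂ : ∀ t → t ≡ t * (1ℚ * 1ℚ)
          ring₂ = solve-∀ ℚ-ring
        V-true≤ (suc m) = begin
          V true (suc m) ≡⟨ V-true m ⟩
          y * V false m + rest m ≤⟨ +-monoʳ-≤ (y * V false m) (≤-trans (rest≤ m (V-true≤ m)) (*-monoʳ (0≤V false m) (growth≤ (c₁ m) (c₂ m)))) ⟩
          y * V false m + (x * y + x * y + (y + x * y + x * y)) * V false m ≡⟨ ring x y (V false m) ⟩
          θ * V false m ≤⟨ *-monoˡ 0≤θ (subst (V false m ≤ℚ_) (sym (V-false m)) (x≤x+ (0≤rest m))) ⟩
          θ * V false (suc m) ∎
          where
          open ≤-Reasoning
          ring : ∀ x y f → y * f + (x * y + x * y + (y + x * y + x * y)) * f ≡ ((y + x * y + x * y) + (y + x * y + x * y)) * f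
          ring = solve-∀ ℚ-ring

      -- A vertex without selected edges leaves `V false` unchanged, so the exponent counts selected
      -- edges rather than vertices, as small edge sets require.
      V-bound : ∀ m → V false m ≤ℚ (1ℚ + η) ^ total m
      V-bound zero    = ≤-refl
      V-bound (suc m) = begin
        V false (suc m) ≡⟨ V-false m ⟩
        V false m + rest m ≤⟨ +-monoʳ-≤ (V false m) (rest≤ m (V-true≤ m)) ⟩
        V false m + growth (c₁ m) (c₂ m) * V false m ≡⟨ ring (V false m) (growth (c₁ m) (c₂ m)) ⟩
        (1ℚ + growth (c₁ m) (c₂ m)) * V false m ≤⟨ *-mono (0≤^ (b2n (c₁ m) ℕ.+ b2n (c₂ m)) 0≤1+η) (0≤V false m) (growth≤^ (c₁ m) (c₂ m)) (V-bound m) ⟩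
        (1ℚ + η) ^ (b2n (c₁ m) ℕ.+ b2n (c₂ m)) * (1ℚ + η) ^ total m ≡⟨ ^-+ (1ℚ + η) (b2n (c₁ m) ℕ.+ b2n (c₂ m)) (total m) ⟨
        (1ℚ + η) ^ (b2n (c₁ m) ℕ.+ b2n (c₂ m) ℕ.+ total m) ≡⟨ cong ((1ℚ + η) ^_) (ℕₚ.+-assoc (b2n (c₁ m)) (b2n (c₂ m)) (total m)) ⟩
        (1ℚ + η) ^ total (suc m) ∎
        where
        open ≤-Reasoning
        ring : ∀ f g → f + g * f ≡ (1ℚ + g) * f
        ring = solve-∀ ℚ-ring
        0≤1+η : 0ℚ ≤ℚ 1ℚ + η
        0≤1+η = 0≤+ 0≤1 (0≤+ 0≤θ/2 0≤xy)

-- From links to the average of `(1 + x)` to the overlap along a squared path.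

module SpreadBound where

  open import Data.Nat as ℕ using (ℕ; suc)
  import Data.Nat.Properties as ℕₚ
  open import Data.Bool.Properties using (∧-conicalˡ; ∧-conicalʳ)
  open import Data.Fin using (Fin)
  open import Data.List using ([]; _∷_; length; allFin)
  open import Data.Vec using (Vec; []; _∷_)
  open import Data.Rational using (ℚ; 0ℚ; 1ℚ; _+_; _*_; _<_) renaming (_≤_ to _≤ℚ_)
  open import Data.Rational.Properties using (module ≤-Reasoning; ≤-refl; ≤-trans; *-comm)
  open import Tactic.RingSolver using (solve-∀)
  open Expectation
  open FragmentMethod using (0≤𝟙; 𝟙≤1)
  open Permutations
  open LinkCounting
  open TransferMatrix

  module Spread {n : ℕ} (near : Fin n → Fin n → Bool) (κ : Fin n → Fin n → ℕ) (D : ℕ)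
    (rows : ∀ i → ∑ℕ (allFin n) (κ i) ℕ.≤ D)
    (near⇒κ : ∀ {i j} → near i j ≡ true → 1 ℕ.≤ κ j i)
    (near²⇒κ : ∀ {i j l} → near i j ≡ true → near i l ≡ true → 1 ℕ.≤ κ l j)
    (a : ℕ → Fin n) (a-injective : ∀ {u v} → u ℕ.< n → v ℕ.< n → a u ≡ a v → u ≡ v) where

    open Chains κ D rows a a-injective

    adj : Perm n → ℕ → ℕ → Bool
    adj ω u v = near (pos ω (a u)) (pos ω (a v))

    module _ (c₁ c₂ : ℕ → Bool) (x : ℚ) (0≤x : 0ℚ ≤ℚ x) where

      open Transfer c₁ c₂ x 0≤x

      -- The invariant behind `b`: when it is true, the vertex `2 + m` just above has both back
      -- edges. Vertices `1 + m` and `m` are then both close to it, hence within two steps of each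
      -- other, which yields the link for state `none`.
      holds⇒chain : ∀ {m} b (ss : Vec State m) ω →
        (b ≡ true → adj ω (2 ℕ.+ m) (1 ℕ.+ m) ≡ true × adj ω (2 ℕ.+ m) m ≡ true) →
        holds (adj ω) ss ≡ true → 1 ℕ.≤ chain b ss ω
      holds⇒chain true  [] ω above h = ℕₚ.*-mono-≤ {1} {_} {1} (near²⇒κ (proj₁ (above refl)) (proj₂ (above refl))) ℕₚ.≤-refl
      holds⇒chain false [] ω above h = ℕₚ.≤-refl
      holds⇒chain {suc m} b (both ∷ ss) ω above h = linked-both b
        where
        now : adj ω (2 ℕ.+ m) (1 ℕ.+ m) ∧ adj ω (2 ℕ.+ m) m ≡ true
        now = ∧-conicalˡ _ _ h
        now₁ = ∧-conicalˡ (adj ω (2 ℕ.+ m) (1 ℕ.+ m)) (adj ω (2 ℕ.+ m) m) now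
        now₂ = ∧-conicalʳ (adj ω (2 ℕ.+ m) (1 ℕ.+ m)) (adj ω (2 ℕ.+ m) m) now
        -- `linked b both` is true for either value of `b`, but computes only once `b` is known.
        linked-both : ∀ b → 1 ℕ.≤ chain b (both ∷ ss) ω
        linked-both true  = ℕₚ.*-mono-≤ {1} {_} {1} (near⇒κ now₁) (holds⇒chain true ss ω (λ _ → now₁ , now₂) (∧-conicalʳ _ _ h))
        linked-both false = ℕₚ.*-mono-≤ {1} {_} {1} (near⇒κ now₁) (holds⇒chain true ss ω (λ _ → now₁ , now₂) (∧-conicalʳ _ _ h))
      holds⇒chain false (none ∷ ss) ω above h = holds⇒chain false ss ω (λ ()) h
      holds⇒chain true  (none ∷ ss) ω above h =
        ℕₚ.*-mono-≤ {1} {_} {1} (near²⇒κ (proj₁ (above refl)) (proj₂ (above refl))) (holds⇒chain false ss ω (λ ()) h)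
      holds⇒chain false (one ∷ ss) ω above h =
        ℕₚ.*-mono-≤ {1} {_} {1} (near⇒κ (∧-conicalˡ _ _ h)) (holds⇒chain false ss ω (λ ()) (∧-conicalʳ _ _ h))
      holds⇒chain true  (one ∷ ss) ω above h =
        ℕₚ.*-mono-≤ {1} {_} {1} (near⇒κ (∧-conicalˡ _ _ h)) (holds⇒chain false ss ω (λ ()) (∧-conicalʳ _ _ h))
      holds⇒chain false (two ∷ ss) ω above h =
        ℕₚ.*-mono-≤ {1} {_} {1} (near⇒κ (∧-conicalˡ _ _ h)) (holds⇒chain false ss ω (λ ()) (∧-conicalʳ _ _ h))
      holds⇒chain true  (two ∷ ss) ω above h =
        ℕₚ.*-mono-≤ {1} {_} {1} (near⇒κ (∧-conicalˡ _ _ h)) (holds⇒chain false ss ω (λ ()) (∧-conicalʳ _ _ h))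

      𝟙holds≤chain : ∀ {m} (ss : Vec State m) ω → 𝟙 (holds (adj ω) ss) ≤ℚ ι (chain false ss ω)
      𝟙holds≤chain ss ω = go (holds (adj ω) ss) (holds⇒chain false ss ω (λ ()))
        where
        go : ∀ b {c} → (b ≡ true → 1 ℕ.≤ c) → 𝟙 b ≤ℚ ι c
        go true  {c} f = subst (_≤ℚ ι c) ι-1 (ι-mono (f refl))
        go false {c} f = 0≤ι c

      module _ (y : ℚ) (0≤y : 0ℚ ≤ℚ y) (0<n : 0ℚ < ι n) (yn≡8D : y * ι n ≡ ι (8 ℕ.* D)) (2x²y≤1 : x * x * y + x * x * y ≤ℚ 1ℚ) where

        open Bound y 0≤y 2x²y≤1

        private
          h : ℚ
          h = ι (length (perms n))

        -- `y` is the price of one link: `y * n = 8 * D` turns the integer bound, which is cleared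
        -- of denominators, into a power of `y`.
        chain-sum : ∀ {m} (ss : Vec State m) → 2 ℕ.+ m ℕ.≤ n → ∑ (perms n) (λ ω → ι (chain false ss ω)) ≤ℚ h * y ^ rank false ss
        chain-sum ss m≤n = *-cancelˡ (0<^ r 0<n) (begin
          ι n ^ r * ∑ (perms n) (λ ω → ι (chain false ss ω)) ≡⟨ cong₂ _*_ (sym (ι-^ n r)) (∑ι (perms n) (chain false ss)) ⟩
          ι (n ℕ.^ r) * ι S ≡⟨ *-comm (ι (n ℕ.^ r)) (ι S) ⟩
          ι S * ι (n ℕ.^ r) ≡⟨ ι-* S (n ℕ.^ r) ⟨
          ι (S ℕ.* n ℕ.^ r) ≤⟨ ι-mono (chain-bound false ss m≤n) ⟩
          ι ((8 ℕ.* D) ℕ.^ r ℕ.* length (perms n)) ≡⟨ trans (ι-* ((8 ℕ.* D) ℕ.^ r) (length (perms n))) (cong (_* h) (ι-^ (8 ℕ.* D) r)) ⟩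
          ι (8 ℕ.* D) ^ r * h ≡⟨ cong (λ z → z ^ r * h) yn≡8D ⟨
          (y * ι n) ^ r * h ≡⟨ cong (_* h) (*-^ y (ι n) r) ⟩
          y ^ r * ι n ^ r * h ≡⟨ ring (y ^ r) (ι n ^ r) h ⟩
          ι n ^ r * (h * y ^ r) ∎)
          where
          open ≤-Reasoning
          r = rank false ss
          S = ∑ℕ (perms n) (chain false ss)
          ring : ∀ a b c → a * b * c ≡ b * (c * a)
          ring = solve-∀ ℚ-ring

        spread-sum : ∀ m → 2 ℕ.+ m ℕ.≤ n → ∑ (perms n) (λ ω → (1ℚ + x) ^ count (adj ω) m) ≤ℚ h * (1ℚ + η) ^ total m
        spread-sum m m≤n = begin
          ∑ (perms n) (λ ω → (1ℚ + x) ^ count (adj ω) m) ≡⟨ ∑-cong (perms n) (λ ω → expand (adj ω) m) ⟩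
          ∑ (perms n) (λ ω → ∑S {m} (λ ss → wt ss * 𝟙 (holds (adj ω) ss))) ≡⟨ ∑S-∑ {m = m} (perms n) (λ ω ss → wt ss * 𝟙 (holds (adj ω) ss)) ⟩
          ∑S {m} (λ ss → ∑ (perms n) (λ ω → wt ss * 𝟙 (holds (adj ω) ss))) ≤⟨ ∑S-mono {m} each ⟩
          ∑S {m} (λ ss → h * (wt ss * y ^ rank false ss)) ≡⟨ ∑S-*ˡ {m} h (λ ss → wt ss * y ^ rank false ss) ⟩
          h * V false m ≤⟨ *-monoˡ (0≤ι (length (perms n))) (V-bound m) ⟩
          h * (1ℚ + η) ^ total m ∎
          where
          open ≤-Reasoning
          ring : ∀ a b c → a * (b * c) ≡ b * (a * c)
          ring = solve-∀ ℚ-ring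
          each : (ss : Vec State m) → ∑ (perms n) (λ ω → wt ss * 𝟙 (holds (adj ω) ss)) ≤ℚ h * (wt ss * y ^ rank false ss)
          each ss = begin
            ∑ (perms n) (λ ω → wt ss * 𝟙 (holds (adj ω) ss)) ≡⟨ ∑-*ˡ (perms n) (wt ss) (λ ω → 𝟙 (holds (adj ω) ss)) ⟩
            wt ss * ∑ (perms n) (λ ω → 𝟙 (holds (adj ω) ss)) ≤⟨ *-monoˡ (0≤wt ss) (≤-trans (∑-mono (perms n) (λ {ω} _ → 𝟙holds≤chain ss ω)) (chain-sum ss m≤n)) ⟩
            wt ss * (h * y ^ rank false ss) ≡⟨ ring (wt ss) h (y ^ rank false ss) ⟩
            h * (wt ss * y ^ rank false ss) ∎

-- Cyclic shifts, closeness on the cycle, and edges as entries of `pairs`.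

module CyclicSquare where

  open import Data.Nat using (ℕ; zero; suc; _+_; _*_; _≤_; _<_; z≤n; s≤s; _<?_)
  open import Data.Nat.Properties
  open import Data.Nat.DivMod using (_%_; m%n<n; m%n%n≡m%n; [m+n]%n≡m%n; [m+kn]%n≡m%n; m<n⇒m%n≡m; %-distribˡ-+)
  open import Data.Bool.Properties using (∨-comm; ∨-zeroʳ)
  open import Data.Fin as Fin using (Fin; toℕ)
  import Data.Fin.Properties as Finₚ
  open import Data.List as List using (List; []; _∷_; map; length; filter; allFin)
  open import Data.List.Membership.Propositional using (_∈_)
  open import Data.List.Membership.Propositional.Properties using (∈-filter⁺; ∈-filter⁻; ∈-map⁻; ∈-map⁺; ∈-allFin; ∈-concat⁻′; ∈-concat⁺′; ∈-lookup)
  open import Data.List.Relation.Unary.Any as Any using (here; there)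
  open import Data.List.Relation.Unary.Any.Properties using (lookup-index)
  open import Data.List.Relation.Unary.All as All using (All; []; _∷_)
  import Data.List.Relation.Unary.All.Properties as Allₚ
  open import Data.List.Relation.Unary.AllPairs as AllPairs using (AllPairs; []; _∷_)
  import Data.List.Relation.Unary.AllPairs.Properties as AllPairsₚ
  open import Data.List.Relation.Unary.Unique.Propositional using (Unique)
  import Data.List.Relation.Unary.Unique.Propositional.Properties as Uniqueₚ
  open import Data.Product.Properties using (,-injectiveˡ; ,-injectiveʳ)
  import Data.Product.Properties as Productₚ
  open import Relation.Binary.Definitions using (tri<; tri≈; tri>)
  open Permutations
  open TransferMatrix using (b2n)

  private variable
    A : Set

  term≤∑ℕ : ∀ {xs : List A} {a} (f : A → ℕ) → a ∈ xs → f a ≤ ∑ℕ xs f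
  term≤∑ℕ f (here refl) = m≤m+n _ _
  term≤∑ℕ f (there a∈)  = ≤-trans (term≤∑ℕ f a∈) (m≤n+m _ _)

  b2n≤1 : ∀ b → b2n b ≤ 1
  b2n≤1 true  = ≤-refl
  b2n≤1 false = z≤n

  b2n-∨ : ∀ b c → b2n (b ∨ c) ≤ b2n b + b2n c
  b2n-∨ true  c = s≤s z≤n
  b2n-∨ false c = ≤-refl

  b2n-true : ∀ {b} → b ≡ true → 1 ≤ b2n b
  b2n-true refl = ≤-refl

  -- The bound is a Boolean `c` rather than 1, so that the same count is also 0 whenever `c` is
  -- false.
  ∑ℕ-atMostOne : ∀ {xs : List A} → Unique xs → (p : A → Bool) →
    (∀ {a a′} → a ∈ xs → a′ ∈ xs → p a ≡ true → p a′ ≡ true → a ≡ a′) →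
    ∀ {c} → (∀ {a} → a ∈ xs → p a ≡ true → c ≡ true) → ∑ℕ xs (b2n ∘ p) ≤ b2n c
  ∑ℕ-atMostOne [] p same imp = z≤n
  ∑ℕ-atMostOne {xs = x ∷ xs} (x∉ ∷ uniq) p same {c} imp with p x in px
  ... | false = ∑ℕ-atMostOne uniq p (λ a∈ a′∈ → same (there a∈) (there a′∈)) (imp ∘ there)
  ... | true  = subst₂ _≤_ (cong suc (sym rest≡0)) (cong b2n (sym (imp (here refl) px))) ≤-refl
    where
    zero-on : ∀ {ys} → (∀ {y} → y ∈ ys → p y ≢ true) → ∑ℕ ys (b2n ∘ p) ≡ 0
    zero-on {[]}     h = refl
    zero-on {y ∷ ys} h with p y in py
    ... | true  = contradiction py (h (here refl))
    ... | false = zero-on (h ∘ there)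
    rest≡0 : ∑ℕ xs (b2n ∘ p) ≡ 0
    rest≡0 = zero-on (λ y∈ py → All.lookup x∉ y∈ (same (here refl) (there y∈) px py))

  does⇒ : ∀ {P : Set} (d : Dec P) → does d ≡ true → P
  does⇒ (yes p) _ = p

  module Cyclic (n′ : ℕ) where

    n : ℕ
    n = suc n′

    toℕ-shift : ∀ d (i : Fin n) → toℕ (shift d i) ≡ (toℕ i + d) % n
    toℕ-shift d i = Finₚ.toℕ-fromℕ< (m%n<n (toℕ i + d) n)

    %-absorb : ∀ x y → (x % n + y) % n ≡ (x + y) % n
    %-absorb x y = begin
      (x % n + y) % n ≡⟨ %-distribˡ-+ (x % n) y n ⟩
      (x % n % n + y % n) % n ≡⟨ cong (λ z → (z + y % n) % n) (m%n%n≡m%n x n) ⟩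
      (x % n + y % n) % n ≡⟨ %-distribˡ-+ x y n ⟨
      (x + y) % n ∎
      where open ≡-Reasoning

    -- Adding `d * n′` undoes the addition of `d`, as `d + d * n′ = d * n` vanishes modulo `n`; this
    -- replaces truncated subtraction.
    %-cancel : ∀ x d → ((x + d) % n + d * n′) % n ≡ x % n
    %-cancel x d = begin
      ((x + d) % n + d * n′) % n ≡⟨ %-absorb (x + d) (d * n′) ⟩
      (x + d + d * n′) % n ≡⟨ cong (_% n) (trans (+-assoc x d (d * n′)) (cong (x +_) (sym (*-suc d n′)))) ⟩
      (x + d * n) % n ≡⟨ [m+kn]%n≡m%n x d n ⟩
      x % n ∎
      where open ≡-Reasoning

    shift-shift : ∀ d e (i : Fin n) → shift e (shift d i) ≡ shift (d + e) i
    shift-shift d e i = Finₚ.toℕ-injective (begin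
      toℕ (shift e (shift d i)) ≡⟨ toℕ-shift e (shift d i) ⟩
      (toℕ (shift d i) + e) % n ≡⟨ cong (λ z → (z + e) % n) (toℕ-shift d i) ⟩
      ((toℕ i + d) % n + e) % n ≡⟨ %-absorb (toℕ i + d) e ⟩
      (toℕ i + d + e) % n ≡⟨ cong (_% n) (+-assoc (toℕ i) d e) ⟩
      (toℕ i + (d + e)) % n ≡⟨ toℕ-shift (d + e) i ⟨
      toℕ (shift (d + e) i) ∎)
      where open ≡-Reasoning

    shift-0 : ∀ (i : Fin n) → shift 0 i ≡ i
    shift-0 i = Finₚ.toℕ-injective (trans (toℕ-shift 0 i) (trans (cong (_% n) (+-identityʳ (toℕ i))) (m<n⇒m%n≡m (Finₚ.toℕ<n i))))

    shift-+n : ∀ d (i : Fin n) → shift (d + n) i ≡ shift d i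
    shift-+n d i = Finₚ.toℕ-injective (begin
      toℕ (shift (d + n) i) ≡⟨ toℕ-shift (d + n) i ⟩
      (toℕ i + (d + n)) % n ≡⟨ cong (_% n) (+-assoc (toℕ i) d n) ⟨
      (toℕ i + d + n) % n ≡⟨ [m+n]%n≡m%n (toℕ i + d) n ⟩
      (toℕ i + d) % n ≡⟨ toℕ-shift d i ⟨
      toℕ (shift d i) ∎)
      where open ≡-Reasoning

    shift-injective : ∀ d {i j : Fin n} → shift d i ≡ shift d j → i ≡ j
    shift-injective d {i} {j} e = Finₚ.toℕ-injective (begin
      toℕ i ≡⟨ m<n⇒m%n≡m (Finₚ.toℕ<n i) ⟨
      toℕ i % n ≡⟨ %-cancel (toℕ i) d ⟨
      ((toℕ i + d) % n + d * n′) % n ≡⟨ cong (λ z → (z + d * n′) % n) (trans (sym (toℕ-shift d i)) (trans (cong toℕ e) (toℕ-shift d j))) ⟩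
      ((toℕ j + d) % n + d * n′) % n ≡⟨ %-cancel (toℕ j) d ⟩
      toℕ j % n ≡⟨ m<n⇒m%n≡m (Finₚ.toℕ<n j) ⟩
      toℕ j ∎)
      where open ≡-Reasoning

    shift-injectiveˡ : ∀ (r : Fin n) {d e} → d < n → e < n → shift d r ≡ shift e r → d ≡ e
    shift-injectiveˡ r {d} {e} d<n e<n eq = begin
      d ≡⟨ m<n⇒m%n≡m d<n ⟨
      d % n ≡⟨ %-cancel d R ⟨
      ((d + R) % n + R * n′) % n ≡⟨ cong (λ z → (z + R * n′) % n) same ⟩
      ((e + R) % n + R * n′) % n ≡⟨ %-cancel e R ⟩
      e % n ≡⟨ m<n⇒m%n≡m e<n ⟩
      e ∎
      where
      open ≡-Reasoning
      R = toℕ r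
      same : (d + R) % n ≡ (e + R) % n
      same = trans (cong (_% n) (+-comm d R)) (trans (sym (toℕ-shift d r)) (trans (cong toℕ eq) (trans (toℕ-shift e r) (cong (_% n) (+-comm R e)))))

    shift-reaches : ∀ (r i : Fin n) → ∃ λ u → u < n × i ≡ shift u r
    shift-reaches r i = u , m%n<n (toℕ i + R * n′) n , Finₚ.toℕ-injective (begin
      toℕ i ≡⟨ m<n⇒m%n≡m (Finₚ.toℕ<n i) ⟨
      toℕ i % n ≡⟨ [m+kn]%n≡m%n (toℕ i) R n ⟨
      (toℕ i + R * n) % n ≡⟨ cong (λ z → (toℕ i + z) % n) (trans (*-suc R n′) (+-comm R (R * n′))) ⟩
      (toℕ i + (R * n′ + R)) % n ≡⟨ cong (_% n) (+-assoc (toℕ i) (R * n′) R) ⟨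
      (toℕ i + R * n′ + R) % n ≡⟨ %-absorb (toℕ i + R * n′) R ⟨
      (u + R) % n ≡⟨ cong (_% n) (+-comm u R) ⟩
      (R + u) % n ≡⟨ toℕ-shift u r ⟨
      toℕ (shift u r) ∎)
      where
      open ≡-Reasoning
      R = toℕ r
      u = (toℕ i + R * n′) % n

    step : ℕ → Fin n → Fin n → Bool
    step d i j = does (shift d i Finₚ.≟ j)

    ahead near : Fin n → Fin n → Bool
    ahead i j = step 1 i j ∨ step 2 i j
    near i j = ahead i j ∨ ahead j i

    near-sym : ∀ {i j} → near i j ≡ true → near j i ≡ true
    near-sym {i} {j} e = trans (∨-comm (ahead j i) (ahead i j)) e

    data Near (i j : Fin n) : Set where
      forth : ∀ d → d ≡ 1 ⊎ d ≡ 2 → j ≡ shift d i → Near i j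
      back  : ∀ d → d ≡ 1 ⊎ d ≡ 2 → i ≡ shift d j → Near i j

    near⇒Near : ∀ {i j} → near i j ≡ true → Near i j
    near⇒Near {i} {j} e with shift 1 i Finₚ.≟ j | shift 2 i Finₚ.≟ j | shift 1 j Finₚ.≟ i | shift 2 j Finₚ.≟ i
    ... | yes p | _     | _     | _     = forth 1 (inj₁ refl) (sym p)
    ... | no _  | yes p | _     | _     = forth 2 (inj₂ refl) (sym p)
    ... | no _  | no _  | yes p | _     = back 1 (inj₁ refl) (sym p)
    ... | no _  | no _  | no _  | yes p = back 2 (inj₂ refl) (sym p)

    shift⇒near : ∀ {i} d → d ≡ 1 ⊎ d ≡ 2 → near i (shift d i) ≡ true
    shift⇒near {i} _ (inj₁ refl) rewrite dec-true (shift 1 i Finₚ.≟ shift 1 i) refl = refl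
    shift⇒near {i} _ (inj₂ refl) rewrite dec-true (shift 2 i Finₚ.≟ shift 2 i) refl = cong (_∨ ahead (shift 2 i) i) (∨-zeroʳ (step 1 i (shift 2 i)))

    near-row : ∀ i → ∑ℕ (allFin n) (λ j → b2n (near i j)) ≤ 4
    near-row i = begin
      ∑ℕ (allFin n) (λ j → b2n (near i j))
        ≤⟨ ∑ℕ-mono (allFin n) (λ {j} _ → ≤-trans (b2n-∨ (ahead i j) (ahead j i)) (+-mono-≤ (b2n-∨ (step 1 i j) (step 2 i j)) (b2n-∨ (step 1 j i) (step 2 j i)))) ⟩
      ∑ℕ (allFin n) (λ j → b2n (step 1 i j) + b2n (step 2 i j) + (b2n (step 1 j i) + b2n (step 2 j i)))
        ≡⟨ trans (∑ℕ-+ (allFin n) (λ j → b2n (step 1 i j) + b2n (step 2 i j)) (λ j → b2n (step 1 j i) + b2n (step 2 j i)))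
             (cong₂ _+_ (∑ℕ-+ (allFin n) (λ j → b2n (step 1 i j)) (λ j → b2n (step 2 i j))) (∑ℕ-+ (allFin n) (λ j → b2n (step 1 j i)) (λ j → b2n (step 2 j i)))) ⟩
      out 1 + out 2 + (into 1 + into 2)
        ≤⟨ +-mono-≤ (+-mono-≤ (out≤1 1) (out≤1 2)) (+-mono-≤ (into≤1 1) (into≤1 2)) ⟩
      4 ∎
      where
      open ≤-Reasoning
      out into : ℕ → ℕ
      out d  = ∑ℕ (allFin n) (λ j → b2n (step d i j))
      into d = ∑ℕ (allFin n) (λ j → b2n (step d j i))
      out≤1 : ∀ d → out d ≤ 1
      out≤1 d = ∑ℕ-atMostOne (Uniqueₚ.allFin⁺ n) (step d i)
        (λ {j} {j′} _ _ e e′ → trans (sym (does⇒ (shift d i Finₚ.≟ j) e)) (does⇒ (shift d i Finₚ.≟ j′) e′)) {true} (λ _ _ → refl)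
      into≤1 : ∀ d → into d ≤ 1
      into≤1 d = ∑ℕ-atMostOne (Uniqueₚ.allFin⁺ n) (λ j → step d j i)
        (λ {j} {j′} _ _ e e′ → shift-injective d (trans (does⇒ (shift d j Finₚ.≟ i) e) (sym (does⇒ (shift d j′ Finₚ.≟ i) e′)))) {true} (λ _ _ → refl)

    -- The number of walks of length one or two in the square of the cycle: one step for a present
    -- edge, two for a link forced through a common neighbour. Rows sum to at most `4 + 4 * 4`, the
    -- origin of the 20.
    κ : Fin n → Fin n → ℕ
    κ i j = b2n (near i j) + ∑ℕ (allFin n) (λ l → b2n (near i l) * b2n (near l j))

    κ-row : ∀ i → ∑ℕ (allFin n) (κ i) ≤ 20
    κ-row i = begin
      ∑ℕ (allFin n) (κ i)
        ≡⟨ ∑ℕ-+ (allFin n) (λ j → b2n (near i j)) (λ j → ∑ℕ (allFin n) (λ l → b2n (near i l) * b2n (near l j))) ⟩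
      ∑ℕ (allFin n) (λ j → b2n (near i j)) + ∑ℕ (allFin n) (λ j → ∑ℕ (allFin n) (λ l → b2n (near i l) * b2n (near l j)))
        ≡⟨ cong (∑ℕ (allFin n) (λ j → b2n (near i j)) +_) (∑ℕ-swap (allFin n) (allFin n) (λ j l → b2n (near i l) * b2n (near l j))) ⟩
      ∑ℕ (allFin n) (λ j → b2n (near i j)) + ∑ℕ (allFin n) (λ l → ∑ℕ (allFin n) (λ j → b2n (near i l) * b2n (near l j)))
        ≤⟨ +-mono-≤ (near-row i) (∑ℕ-mono (allFin n) (λ {l} _ → second l)) ⟩
      4 + ∑ℕ (allFin n) (λ l → 4 * b2n (near i l))
        ≡⟨ cong (4 +_) (∑ℕ-*ˡ (allFin n) 4 (λ l → b2n (near i l))) ⟩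
      4 + 4 * ∑ℕ (allFin n) (λ l → b2n (near i l))
        ≤⟨ +-monoʳ-≤ 4 (*-monoʳ-≤ 4 (near-row i)) ⟩
      20 ∎
      where
      open ≤-Reasoning
      second : ∀ l → ∑ℕ (allFin n) (λ j → b2n (near i l) * b2n (near l j)) ≤ 4 * b2n (near i l)
      second l = begin
        ∑ℕ (allFin n) (λ j → b2n (near i l) * b2n (near l j)) ≡⟨ ∑ℕ-*ˡ (allFin n) (b2n (near i l)) (λ j → b2n (near l j)) ⟩
        b2n (near i l) * ∑ℕ (allFin n) (λ j → b2n (near l j)) ≤⟨ *-monoʳ-≤ (b2n (near i l)) (near-row l) ⟩
        b2n (near i l) * 4 ≡⟨ *-comm (b2n (near i l)) 4 ⟩
        4 * b2n (near i l) ∎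

    near⇒κ : ∀ {i j} → near i j ≡ true → 1 ≤ κ j i
    near⇒κ {i} {j} e = ≤-trans (b2n-true (near-sym {i} {j} e)) (m≤m+n _ _)

    near²⇒κ : ∀ {i j l} → near i j ≡ true → near i l ≡ true → 1 ≤ κ l j
    near²⇒κ {i} {j} {l} e e′ = ≤-trans (*-mono-≤ (b2n-true (near-sym {i} {l} e′)) (b2n-true e))
      (≤-trans (term≤∑ℕ (λ m → b2n (near l m) * b2n (near m j)) (∈-allFin i)) (m≤n+m _ (b2n (near l j))))

  ∈-pairs⁺ : ∀ {n} {v w : Fin n} → toℕ v < toℕ w → (v , w) ∈ pairs n
  ∈-pairs⁺ {n} {v} {w} v<w = ∈-concat⁺′ (∈-map⁺ (v ,_) (∈-filter⁺ (λ j → toℕ v <? toℕ j) (∈-allFin w) v<w))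
    (∈-map⁺ (λ i → map (λ j → (i , j)) (filter (λ j → toℕ i <? toℕ j) (allFin n))) (∈-allFin v))

  ∈-pairs⁻ : ∀ {n} {e : Fin n × Fin n} → e ∈ pairs n → toℕ (proj₁ e) < toℕ (proj₂ e)
  ∈-pairs⁻ {n} e∈ with ∈-concat⁻′ (map (λ i → map (λ j → (i , j)) (filter (λ j → toℕ i <? toℕ j) (allFin n))) (allFin n)) e∈
  ... | _ , e∈row , row∈ with ∈-map⁻ (λ i → map (λ j → (i , j)) (filter (λ j → toℕ i <? toℕ j) (allFin n))) row∈
  ... | i , _ , refl with ∈-map⁻ (i ,_) e∈row
  ... | j , j∈ , refl = proj₂ (∈-filter⁻ (λ j → toℕ i <? toℕ j) {xs = allFin n} j∈)

  pairs-unique : ∀ n → Unique (pairs n)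
  pairs-unique n = Uniqueₚ.concat⁺
    (Allₚ.map⁺ (All.tabulate (λ {i} _ → Uniqueₚ.map⁺ ,-injectiveʳ (Uniqueₚ.filter⁺ (λ j → toℕ i <? toℕ j) (Uniqueₚ.allFin⁺ n)))))
    (AllPairsₚ.map⁺ (AllPairs.map disjoint (Uniqueₚ.allFin⁺ n)))
    where
    disjoint : ∀ {i i′ : Fin n} → i ≢ i′ → ∀ {e} →
      ¬ (e ∈ map (i ,_) (filter (λ j → toℕ i <? toℕ j) (allFin n)) × e ∈ map (i′ ,_) (filter (λ j → toℕ i′ <? toℕ j) (allFin n)))
    disjoint {i} {i′} i≢i′ (e∈ , e∈′) with ∈-map⁻ (i ,_) e∈ | ∈-map⁻ (i′ ,_) e∈′
    ... | _ , _ , refl | _ , _ , eq = i≢i′ (,-injectiveˡ eq)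

  lookup-unique : ∀ {xs : List A} → Unique xs → ∀ {k l} → List.lookup xs k ≡ List.lookup xs l → k ≡ l
  lookup-unique (x∉ ∷ uniq) {Fin.zero}  {Fin.zero}  e = refl
  lookup-unique (x∉ ∷ uniq) {Fin.zero}  {Fin.suc l} e = contradiction e (All.lookup x∉ (∈-lookup l))
  lookup-unique (x∉ ∷ uniq) {Fin.suc k} {Fin.zero}  e = contradiction (sym e) (All.lookup x∉ (∈-lookup k))
  lookup-unique (x∉ ∷ uniq) {Fin.suc k} {Fin.suc l} e = cong Fin.suc (lookup-unique uniq e)

  -- The last component of `Adj`, so that a proof can be handed over as it is.
  Joins : ∀ {n} → Fin (length (pairs n)) → Fin n → Fin n → Set
  Joins {n} k v w = List.lookup (pairs n) k ≡ (v , w) ⊎ List.lookup (pairs n) k ≡ (w , v)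

  joins? : ∀ {n} k (v w : Fin n) → Dec (Joins k v w)
  joins? {n} k v w = (List.lookup (pairs n) k ≟ₚ (v , w)) ⊎-dec (List.lookup (pairs n) k ≟ₚ (w , v))
    where _≟ₚ_ = Productₚ.≡-dec Finₚ._≟_ Finₚ._≟_

  joins-exists : ∀ {n} {v w : Fin n} → v ≢ w → ∃ λ k → Joins k v w
  joins-exists {n} {v} {w} v≢w with <-cmp (toℕ v) (toℕ w)
  ... | tri< v<w _ _ = Any.index (∈-pairs⁺ v<w) , inj₁ (sym (lookup-index (∈-pairs⁺ v<w)))
  ... | tri≈ _ v≡w _ = contradiction (Finₚ.toℕ-injective v≡w) v≢w
  ... | tri> _ _ w<v = Any.index (∈-pairs⁺ w<v) , inj₂ (sym (lookup-index (∈-pairs⁺ w<v)))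

  joins-ordered : ∀ {n} k {v w : Fin n} → List.lookup (pairs n) k ≡ (v , w) → toℕ v < toℕ w
  joins-ordered {n} k e = subst (λ e → toℕ (proj₁ e) < toℕ (proj₂ e)) e (∈-pairs⁻ {n} (∈-lookup k))

  -- `pairs` lists every edge once and with the smaller endpoint first, so both orientations cannot
  -- occur.
  joins-unique : ∀ {n} {k l} {v w : Fin n} → Joins k v w → Joins l v w → k ≡ l
  joins-unique {n} (inj₁ e) (inj₁ e′) = lookup-unique (pairs-unique n) (trans e (sym e′))
  joins-unique {n} (inj₂ e) (inj₂ e′) = lookup-unique (pairs-unique n) (trans e (sym e′))
  joins-unique {n} {k} {l} (inj₁ e) (inj₂ e′) = contradiction (joins-ordered l e′) (<-asym (joins-ordered k e))
  joins-unique {n} {k} {l} (inj₂ e) (inj₁ e′) = contradiction (joins-ordered l e′) (<-asym (joins-ordered k e))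

-- The edges of a squared cycle as slots of a linear order.

module SlotCounting where

  open import Data.Nat using (ℕ; zero; suc; _+_; _≤_; _<_; z≤n; s≤s)
  open import Data.Nat.Properties
  open import Data.Fin as Fin using (Fin)
  import Data.Fin.Properties as Finₚ
  open import Data.List as List using (List; []; _∷_; length; _++_; allFin)
  open import Data.List.Membership.Propositional using (_∈_)
  open import Data.List.Membership.Propositional.Properties using (∈-allFin; ∈-++⁺ʳ)
  open import Data.List.Relation.Unary.Any using (here; there)
  open import Data.List.Relation.Unary.All as All using (All; []; _∷_)
  open import Data.List.Relation.Unary.AllPairs using ([]; _∷_)
  open import Data.List.Relation.Unary.Unique.Propositional using (Unique)
  import Data.List.Relation.Unary.Unique.Propositional.Properties as Uniqueₚ
  open import Data.Product.Properties using (,-injectiveˡ; ,-injectiveʳ)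
  open import Data.Vec as Vec using (Vec; []; _∷_)
  import Data.Vec.Properties as Vecₚ
  open import Data.Fin.Subset using (Subset; _∩_; ∣_∣; _⊆_) renaming (_∈_ to _∈ₛ_)
  open import Data.Fin.Subset.Properties using (p∩q⊆p; p∩q⊆q) renaming (_∈?_ to _∈ₛ?_)
  open import Data.Bool.Properties using (∧-conicalˡ; ∧-conicalʳ)
  open Expectation using (ι; ∑; 𝟙; ∑-mono; ∑-*ˡ; 0≤^; 0≤+; 0≤1; x≤x+; *-monoˡ; ^-+; ^-monoʳ) renaming (_^_ to _^ℚ_)
  open Permutations
  open SpreadBound
  open CyclicSquare
  open TransferMatrix using (b2n; module Transfer)

  ∣∣≡∑ : ∀ {N} (F : Subset N) → ∣ F ∣ ≡ ∑ℕ (allFin N) (λ k → b2n (Vec.lookup F k))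
  ∣∣≡∑ F = go F id (λ k → b2n (Vec.lookup F k)) (λ _ → refl)
    where
    go : ∀ {N} {A : Set} (F : Subset N) (g : Fin N → A) (f : A → ℕ) → (∀ k → f (g k) ≡ b2n (Vec.lookup F k)) → ∣ F ∣ ≡ ∑ℕ (List.tabulate g) f
    go []          g f e = refl
    go (true  ∷ F) g f e = cong₂ _+_ (sym (e Fin.zero)) (go F (g ∘ Fin.suc) f (e ∘ Fin.suc))
    go (false ∷ F) g f e = cong₂ _+_ (sym (e Fin.zero)) (go F (g ∘ Fin.suc) f (e ∘ Fin.suc))

  -- The pigeonhole principle behind the choice of a cut.
  ∑ℕ<length⇒zero : ∀ {A : Set} (xs : List A) (f : A → ℕ) → ∑ℕ xs f < length xs → ∃ λ a → f a ≡ 0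
  ∑ℕ<length⇒zero (x ∷ xs) f lt with f x in fx
  ... | zero  = x , fx
  ... | suc c = ∑ℕ<length⇒zero xs f (≤-trans (s≤s (m≤n+m (∑ℕ xs f) c)) (≤-pred lt))

  b2n-does≤ : ∀ {P : Set} (d : Dec P) {c} → (P → 1 ≤ c) → b2n (does d) ≤ c
  b2n-does≤ (yes p) h = h p
  b2n-does≤ (no  _) h = z≤n

  -- Listed from the top vertex down, in the order in which `Transfer` adds up its edges.
  slots : ℕ → List (ℕ × ℕ)
  slots zero    = []
  slots (suc m) = (2 + m , 1 + m) ∷ (2 + m , m) ∷ slots m

  slots-below : ∀ m {u v} → (u , v) ∈ slots m → u < 2 + m × v < u
  slots-below (suc m) (here refl)         = ≤-refl , ≤-refl
  slots-below (suc m) (there (here refl)) = ≤-refl , n≤1+n (suc m)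
  slots-below (suc m) (there (there s∈))  = let (u< , v<) = slots-below m s∈ in ≤-trans u< (n≤1+n _) , v<

  slots-unique : ∀ m → Unique (slots m)
  slots-unique zero    = []
  slots-unique (suc m) = ((λ e → 1+n≢n (,-injectiveʳ e)) ∷ All.tabulate (above (1 + m))) ∷ (All.tabulate (above m) ∷ slots-unique m)
    where
    above : ∀ v {s} → s ∈ slots m → (2 + m , v) ≢ s
    above v s∈ refl = <-irrefl refl (proj₁ (slots-below m s∈))

  ∈-slots₁ : ∀ {m i} → i < m → (2 + i , 1 + i) ∈ slots m
  ∈-slots₁ {suc m} {i} i<m with m≤n⇒m<n∨m≡n (≤-pred i<m)
  ... | inj₁ i<m′ = there (there (∈-slots₁ i<m′))
  ... | inj₂ refl = here refl

  ∈-slots₂ : ∀ {m i} → i < m → (2 + i , i) ∈ slots m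
  ∈-slots₂ {suc m} {i} i<m with m≤n⇒m<n∨m≡n (≤-pred i<m)
  ... | inj₁ i<m′ = there (there (∈-slots₂ i<m′))
  ... | inj₂ refl = there (here refl)

  module Overlap (m₀ : ℕ) where

    open Cyclic (suc m₀)

    N : ℕ
    N = length (pairs n)

    ends : Fin N → Fin n × Fin n
    ends = List.lookup (pairs n)

    isEdge : Perm n → Fin N → Bool
    isEdge ω k = near (pos ω (proj₁ (ends k))) (pos ω (proj₂ (ends k)))

    E : Perm n → Subset N
    E ω = Vec.tabulate (isEdge ω)

    E⇒near : ∀ ω k {v w} → Joins k v w → k ∈ₛ E ω → near (pos ω v) (pos ω w) ≡ true
    E⇒near ω k {v} {w} j k∈ = [ (λ e → subst₂ (λ v w → near (pos ω v) (pos ω w) ≡ true) (cong proj₁ e) (cong proj₂ e) here′)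
                              , (λ e → near-sym {pos ω w} {pos ω v} (subst₂ (λ v w → near (pos ω v) (pos ω w) ≡ true) (cong proj₁ e) (cong proj₂ e) here′)) ]′ j
      where
      here′ : near (pos ω (proj₁ (ends k))) (pos ω (proj₂ (ends k))) ≡ true
      here′ = trans (sym (Vecₚ.lookup∘tabulate (isEdge ω) k)) (Vecₚ.[]=⇒lookup k∈)

    near⇒E : ∀ ω k {v w} → Joins k v w → near (pos ω v) (pos ω w) ≡ true → k ∈ₛ E ω
    near⇒E ω k {v} {w} j e = Vecₚ.lookup⇒[]= k (E ω) (trans (Vecₚ.lookup∘tabulate (isEdge ω) k) (oriented j))
      where
      oriented : Joins k v w → near (pos ω (proj₁ (ends k))) (pos ω (proj₂ (ends k))) ≡ true
      oriented (inj₁ eq) = trans (cong (λ (v , w) → near (pos ω v) (pos ω w)) eq) e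
      oriented (inj₂ eq) = trans (cong (λ (v , w) → near (pos ω v) (pos ω w)) eq) (near-sym {pos ω v} {pos ω w} e)

    -- The edges of the cyclic square ordered from a base vertex that are not of the form (u , u - 1) or (u , u - 2) with 2 ≤ u < n.
    extra : List (ℕ × ℕ)
    extra = (1 , 0) ∷ (1 + m₀ , 0) ∷ (1 + m₀ , 1) ∷ (m₀ , 0) ∷ []

    module _ {τ : Perm n} (τ∈ : τ ∈ perms n) where

      -- Numbers the vertices along `τ` from the position `r`. Cutting the cycle there makes the
      -- edges of `E τ` back edges of this numbering, apart from those in `extra`.
      order : Fin n → ℕ → Fin n
      order r u = vert τ (shift u r)

      vert-injective : ∀ {i j} → vert τ i ≡ vert τ j → i ≡ j
      vert-injective {i} {j} e = trans (sym (proj₂ (∈-perms⁻ τ∈) i)) (trans (cong (pos τ) e) (proj₂ (∈-perms⁻ τ∈) j))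

      module _ {F : Subset N} where

        selected? : ∀ r (s : ℕ × ℕ) → Dec (∃ λ k → k ∈ₛ F × Joins k (order r (proj₁ s)) (order r (proj₂ s)))
        selected? r (u , v) = Finₚ.any? (λ k → (k ∈ₛ? F) ×-dec joins? k (order r u) (order r v))

        selected : Fin n → ℕ × ℕ → Bool
        selected r s = does (selected? r s)

        wrapping : Fin n → ℕ
        wrapping r = ∑ℕ extra (λ s → b2n (selected r s))

        wrapping≤4 : ∀ r → wrapping r ≤ 4
        wrapping≤4 r = ∑ℕ-mono extra {g = λ _ → 1} (λ {s} _ → b2n≤1 (selected r s))

        module _ (r : Fin n) where

          a : ℕ → Fin n
          a = order r

          a-injective : ∀ {u v} → u < n → v < n → a u ≡ a v → u ≡ v
          a-injective u<n v<n e = shift-injectiveˡ r u<n v<n (vert-injective e)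

          a-+n : ∀ u → a (u + n) ≡ a u
          a-+n u = cong (vert τ) (shift-+n u r)

          joinsAt? : ∀ s k → Dec (Joins k (a (proj₁ s)) (a (proj₂ s)))
          joinsAt? (u , v) k = joins? k (a u) (a v)

          -- Stepping past the last vertex wraps around to 0 or 1: from `1 + m₀` by one or two
          -- steps, and from `m₀` by two. These three pairs and `(1 , 0)` are the entries of
          -- `extra`.
          slot : ∀ u d → u < n → d ≡ 1 ⊎ d ≡ 2 → ∃ λ s → s ∈ extra ++ slots m₀ ×
            ((a (proj₁ s) ≡ a u × a (proj₂ s) ≡ a (u + d)) ⊎ (a (proj₁ s) ≡ a (u + d) × a (proj₂ s) ≡ a u))
          slot zero d _ (inj₁ refl) = (1 , 0) , here refl , inj₂ (refl , refl)
          slot (suc i) d (s≤s i<) (inj₁ refl) with m≤n⇒m<n∨m≡n (≤-pred i<)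
          ... | inj₁ i<m₀ = (2 + i , 1 + i) , ∈-++⁺ʳ extra (∈-slots₁ i<m₀) , inj₂ (cong (a ∘ suc) (+-comm 1 i) , refl)
          ... | inj₂ refl = (1 + m₀ , 0) , there (here refl) , inj₁ (refl , trans (sym (a-+n 0)) (cong (a ∘ suc) (+-comm 1 m₀)))
          slot u d (s≤s u≤) (inj₂ refl) with m≤n⇒m<n∨m≡n u≤
          ... | inj₂ refl = (1 + m₀ , 1) , there (there (here refl)) , inj₁ (refl , trans (sym (a-+n 1)) (cong (a ∘ suc) (+-comm 2 m₀)))
          ... | inj₁ u< with m≤n⇒m<n∨m≡n (≤-pred u<)
          ...   | inj₁ u<m₀ = (2 + u , u) , ∈-++⁺ʳ extra (∈-slots₂ u<m₀) , inj₂ (cong a (+-comm 2 u) , refl)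
          ...   | inj₂ refl = (m₀ , 0) , there (there (there (here refl))) , inj₁ (refl , trans (sym (a-+n 0)) (cong a (+-comm 2 m₀)))

          slot-between : ∀ {v w} d → d ≡ 1 ⊎ d ≡ 2 → pos τ w ≡ shift d (pos τ v) → ∃ λ s → s ∈ extra ++ slots m₀ ×
            ((a (proj₁ s) ≡ v × a (proj₂ s) ≡ w) ⊎ (a (proj₁ s) ≡ w × a (proj₂ s) ≡ v))
          slot-between {v} {w} d d≡ eq with shift-reaches r (pos τ v)
          ... | u , u<n , pv≡ = let (s , s∈ , match) = slot u d u<n d≡ in s , s∈ ,
            [ (λ (e , e′) → inj₁ (trans e au≡v , trans e′ aud≡w)) , (λ (e , e′) → inj₂ (trans e aud≡w , trans e′ au≡v)) ]′ match
            where
            au≡v : a u ≡ v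
            au≡v = trans (cong (vert τ) (sym pv≡)) (proj₁ (∈-perms⁻ τ∈) v)
            aud≡w : a (u + d) ≡ w
            aud≡w = trans (cong (vert τ) (trans (sym (shift-shift u d r)) (trans (cong (shift d) (sym pv≡)) (sym eq)))) (proj₁ (∈-perms⁻ τ∈) w)

          slot-of : ∀ {k} → k ∈ₛ E τ → ∃ λ s → s ∈ extra ++ slots m₀ × Joins k (a (proj₁ s)) (a (proj₂ s))
          slot-of {k} k∈ with near⇒Near {pos τ (proj₁ (ends k))} {pos τ (proj₂ (ends k))} (E⇒near τ k (inj₁ refl) k∈)
          ... | forth d d≡ e = let (s , s∈ , match) = slot-between d d≡ e in s , s∈ ,
            [ (λ (e , e′) → inj₁ (cong₂ _,_ (sym e) (sym e′))) , (λ (e , e′) → inj₂ (cong₂ _,_ (sym e′) (sym e))) ]′ match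
          ... | back d d≡ e = let (s , s∈ , match) = slot-between d d≡ e in s , s∈ ,
            [ (λ (e , e′) → inj₂ (cong₂ _,_ (sym e′) (sym e))) , (λ (e , e′) → inj₁ (cong₂ _,_ (sym e) (sym e′))) ]′ match

          adjacent : Perm n → ℕ × ℕ → Bool
          adjacent ω (u , v) = near (pos ω (a u)) (pos ω (a v))

          lookup⇒∈ : ∀ {G : Subset N} {k} → Vec.lookup G k ≡ true → k ∈ₛ G
          lookup⇒∈ {G} {k} = Vecₚ.lookup⇒[]= k G

          joined : Subset N → ℕ × ℕ → Fin N → Bool
          joined G s k = Vec.lookup G k ∧ does (joinsAt? s k)

          joined⇒∈ : ∀ G s k → joined G s k ≡ true → k ∈ₛ G
          joined⇒∈ G s k e = lookup⇒∈ (∧-conicalˡ (Vec.lookup G k) (does (joinsAt? s k)) e)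

          joined⇒joins : ∀ G s k → joined G s k ≡ true → Joins k (a (proj₁ s)) (a (proj₂ s))
          joined⇒joins G s k e = does⇒ (joinsAt? s k) (∧-conicalʳ (Vec.lookup G k) (does (joinsAt? s k)) e)

          edges-at : ∀ G s {c} → (∀ {k} → k ∈ₛ G → Joins k (a (proj₁ s)) (a (proj₂ s)) → c ≡ true) →
            ∑ℕ (allFin N) (λ k → b2n (joined G s k)) ≤ b2n c
          edges-at G s imp = ∑ℕ-atMostOne (Uniqueₚ.allFin⁺ N) (joined G s)
            (λ {k} {l} _ _ e e′ → joins-unique (joined⇒joins G s k e) (joined⇒joins G s l e′))
            (λ {k} _ e → imp (joined⇒∈ G s k e) (joined⇒joins G s k e))

          selected-by : ∀ s {k} → k ∈ₛ F → Joins k (a (proj₁ s)) (a (proj₂ s)) → selected r s ≡ true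
          selected-by s k∈ j = dec-true (selected? r s) (_ , k∈ , j)

          -- Every edge of `F ∩ E ω` lies in some slot, and no slot holds two edges. For the slots
          -- in `extra` membership in `E ω` is dropped, which leaves a count independent of `ω`.
          intersection≤ : F ⊆ E τ → ∀ ω → ∣ F ∩ E ω ∣ ≤ wrapping r + ∑ℕ (slots m₀) (λ s → b2n (selected r s ∧ adjacent ω s))
          intersection≤ F⊆Eτ ω = begin
            ∣ G ∣ ≡⟨ ∣∣≡∑ G ⟩
            ∑ℕ (allFin N) (λ k → b2n (Vec.lookup G k)) ≤⟨ ∑ℕ-mono (allFin N) (λ {k} _ → covered k) ⟩
            ∑ℕ (allFin N) (λ k → ∑ℕ all (λ s → b2n (joined G s k))) ≡⟨ ∑ℕ-swap (allFin N) all (λ k s → b2n (joined G s k)) ⟩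
            ∑ℕ all (λ s → ∑ℕ (allFin N) (λ k → b2n (joined G s k))) ≡⟨ ∑ℕ-++ extra (slots m₀) _ ⟩
            ∑ℕ extra (λ s → ∑ℕ (allFin N) (λ k → b2n (joined G s k))) + ∑ℕ (slots m₀) (λ s → ∑ℕ (allFin N) (λ k → b2n (joined G s k)))
              ≤⟨ +-mono-≤ (∑ℕ-mono extra (λ {s} _ → edges-at G s (λ k∈ → selected-by s (p∩q⊆p F (E ω) k∈))))
                          (∑ℕ-mono (slots m₀) (λ {s} _ → edges-at G s (λ {k} k∈ j →
                            cong₂ _∧_ (selected-by s (p∩q⊆p F (E ω) k∈) j) (E⇒near ω k j (p∩q⊆q F (E ω) k∈))))) ⟩
            wrapping r + ∑ℕ (slots m₀) (λ s → b2n (selected r s ∧ adjacent ω s)) ∎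
            where
            open ≤-Reasoning
            G = F ∩ E ω
            all = extra ++ slots m₀
            covered : ∀ k → b2n (Vec.lookup G k) ≤ ∑ℕ all (λ s → b2n (joined G s k))
            covered k with Vec.lookup G k in eq
            ... | false = z≤n
            ... | true  = let (s , s∈ , j) = slot-of (F⊆Eτ (p∩q⊆p F (E ω) (lookup⇒∈ eq))) in
              ≤-trans (b2n-true (dec-true (joinsAt? s k) j)) (term≤∑ℕ (λ s → b2n (does (joinsAt? s k))) s∈)

          -- An edge fills at most one slot: the first vertex of a slot has the larger number, which
          -- excludes a crossed match, and the numbering is injective.
          selected≤ : ∑ℕ (slots m₀) (λ s → b2n (selected r s)) ≤ ∣ F ∣
          selected≤ = begin
            ∑ℕ (slots m₀) (λ s → b2n (selected r s)) ≤⟨ ∑ℕ-mono (slots m₀) (λ {s} _ → witness s) ⟩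
            ∑ℕ (slots m₀) (λ s → ∑ℕ (allFin N) (λ k → b2n (joined F s k))) ≡⟨ ∑ℕ-swap (slots m₀) (allFin N) (λ s k → b2n (joined F s k)) ⟩
            ∑ℕ (allFin N) (λ k → ∑ℕ (slots m₀) (λ s → b2n (joined F s k))) ≤⟨ ∑ℕ-mono (allFin N) (λ {k} _ → single k) ⟩
            ∑ℕ (allFin N) (λ k → b2n (Vec.lookup F k)) ≡⟨ ∣∣≡∑ F ⟨
            ∣ F ∣ ∎
            where
            open ≤-Reasoning
            witness : ∀ s → b2n (selected r s) ≤ ∑ℕ (allFin N) (λ k → b2n (joined F s k))
            witness s = b2n-does≤ (selected? r s) (λ (k , k∈ , j) →
              ≤-trans (b2n-true (cong₂ _∧_ (Vecₚ.[]=⇒lookup k∈) (dec-true (joinsAt? s k) j))) (term≤∑ℕ (λ k → b2n (joined F s k)) (∈-allFin k)))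
            same : ∀ {u v u′ v′} → u < n → v < u → u′ < n → v′ < u′ → ∀ k → Joins k (a u) (a v) → Joins k (a u′) (a v′) → (u , v) ≡ (u′ , v′)
            same {u} {v} {u′} {v′} u< v< u′< v′< k j j′ = go j j′
              where
              straight : ∀ {e} → e ≡ (a u , a v) → e ≡ (a u′ , a v′) → (u , v) ≡ (u′ , v′)
              straight refl e = cong₂ _,_ (a-injective u< u′< (,-injectiveˡ e)) (a-injective (<-trans v< u<) (<-trans v′< u′<) (,-injectiveʳ e))
              crossed : a u ≡ a v′ → a v ≡ a u′ → (u , v) ≡ (u′ , v′)
              crossed e e′ = contradiction (subst₂ _<_ (a-injective (<-trans v< u<) u′< e′) (a-injective u< (<-trans v′< u′<) e) v<) (<-asym v′<)
              go : Joins k (a u) (a v) → Joins k (a u′) (a v′) → (u , v) ≡ (u′ , v′)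
              go (inj₁ e) (inj₁ e′) = straight e e′
              go (inj₁ e) (inj₂ e′) = let c = trans (sym e) e′ in crossed (,-injectiveˡ c) (,-injectiveʳ c)
              go (inj₂ e) (inj₁ e′) = let c = trans (sym e) e′ in crossed (,-injectiveʳ c) (,-injectiveˡ c)
              go (inj₂ e) (inj₂ e′) = let c = trans (sym e) e′ in straight refl (cong₂ _,_ (,-injectiveʳ c) (,-injectiveˡ c))
            single : ∀ k → ∑ℕ (slots m₀) (λ s → b2n (joined F s k)) ≤ b2n (Vec.lookup F k)
            single k = ∑ℕ-atMostOne (slots-unique m₀) (λ s → joined F s k)
              (λ {s} {s′} s∈ s′∈ e e′ → let (u< , v<) = slots-below m₀ s∈ ; (u′< , v′<) = slots-below m₀ s′∈ in
                same u< v< u′< v′< k (joined⇒joins F s k e) (joined⇒joins F s′ k e′))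
              (λ {s} _ e → ∧-conicalˡ (Vec.lookup F k) (does (joinsAt? s k)) e)

-- Overlap averages for full squared cycles and for small edge sets.

module OverlapBound where

  open import Data.Nat using (ℕ; zero; suc; _+_; _*_; _≤_; _<_; z≤n; s≤s)
  open import Data.Nat.Properties
  open import Data.Nat.Tactic.RingSolver using (solve-∀)
  open import Data.Fin as Fin using (Fin)
  import Data.Fin.Properties as Finₚ
  open import Data.List using (List; []; _∷_; length; allFin)
  import Data.List.Properties as Listₚ
  open import Data.List.Membership.Propositional using (_∈_)
  open import Data.List.Membership.Propositional.Properties using (∈-allFin)
  open import Data.List.Relation.Unary.Any using (here; there)
  open import Data.List.Relation.Unary.All using ([]; _∷_)
  open import Data.List.Relation.Unary.AllPairs using ([]; _∷_)
  import Data.List.Relation.Unary.Unique.Propositional.Properties as Uniqueₚ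
  open import Data.Vec as Vec using (Vec; []; _∷_)
  import Data.Vec.Properties as Vecₚ
  open import Data.Fin.Subset using (Subset; _∩_; ∣_∣; _⊆_) renaming (_∈_ to _∈ₛ_)
  open import Data.Bool.Properties using (∧-conicalˡ; ∧-conicalʳ)
  open import Data.Rational as ℚ using (ℚ; 0ℚ; 1ℚ)
  import Data.Rational.Properties as ℚₚ
  open import Data.Fin.Permutation using (permutation)
  import Tactic.RingSolver
  open import Data.Fin.Subset.Properties using (⊆-refl)
  open Expectation using (ι; ∑; 𝟙; ∑-mono; ∑-*ˡ; ∑-cong; 0≤^; 0≤+; 0≤1; x≤x+; *-monoˡ; ^-+; ^-monoʳ; *-monoʳ; 0≤ι; 0≤*; ℚ-ring) renaming (_^_ to _^ℚ_)
  open Permutations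
  open SpreadBound
  open CyclicSquare
  open SlotCounting
  open TransferMatrix using (b2n; module Transfer)

  module Bounds (m₀ : ℕ) where

    open Cyclic (suc m₀)
    open Overlap m₀

    module _ {τ : Perm n} (τ∈ : τ ∈ perms n) (F : Subset N) where

      private
        tips : List ℕ
        tips = 0 ∷ 1 ∷ 1 + m₀ ∷ m₀ ∷ []

        -- Pairs of `extra` have both their vertices at `tips`, so testing one endpoint of an edge
        -- detects them, and an edge of `F` is cut at no more than four bases.
        cut : Fin n → Fin N → ℕ → Bool
        cut r k d = Vec.lookup F k ∧ does (proj₁ (ends k) Finₚ.≟ order τ∈ r d)

        cuts : Fin n → ℕ
        cuts r = ∑ℕ (allFin N) (λ k → ∑ℕ tips (λ d → b2n (cut r k d)))

        ∑cuts≤ : ∑ℕ (allFin n) cuts ≤ 4 * ∣ F ∣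
        ∑cuts≤ = begin
          ∑ℕ (allFin n) cuts
            ≡⟨ ∑ℕ-swap (allFin n) (allFin N) (λ r k → ∑ℕ tips (λ d → b2n (cut r k d))) ⟩
          ∑ℕ (allFin N) (λ k → ∑ℕ (allFin n) (λ r → ∑ℕ tips (λ d → b2n (cut r k d))))
            ≡⟨ ∑ℕ-cong (allFin N) (λ k → ∑ℕ-swap (allFin n) tips (λ r d → b2n (cut r k d))) ⟩
          ∑ℕ (allFin N) (λ k → ∑ℕ tips (λ d → ∑ℕ (allFin n) (λ r → b2n (cut r k d))))
            ≤⟨ ∑ℕ-mono (allFin N) (λ {k} _ → ∑ℕ-mono tips (λ {d} _ → once k d)) ⟩
          ∑ℕ (allFin N) (λ k → 4 * b2n (Vec.lookup F k))
            ≡⟨ ∑ℕ-*ˡ (allFin N) 4 (λ k → b2n (Vec.lookup F k)) ⟩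
          4 * ∑ℕ (allFin N) (λ k → b2n (Vec.lookup F k))
            ≡⟨ cong (4 *_) (∣∣≡∑ F) ⟨
          4 * ∣ F ∣ ∎
          where
          open ≤-Reasoning
          once : ∀ k d → ∑ℕ (allFin n) (λ r → b2n (cut r k d)) ≤ b2n (Vec.lookup F k)
          once k d = ∑ℕ-atMostOne (Uniqueₚ.allFin⁺ n) (λ r → cut r k d)
            (λ {r} {r′} _ _ e e′ → shift-injective d (vert-injective τ∈ (trans (sym (hit r e)) (hit r′ e′))))
            (λ {r} _ e → ∧-conicalˡ (Vec.lookup F k) (does (proj₁ (ends k) Finₚ.≟ order τ∈ r d)) e)
            where
            hit : ∀ r → cut r k d ≡ true → proj₁ (ends k) ≡ order τ∈ r d
            hit r e = does⇒ (proj₁ (ends k) Finₚ.≟ order τ∈ r d) (∧-conicalʳ (Vec.lookup F k) (does (proj₁ (ends k) Finₚ.≟ order τ∈ r d)) e)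

      -- Few edges leave room for a base at which the cyclic order is cut without cutting an edge of F.
      uncut-base : 4 * ∣ F ∣ < n → ∃ λ r → wrapping τ∈ {F} r ≡ 0
      uncut-base few = r , n≤0⇒n≡0 (∑ℕ-mono extra {g = λ _ → 0} (λ {s} s∈ → b2n-does≤ (selected? τ∈ r s) (λ (k , k∈ , j) → cut-by s s∈ k k∈ j)))
        where
        found : ∃ λ r → cuts r ≡ 0
        found = ∑ℕ<length⇒zero (allFin n) cuts (≤-trans (s≤s ∑cuts≤) (subst (4 * ∣ F ∣ <_) (sym (Listₚ.length-tabulate {n = n} id)) few))
        r = proj₁ found
        impossible : ∀ k {d} → d ∈ tips → k ∈ₛ F → proj₁ (ends k) ≡ order τ∈ r d → 1 ≤ 0
        impossible k {d} d∈ k∈ e = subst (1 ≤_) (proj₂ found) (begin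
          1 ≤⟨ b2n-true (cong₂ _∧_ (Vecₚ.[]=⇒lookup k∈) (dec-true (proj₁ (ends k) Finₚ.≟ order τ∈ r d) e)) ⟩
          b2n (cut r k d) ≤⟨ term≤∑ℕ (λ d → b2n (cut r k d)) d∈ ⟩
          ∑ℕ tips (λ d → b2n (cut r k d)) ≤⟨ term≤∑ℕ (λ k → ∑ℕ tips (λ d → b2n (cut r k d))) (∈-allFin k) ⟩
          cuts r ∎)
          where open ≤-Reasoning
        tips-of : ∀ {s} → s ∈ extra → proj₁ s ∈ tips × proj₂ s ∈ tips
        tips-of (here refl)                         = there (here refl) , here refl
        tips-of (there (here refl))                 = there (there (here refl)) , here refl
        tips-of (there (there (here refl)))         = there (there (here refl)) , there (here refl)
        tips-of (there (there (there (here refl)))) = there (there (there (here refl))) , here refl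
        cut-by : ∀ s → s ∈ extra → ∀ k → k ∈ₛ F → Joins k (order τ∈ r (proj₁ s)) (order τ∈ r (proj₂ s)) → 1 ≤ 0
        cut-by s s∈ k k∈ (inj₁ e) = impossible k (proj₁ (tips-of s∈)) k∈ (cong proj₁ e)
        cut-by s s∈ k k∈ (inj₂ e) = impossible k (proj₂ (tips-of s∈)) k∈ (cong proj₁ e)

    module _ {x y : ℚ} (0≤x : 0ℚ ℚ.≤ x) (0≤y : 0ℚ ℚ.≤ y) (0<n : 0ℚ ℚ.< ι n) (yn≡160 : y ℚ.* ι n ≡ ι 160)
      (2x²y≤1 : x ℚ.* x ℚ.* y ℚ.+ x ℚ.* x ℚ.* y ℚ.≤ 1ℚ) where

      private
        h η : ℚ
        h = ι (length (perms n))
        η = y ℚ.+ x ℚ.* y ℚ.+ x ℚ.* y ℚ.+ x ℚ.* y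

        1≤1+x : 1ℚ ℚ.≤ 1ℚ ℚ.+ x
        1≤1+x = x≤x+ 0≤x

        1≤1+η : 1ℚ ℚ.≤ 1ℚ ℚ.+ η
        1≤1+η = x≤x+ (0≤+ (0≤+ (0≤+ 0≤y (0≤* 0≤x 0≤y)) (0≤* 0≤x 0≤y)) (0≤* 0≤x 0≤y))

      module _ {τ : Perm n} (τ∈ : τ ∈ perms n) {F : Subset N} (F⊆Eτ : F ⊆ E τ) (r : Fin n) where

        private
          sel : ℕ × ℕ → Bool
          sel = selected τ∈ {F} r
          c₁ c₂ : ℕ → Bool
          c₁ m = sel (2 + m , 1 + m)
          c₂ m = sel (2 + m , m)

          module Sp = Spread near κ 20 κ-row (λ {i} {j} → near⇒κ {i} {j}) (λ {i} {j} {l} → near²⇒κ {i} {j} {l}) (order τ∈ r) (a-injective τ∈ {F} r)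
          module Tr = Transfer c₁ c₂ x 0≤x

          count≡ : ∀ ω m → Tr.count (Sp.adj ω) m ≡ ∑ℕ (slots m) (λ s → b2n (sel s ∧ adjacent τ∈ {F} r ω s))
          count≡ ω zero    = refl
          count≡ ω (suc m) = cong (λ z → b2n (sel (2 + m , 1 + m) ∧ adjacent τ∈ {F} r ω (2 + m , 1 + m)) + (b2n (sel (2 + m , m) ∧ adjacent τ∈ {F} r ω (2 + m , m)) + z)) (count≡ ω m)

          total≡ : ∀ m → Tr.total m ≡ ∑ℕ (slots m) (λ s → b2n (sel s))
          total≡ zero    = refl
          total≡ (suc m) = cong (λ z → b2n (sel (2 + m , 1 + m)) + (b2n (sel (2 + m , m)) + z)) (total≡ m)

        -- Edges of `F` across the cut are charged the full factor `1 + x`, as if they lay in every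
        -- `E ω`; the other slots are charged `1 + η`.
        overlap-at : ∑ (perms n) (λ ω → (1ℚ ℚ.+ x) ^ℚ ∣ F ∩ E ω ∣) ℚ.≤
          (1ℚ ℚ.+ x) ^ℚ wrapping τ∈ {F} r ℚ.* (h ℚ.* (1ℚ ℚ.+ η) ^ℚ ∑ℕ (slots m₀) (λ s → b2n (sel s)))
        overlap-at = begin
          ∑ (perms n) (λ ω → X ^ℚ ∣ F ∩ E ω ∣)
            ≤⟨ ∑-mono (perms n) (λ {ω} _ → ^-monoʳ 1≤1+x (≤-trans (intersection≤ τ∈ {F} r F⊆Eτ ω) (≤-reflexive (cong (w +_) (sym (count≡ ω m₀)))))) ⟩
          ∑ (perms n) (λ ω → X ^ℚ (w + Tr.count (Sp.adj ω) m₀))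
            ≡⟨ ∑-cong (perms n) (λ ω → ^-+ X w (Tr.count (Sp.adj ω) m₀)) ⟩
          ∑ (perms n) (λ ω → X ^ℚ w ℚ.* X ^ℚ Tr.count (Sp.adj ω) m₀)
            ≡⟨ ∑-*ˡ (perms n) (X ^ℚ w) (λ ω → X ^ℚ Tr.count (Sp.adj ω) m₀) ⟩
          X ^ℚ w ℚ.* ∑ (perms n) (λ ω → X ^ℚ Tr.count (Sp.adj ω) m₀)
            ≤⟨ *-monoˡ (0≤^ w (ℚₚ.≤-trans 0≤1 1≤1+x)) (Sp.spread-sum c₁ c₂ x 0≤x y 0≤y 0<n yn≡160 2x²y≤1 m₀ ≤-refl) ⟩
          X ^ℚ w ℚ.* (h ℚ.* (1ℚ ℚ.+ η) ^ℚ Tr.total m₀)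
            ≡⟨ cong (λ z → X ^ℚ w ℚ.* (h ℚ.* (1ℚ ℚ.+ η) ^ℚ z)) (total≡ m₀) ⟩
          X ^ℚ w ℚ.* (h ℚ.* (1ℚ ℚ.+ η) ^ℚ ∑ℕ (slots m₀) (λ s → b2n (sel s))) ∎
          where
          open ℚₚ.≤-Reasoning
          X = 1ℚ ℚ.+ x
          w = wrapping τ∈ {F} r

      length-slots : ∀ m → length (slots m) ≡ 2 * m
      length-slots zero    = refl
      length-slots (suc m) = trans (cong (2 +_) (length-slots m)) (sym (*-suc 2 m))

      -- No base is better than another for a whole squared cycle, so an arbitrary one is taken and
      -- the cut costs `(1 + x) ^ 4`.
      overlap-full : ∀ {τ} → τ ∈ perms n → ∑ (perms n) (λ ω → (1ℚ ℚ.+ x) ^ℚ ∣ E τ ∩ E ω ∣) ℚ.≤ h ℚ.* ((1ℚ ℚ.+ x) ^ℚ 4 ℚ.* (1ℚ ℚ.+ η) ^ℚ (2 * m₀))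
      overlap-full {τ} τ∈ = begin
        ∑ (perms n) (λ ω → X ^ℚ ∣ E τ ∩ E ω ∣) ≤⟨ overlap-at τ∈ (λ {k} → ⊆-refl {x = E τ} {k}) Fin.zero ⟩
        X ^ℚ w ℚ.* (h ℚ.* (1ℚ ℚ.+ η) ^ℚ T) ≤⟨ *-monoʳ (0≤* (0≤ι (length (perms n))) (0≤^ T (ℚₚ.≤-trans 0≤1 1≤1+η))) (^-monoʳ 1≤1+x (wrapping≤4 τ∈ {E τ} Fin.zero)) ⟩
        X ^ℚ 4 ℚ.* (h ℚ.* (1ℚ ℚ.+ η) ^ℚ T) ≤⟨ *-monoˡ (0≤^ 4 (ℚₚ.≤-trans 0≤1 1≤1+x)) (*-monoˡ (0≤ι (length (perms n))) (^-monoʳ 1≤1+η T≤)) ⟩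
        X ^ℚ 4 ℚ.* (h ℚ.* (1ℚ ℚ.+ η) ^ℚ (2 * m₀)) ≡⟨ ring (X ^ℚ 4) h ((1ℚ ℚ.+ η) ^ℚ (2 * m₀)) ⟩
        h ℚ.* (X ^ℚ 4 ℚ.* (1ℚ ℚ.+ η) ^ℚ (2 * m₀)) ∎
        where
        open ℚₚ.≤-Reasoning
        X = 1ℚ ℚ.+ x
        w = wrapping τ∈ {E τ} Fin.zero
        T = ∑ℕ (slots m₀) (λ s → b2n (selected τ∈ {E τ} Fin.zero s))
        T≤ : T ≤ 2 * m₀
        T≤ = ≤-trans (∑ℕ-mono (slots m₀) {g = λ _ → 1} (λ {s} _ → b2n≤1 (selected τ∈ {E τ} Fin.zero s)))
          (≤-reflexive (trans (∑ℕ-const (slots m₀) 1) (trans (*-identityʳ _) (length-slots m₀))))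
        ring : ∀ a b c → a ℚ.* (b ℚ.* c) ≡ b ℚ.* (a ℚ.* c)
        ring = Tactic.RingSolver.solve-∀ ℚ-ring

      -- For the second moment the average must be close to 1, which even one factor `1 + x` would
      -- ruin; hence the base at which no edge of `F` is cut.
      overlap-small : ∀ {τ F} → τ ∈ perms n → F ⊆ E τ → 4 * ∣ F ∣ < n → ∑ (perms n) (λ ω → (1ℚ ℚ.+ x) ^ℚ ∣ F ∩ E ω ∣) ℚ.≤ h ℚ.* (1ℚ ℚ.+ η) ^ℚ ∣ F ∣
      overlap-small {τ} {F} τ∈ F⊆ few = begin
        ∑ (perms n) (λ ω → (1ℚ ℚ.+ x) ^ℚ ∣ F ∩ E ω ∣) ≤⟨ overlap-at τ∈ F⊆ r ⟩
        (1ℚ ℚ.+ x) ^ℚ wrapping τ∈ {F} r ℚ.* (h ℚ.* (1ℚ ℚ.+ η) ^ℚ T) ≡⟨ cong (λ w → (1ℚ ℚ.+ x) ^ℚ w ℚ.* (h ℚ.* (1ℚ ℚ.+ η) ^ℚ T)) (proj₂ base) ⟩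
        1ℚ ℚ.* (h ℚ.* (1ℚ ℚ.+ η) ^ℚ T) ≡⟨ ℚₚ.*-identityˡ _ ⟩
        h ℚ.* (1ℚ ℚ.+ η) ^ℚ T ≤⟨ *-monoˡ (0≤ι (length (perms n))) (^-monoʳ 1≤1+η (selected≤ τ∈ {F} r)) ⟩
        h ℚ.* (1ℚ ℚ.+ η) ^ℚ ∣ F ∣ ∎
        where
        open ℚₚ.≤-Reasoning
        base = uncut-base τ∈ F few
        r = proj₁ base
        T = ∑ℕ (slots m₀) (λ s → b2n (selected τ∈ {F} r s))

    contains : 1 ≤ m₀ → ∀ {ω} {G : Graph n} → ω ∈ perms n → E ω ⊆ G → ContainsSqHamCycle G
    contains 1≤m₀ {ω} {G} ω∈ E⊆G = permutation (vert ω) (pos ω) (proj₁ (∈-perms⁻ ω∈)) (proj₂ (∈-perms⁻ ω∈)) ,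
      -- `1 ≤ m₀` means at least three vertices, so a shift by two does not return to its starting
      -- point.
      λ i → adj i 1 (inj₁ refl) (s≤s (s≤s z≤n)) , adj i 2 (inj₂ refl) (s≤s (s≤s 1≤m₀))
      where
      adj : ∀ i d → d ≡ 1 ⊎ d ≡ 2 → d < n → Adj G (vert ω i) (vert ω (shift d i))
      adj i d d≡ d<n = let (k , j) = joins-exists distinct in
        k , Vecₚ.[]=⇒lookup (E⊆G (near⇒E ω k j (subst₂ (λ i j → near i j ≡ true) (sym (proj₂ (∈-perms⁻ ω∈) i)) (sym (proj₂ (∈-perms⁻ ω∈) (shift d i))) (shift⇒near {i} d d≡)))) , j
        where
        d≢0 : d ≡ 1 ⊎ d ≡ 2 → d ≢ 0
        d≢0 (inj₁ refl) ()
        d≢0 (inj₂ refl) ()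
        distinct : vert ω i ≢ vert ω (shift d i)
        distinct e = d≢0 d≡ (shift-injectiveˡ i d<n (s≤s z≤n) (sym (trans (shift-0 i) (vert-injective ω∈ e))))

-- Square roots, growth estimates and the choice of the constants.

module Numerics where

  open import Data.Nat as ℕ using (ℕ; zero; suc)
  import Data.Nat.Properties as ℕₚ
  import Data.Nat.Tactic.RingSolver as ℕSolver
  open import Data.Integer using (+_)
  import Data.Integer as ℤ
  import Data.Integer.Properties as ℤₚ
  open import Data.Unit using (tt)
  open import Data.Rational using (ℚ; mkℚ; 0ℚ; 1ℚ; ½; _+_; _*_; _-_; -_; _<_; 1/_; positive; toℚᵘ) renaming (_≤_ to _≤ℚ_)
  open import Data.Rational.Properties using (module ≤-Reasoning; ≤-refl; ≤-trans; ≤-reflexive; <⇒≤; ≰⇒>; ≮⇒≥; <-≤-trans; ≤-<-trans; <-irrefl; +-mono-≤; +-monoʳ-≤; +-monoˡ-≤; *-zeroˡ; *-identityˡ; *-identityʳ; +-identityʳ; *-comm; *-assoc; positive⁻¹; pos⇒nonZero; *-inverseʳ; 1/pos⇒pos; toℚᵘ-cancel-≤; toℚᵘ-fromℚᵘ; _≤?_)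
  import Data.Rational.Unnormalised as ℚᵘ
  import Data.Rational.Unnormalised.Properties as ℚᵘₚ
  open import Tactic.RingSolver using (solve-∀)
  open Expectation

  reciprocal : ∀ {a} → 0ℚ < a → ∃ λ b → 0ℚ < b × a * b ≡ 1ℚ
  reciprocal {a} 0<a = 1/ a , positive⁻¹ (1/ a) {{1/pos⇒pos a}} , *-inverseʳ a
    where instance
      pos-a = positive 0<a
      nonZero-a = pos⇒nonZero a {{pos-a}}

  archimedean : ∀ a → ∃ λ M → a ≤ℚ ι M
  archimedean a@(mkℚ z d c) = ℤ.∣ z ∣ , toℚᵘ-cancel-≤ (begin
    toℚᵘ a ≤⟨ ℚᵘ.*≤* (ℤₚ.≤-trans (ℤₚ.≤-reflexive (ℤₚ.*-identityʳ z)) (ℤₚ.≤-trans z≤∣z∣ grow)) ⟩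
    ℚᵘ.mkℚᵘ (+ ℤ.∣ z ∣) 0       ≃⟨ toℚᵘ-fromℚᵘ (ℚᵘ.mkℚᵘ (+ ℤ.∣ z ∣) 0) ⟨
    toℚᵘ (ℕtoℚ ℤ.∣ z ∣) ≡⟨ cong toℚᵘ (ι≡ℕtoℚ ℤ.∣ z ∣) ⟨
    toℚᵘ (ι ℤ.∣ z ∣) ∎)
    where
    open ℚᵘₚ.≤-Reasoning
    z≤∣z∣ : ∀ {z} → z ℤ.≤ + ℤ.∣ z ∣
    z≤∣z∣ {+ _}         = ℤₚ.≤-refl
    z≤∣z∣ {ℤ.-[1+ _ ]} = ℤ.-≤+
    grow : + ℤ.∣ z ∣ ℤ.≤ + ℤ.∣ z ∣ ℤ.* + suc d
    grow = subst (+ ℤ.∣ z ∣ ℤ.≤_) (ℤₚ.pos-* ℤ.∣ z ∣ (suc d)) (ℤ.+≤+ (ℕₚ.m≤m*n ℤ.∣ z ∣ (suc d)))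

  sqrt-exists : ∀ n → ∃ λ s → s ℕ.* s ℕ.≤ n × n ℕ.< suc s ℕ.* suc s
  sqrt-exists zero = 0 , ℕ.z≤n , ℕ.s≤s ℕ.z≤n
  sqrt-exists (suc n) with sqrt-exists n
  ... | s , s²≤n , n<t² with suc n ℕ.<? suc s ℕ.* suc s
  ...   | yes lt = s , ℕₚ.m≤n⇒m≤1+n s²≤n , lt
  ...   | no ¬lt = suc s , ℕₚ.≮⇒≥ ¬lt , ℕₚ.≤-<-trans n<t² (ℕₚ.*-mono-< (ℕₚ.n<1+n (suc s)) (ℕₚ.n<1+n (suc s)))

  -- Stands in for √n: `t` is one more than the integer part of the root, hence between √n and 2√n.
  ceil-sqrt : ∀ n → 1 ℕ.≤ n → ∃ λ t → n ℕ.≤ t ℕ.* t × t ℕ.* t ℕ.≤ 4 ℕ.* n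
  ceil-sqrt n 1≤n with sqrt-exists n
  ... | zero  , _    , n<1  = contradiction (ℕₚ.≤-trans n<1 1≤n) (ℕₚ.<-irrefl refl)
  ... | suc s , s²≤n , n<t² = 2 ℕ.+ s , ℕₚ.<⇒≤ n<t² , ℕₚ.≤-trans
    (ℕₚ.*-mono-≤ {2 ℕ.+ s} {2 ℕ.* suc s} double double) (ℕₚ.≤-trans (ℕₚ.≤-reflexive (ring (suc s))) (ℕₚ.*-monoʳ-≤ 4 s²≤n))
    where
    double : 2 ℕ.+ s ℕ.≤ 2 ℕ.* suc s
    double = subst (2 ℕ.+ s ℕ.≤_) (sym (ℕₚ.*-suc 2 s)) (ℕₚ.+-monoʳ-≤ 2 (ℕₚ.m≤m+n s _))
    ring : ∀ a → 2 ℕ.* a ℕ.* (2 ℕ.* a) ≡ 4 ℕ.* (a ℕ.* a)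
    ring = ℕSolver.solve-∀

  n≤2^n : ∀ n → n ℕ.≤ 2 ℕ.^ n
  n≤2^n zero    = ℕ.z≤n
  n≤2^n (suc n) = ℕₚ.≤-trans (ℕₚ.+-mono-≤ (ℕₚ.m^n>0 2 n) (n≤2^n n)) (ℕₚ.≤-reflexive (cong (2 ℕ.^ n ℕ.+_) (sym (ℕₚ.+-identityʳ (2 ℕ.^ n)))))

  -- A converse to Bernoulli's inequality: as long as the total increment stays at most 1, doubling
  -- `η` absorbs the products of increments.
  ^≤1+ : ∀ {η} j → 0ℚ ≤ℚ η → ι j * (η + η) ≤ℚ 1ℚ → (1ℚ + η) ^ j ≤ℚ 1ℚ + ι j * (η + η)
  ^≤1+ {η} zero    0≤η small = ≤-reflexive (trans (ring η) (cong (λ z → 1ℚ + z * (η + η)) (sym ι-0)))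
    where
    ring : ∀ η → 1ℚ ≡ 1ℚ + 0ℚ * (η + η)
    ring = solve-∀ ℚ-ring
  ^≤1+ {η} (suc j) 0≤η small = begin
    (1ℚ + η) * (1ℚ + η) ^ j ≤⟨ *-monoˡ (0≤+ 0≤1 0≤η) (^≤1+ j 0≤η small′) ⟩
    (1ℚ + η) * (1ℚ + ι j * (η + η)) ≤⟨ 0≤-⇒≤ (subst (0ℚ ≤ℚ_) (ring η (ι j)) (0≤* 0≤η (0≤- small′))) ⟩
    1ℚ + (1ℚ + ι j) * (η + η) ≡⟨ cong (λ z → 1ℚ + z * (η + η)) (ι-suc j) ⟨
    1ℚ + ι (suc j) * (η + η) ∎
    where
    open ≤-Reasoning
    small′ : ι j * (η + η) ≤ℚ 1ℚ
    small′ = ≤-trans (*-monoʳ (0≤+ 0≤η 0≤η) (ι-mono (ℕₚ.n≤1+n j))) small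
    ring : ∀ η j → η * (1ℚ - j * (η + η)) ≡ 1ℚ + (1ℚ + j) * (η + η) - (1ℚ + η) * (1ℚ + j * (η + η))
    ring = solve-∀ ℚ-ring

  ι-2 : ι 2 ≡ 1ℚ + 1ℚ
  ι-2 = trans (ι-+ 1 1) (cong₂ _+_ ι-1 ι-1)

  ι-4 : ι 4 ≡ 1ℚ + 1ℚ + (1ℚ + 1ℚ)
  ι-4 = trans (ι-+ 2 2) (cong₂ _+_ ι-2 ι-2)

  ι-8 : ι 8 ≡ 1ℚ + 1ℚ + (1ℚ + 1ℚ) + (1ℚ + 1ℚ + (1ℚ + 1ℚ))
  ι-8 = trans (ι-+ 4 4) (cong₂ _+_ ι-4 ι-4)

  -- With `x = 128 / p`, the choice `e * K = 128 * 2560` gives `2560 * x ≤ e * √n`. Here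
  -- `2560 = 8 * 320` is made for `8 * x * t * y ≤ e`, where `t ≤ 2 * √n` and `y = 160 / n`
  -- contribute `2 * 160 = 320`.
  module Parameters {e K p : ℚ} {n t : ℕ} (0<e : 0ℚ < e) (0<K : 0ℚ < K) (e≤¼ : e + e + (e + e) ≤ℚ 1ℚ)
    (eK≡ : e * K ≡ ι 128 * ι 2560) (0≤p : 0ℚ ≤ℚ p) (p≤1 : p ≤ℚ 1ℚ) (K²≤ : K * K ≤ℚ p * p * ι n)
    (1≤n : 1 ℕ.≤ n) (n≤t² : n ℕ.≤ t ℕ.* t) (t²≤4n : t ℕ.* t ℕ.≤ 4 ℕ.* n) where

    0<n : 0ℚ < ι n
    0<n = 0<ι n 1≤n

    0≤e : 0ℚ ≤ℚ e
    0≤e = <⇒≤ 0<e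

    e≤1 : e ≤ℚ 1ℚ
    e≤1 = ≤-trans (≤-trans (x≤x+ 0≤e) (x≤x+ (0≤+ 0≤e 0≤e))) e≤¼

    -- For `p = 0` the density hypothesis would force `K` to be 0.
    0<p : 0ℚ < p
    0<p with p ≤? 0ℚ
    ... | no p≰0  = ≰⇒> p≰0
    ... | yes p≤0 = contradiction (<-≤-trans 0<K K≤0) (<-irrefl refl)
      where
      p*p*n≤0 : p * p * ι n ≤ℚ 0ℚ
      p*p*n≤0 = subst (p * p * ι n ≤ℚ_) (trans (cong (_* ι n) (*-zeroˡ p)) (*-zeroˡ (ι n))) (*-monoʳ (<⇒≤ 0<n) (*-monoʳ 0≤p p≤0))
      K≤0 : K ≤ℚ 0ℚ
      K≤0 = sq-cancel-≤ ≤-refl (≤-trans K²≤ p*p*n≤0)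

    q : ℚ
    q = ½ * p

    q+q≡p : q + q ≡ p
    q+q≡p = trans (ring ½ p) (*-identityˡ p)
      where
      ring : ∀ a p → a * p + a * p ≡ (a + a) * p
      ring = solve-∀ ℚ-ring

    0<q : 0ℚ < q
    0<q = 0<* (positive⁻¹ ½) 0<p

    0≤q : 0ℚ ≤ℚ q
    0≤q = <⇒≤ 0<q

    q≤p : q ≤ℚ p
    q≤p = subst (q ≤ℚ_) q+q≡p (x≤x+ 0≤q)

    q≤1 : q ≤ℚ 1ℚ
    q≤1 = ≤-trans q≤p p≤1

    q≤1-q : q ≤ℚ 1ℚ - q
    q≤1-q = 0≤-⇒≤ (subst (0ℚ ≤ℚ_) (trans (cong (_-_ 1ℚ) (sym q+q≡p)) (ring q)) (0≤- p≤1))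
      where
      ring : ∀ q → 1ℚ - (q + q) ≡ 1ℚ - q - q
      ring = solve-∀ ℚ-ring

    0<1-q : 0ℚ < 1ℚ - q
    0<1-q = <-≤-trans 0<q q≤1-q

    X : ℚ
    X = proj₁ (reciprocal 0<q)

    0<X : 0ℚ < X
    0<X = proj₁ (proj₂ (reciprocal 0<q))

    0≤X : 0ℚ ≤ℚ X
    0≤X = <⇒≤ 0<X

    qX≡1 : q * X ≡ 1ℚ
    qX≡1 = proj₂ (proj₂ (reciprocal 0<q))

    j : ℚ
    j = proj₁ (reciprocal 0<1-q)

    [1-q]j≡1 : (1ℚ - q) * j ≡ 1ℚ
    [1-q]j≡1 = proj₂ (proj₂ (reciprocal 0<1-q))

    -- `q′ = q / (1 - q)` gives the union of the two rounds density exactly `p` within the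
    -- rationals; equal densities would involve the square root of `1 - p`. `Q` is the inverse of
    -- `q′`.
    q′ Q : ℚ
    q′ = q * j
    Q  = X * (1ℚ - q)

    0≤j : 0ℚ ≤ℚ j
    0≤j = <⇒≤ (proj₁ (proj₂ (reciprocal 0<1-q)))

    0≤q′ : 0ℚ ≤ℚ q′
    0≤q′ = 0≤* 0≤q 0≤j

    q′≤1 : q′ ≤ℚ 1ℚ
    q′≤1 = subst (q′ ≤ℚ_) [1-q]j≡1 (*-monoʳ 0≤j q≤1-q)

    split : p ≡ q + (1ℚ - q) * q′
    split = trans (sym q+q≡p) (cong (_+_ q) (sym (trans (ring (1ℚ - q) q j) (trans (cong (_* q) [1-q]j≡1) (*-identityˡ q)))))
      where
      ring : ∀ a b c → a * (b * c) ≡ a * c * b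
      ring = solve-∀ ℚ-ring

    q′Q≡1 : q′ * Q ≡ 1ℚ
    q′Q≡1 = trans (ring q j X (1ℚ - q)) (trans (cong₂ _*_ qX≡1 [1-q]j≡1) refl)
      where
      ring : ∀ q j X r → q * j * (X * r) ≡ q * X * (r * j)
      ring = solve-∀ ℚ-ring

    0≤Q : 0ℚ ≤ℚ Q
    0≤Q = 0≤* 0≤X (<⇒≤ 0<1-q)

    -- The overlap average of a full squared cycle is at most `32 ^ t`, so `L = 64` leaves a gain of
    -- `2 ^ t`.
    L x : ℚ
    L = ι 64
    x = X * L

    1≤L : 1ℚ ≤ℚ L
    1≤L = subst (_≤ℚ L) ι-1 (ι-mono (ℕ.s≤s ℕ.z≤n))

    X≤x : X ≤ℚ x
    X≤x = subst (_≤ℚ x) (*-identityʳ X) (*-monoˡ 0≤X 1≤L)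

    0≤x : 0ℚ ≤ℚ x
    0≤x = ≤-trans 0≤X X≤x

    Q≤1+x : Q ≤ℚ 1ℚ + x
    Q≤1+x = ≤-trans (≤-trans (subst (Q ≤ℚ_) (*-identityʳ X) (*-monoˡ 0≤X (-≤ 0≤q))) X≤x) (x≤+x 0≤1)

    1≤x : 1ℚ ≤ℚ x
    1≤x = ≤-trans (subst₂ _≤ℚ_ qX≡1 (*-identityˡ X) (*-monoʳ 0≤X q≤1)) X≤x

    px≡128 : p * x ≡ ι 128
    px≡128 = trans (cong (_* x) (sym q+q≡p)) (trans (ring q X L) (trans (cong (λ z → z * L + z * L) qX≡1) (trans (cong₂ _+_ (*-identityˡ L) (*-identityˡ L)) (sym (ι-+ 64 64)))))
      where
      ring : ∀ q X L → (q + q) * (X * L) ≡ q * X * L + q * X * L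
      ring = solve-∀ ℚ-ring

    [Bx]²≤ : ι 2560 * x * (ι 2560 * x) ≤ℚ ι n * (e * e)
    [Bx]²≤ = *-cancelˡ (0<* 0<c 0<c) (begin
      c * c * (B * x * (B * x)) ≡⟨ ring₁ c B x ⟩
      c * B * (c * B) * (x * x) ≡⟨ cong (λ z → z * z * (x * x)) eK≡ ⟨
      e * K * (e * K) * (x * x) ≡⟨ ring₂ e K x ⟩
      K * K * (e * e * (x * x)) ≤⟨ *-monoʳ (0≤* (0≤sq e) (0≤sq x)) K²≤ ⟩
      p * p * ι n * (e * e * (x * x)) ≡⟨ ring₃ p (ι n) e x ⟩
      p * x * (p * x) * (ι n * (e * e)) ≡⟨ cong (λ z → z * z * (ι n * (e * e))) px≡128 ⟩
      c * c * (ι n * (e * e)) ∎)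
      where
      open ≤-Reasoning
      c B : ℚ
      c = ι 128
      B = ι 2560
      0<c : 0ℚ < c
      0<c = 0<ι 128 (ℕ.s≤s ℕ.z≤n)
      ring₁ : ∀ c B x → c * c * (B * x * (B * x)) ≡ c * B * (c * B) * (x * x)
      ring₁ = solve-∀ ℚ-ring
      ring₂ : ∀ e K x → e * K * (e * K) * (x * x) ≡ K * K * (e * e * (x * x))
      ring₂ = solve-∀ ℚ-ring
      ring₃ : ∀ p n e x → p * p * n * (e * e * (x * x)) ≡ p * x * (p * x) * (n * (e * e))
      ring₃ = solve-∀ ℚ-ring

    -- `160 = 8 * 20`: 20 is the row bound of `κ`, and 8 is the loss per link in comparing `n ^ r`
    -- with `rising`.
    y : ℚ
    y = ι 160 * proj₁ (reciprocal 0<n)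

    0≤y : 0ℚ ≤ℚ y
    0≤y = 0≤* (0≤ι 160) (<⇒≤ (proj₁ (proj₂ (reciprocal 0<n))))

    yn≡160 : y * ι n ≡ ι 160
    yn≡160 = trans (ring (ι 160) (proj₁ (reciprocal 0<n)) (ι n)) (trans (cong (ι 160 *_) (proj₂ (proj₂ (reciprocal 0<n)))) (*-identityʳ (ι 160)))
      where
      ring : ∀ a b c → a * b * c ≡ a * (c * b)
      ring = solve-∀ ℚ-ring

    -- A weak form of `2560 * x ≤ e * √n`, for the places where only the order of `x` matters.
    const-x²≤n : ∀ {c} → c ℕ.≤ 2560 ℕ.* 2560 → ι c * (x * x) ≤ℚ ι n
    const-x²≤n {c} c≤ = begin
      ι c * (x * x) ≤⟨ *-monoʳ (0≤sq x) (ι-mono c≤) ⟩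
      ι (2560 ℕ.* 2560) * (x * x) ≡⟨ cong (_* (x * x)) (ι-* 2560 2560) ⟩
      ι 2560 * ι 2560 * (x * x) ≡⟨ ring (ι 2560) x ⟩
      ι 2560 * x * (ι 2560 * x) ≤⟨ [Bx]²≤ ⟩
      ι n * (e * e) ≤⟨ *-monoˡ (<⇒≤ 0<n) (*-mono 0≤1 0≤e e≤1 e≤1) ⟩
      ι n * (1ℚ * 1ℚ) ≡⟨ *-identityʳ (ι n) ⟩
      ι n ∎
      where
      open ≤-Reasoning
      ring : ∀ B x → B * B * (x * x) ≡ B * x * (B * x)
      ring = solve-∀ ℚ-ring

    2x²y≤1 : x * x * y + x * x * y ≤ℚ 1ℚ
    2x²y≤1 = *-cancelˡ 0<n (begin
      ι n * (x * x * y + x * x * y) ≡⟨ ring (ι n) x y ⟩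
      (y * ι n + y * ι n) * (x * x) ≡⟨ cong (λ z → (z + z) * (x * x)) yn≡160 ⟩
      (ι 160 + ι 160) * (x * x) ≡⟨ cong (_* (x * x)) (ι-+ 160 160) ⟨
      ι 320 * (x * x) ≤⟨ const-x²≤n (ℕₚ.≤ᵇ⇒≤ 320 (2560 ℕ.* 2560) tt) ⟩
      ι n ≡⟨ *-identityʳ (ι n) ⟨
      ι n * 1ℚ ∎)
      where
      open ≤-Reasoning
      ring : ∀ n x y → n * (x * x * y + x * x * y) ≡ (y * n + y * n) * (x * x)
      ring = solve-∀ ℚ-ring

    1+x≤t : 1ℚ + x ≤ℚ ι t
    1+x≤t = sq-cancel-≤ (0≤ι t) (begin
      (1ℚ + x) * (1ℚ + x) ≤⟨ *-mono (0≤+ 0≤x 0≤x) (0≤+ 0≤1 0≤x) (+-monoˡ-≤ x 1≤x) (+-monoˡ-≤ x 1≤x) ⟩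
      (x + x) * (x + x) ≡⟨ ring x ⟩
      (1ℚ + 1ℚ + (1ℚ + 1ℚ)) * (x * x) ≡⟨ cong (_* (x * x)) ι-4 ⟨
      ι 4 * (x * x) ≤⟨ const-x²≤n {4} (ℕₚ.≤ᵇ⇒≤ 4 (2560 ℕ.* 2560) tt) ⟩
      ι n ≤⟨ ι-mono n≤t² ⟩
      ι (t ℕ.* t) ≡⟨ ι-* t t ⟩
      ι t * ι t ∎)
      where
      open ≤-Reasoning
      ring : ∀ x → (x + x) * (x + x) ≡ (1ℚ + 1ℚ + (1ℚ + 1ℚ)) * (x * x)
      ring = solve-∀ ℚ-ring

    Bxt≤ : ι 2560 * x * ι t ≤ℚ (e + e) * ι n
    Bxt≤ = sq-cancel-≤ (0≤* (0≤+ 0≤e 0≤e) (<⇒≤ 0<n)) (begin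
      ι 2560 * x * ι t * (ι 2560 * x * ι t) ≡⟨ ring₁ (ι 2560 * x) (ι t) ⟩
      ι 2560 * x * (ι 2560 * x) * (ι t * ι t) ≤⟨ *-mono (0≤* (<⇒≤ 0<n) (0≤sq e)) (0≤sq (ι t)) [Bx]²≤ (subst₂ _≤ℚ_ (ι-* t t) (ι-* 4 n) (ι-mono t²≤4n)) ⟩
      ι n * (e * e) * (ι 4 * ι n) ≡⟨ cong (λ z → ι n * (e * e) * (z * ι n)) ι-4 ⟩
      ι n * (e * e) * ((1ℚ + 1ℚ + (1ℚ + 1ℚ)) * ι n) ≡⟨ ring₂ (ι n) e ⟩
      (e + e) * ι n * ((e + e) * ι n) ∎)
      where
      open ≤-Reasoning
      ring₁ : ∀ a t → a * t * (a * t) ≡ a * a * (t * t)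
      ring₁ = solve-∀ ℚ-ring
      ring₂ : ∀ n e → n * (e * e) * ((1ℚ + 1ℚ + (1ℚ + 1ℚ)) * n) ≡ (e + e) * n * ((e + e) * n)
      ring₂ = solve-∀ ℚ-ring

    8xty≤e : ι 8 * (x * ι t * y) ≤ℚ e
    8xty≤e = *-cancelˡ (0<ι 320 (ℕ.s≤s ℕ.z≤n)) (begin
      ι 320 * (ι 8 * (x * ι t * y)) ≡⟨ *-assoc (ι 320) (ι 8) (x * ι t * y) ⟨
      ι 320 * ι 8 * (x * ι t * y) ≡⟨ cong (_* (x * ι t * y)) (ι-* 320 8) ⟨
      ι 2560 * (x * ι t * y) ≡⟨ ring₁ (ι 2560) x (ι t) y ⟩
      ι 2560 * x * ι t * y ≤⟨ *-monoʳ 0≤y Bxt≤ ⟩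
      (e + e) * ι n * y ≡⟨ ring₂ e (ι n) y ⟩
      (y * ι n + y * ι n) * e ≡⟨ cong (λ z → (z + z) * e) yn≡160 ⟩
      (ι 160 + ι 160) * e ≡⟨ cong (_* e) (ι-+ 160 160) ⟨
      ι 320 * e ∎)
      where
      open ≤-Reasoning
      ring₁ : ∀ B x t y → B * (x * t * y) ≡ B * x * t * y
      ring₁ = solve-∀ ℚ-ring
      ring₂ : ∀ e n y → (e + e) * n * y ≡ (y * n + y * n) * e
      ring₂ = solve-∀ ℚ-ring

    η : ℚ
    η = y + x * y + x * y + x * y

    0≤η : 0ℚ ≤ℚ η
    0≤η = 0≤+ (0≤+ (0≤+ 0≤y 0≤xy) 0≤xy) 0≤xy
      where
      0≤xy : 0ℚ ≤ℚ x * y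
      0≤xy = 0≤* 0≤x 0≤y

    1≤1+η : 1ℚ ≤ℚ 1ℚ + η
    1≤1+η = x≤x+ 0≤η

    -- As `1 ≤ x`, the doubled cost `2 * y + 6 * x * y` is at most `8 * x * y`, the origin of the 8.
    t2η≤e : ι t * (η + η) ≤ℚ e
    t2η≤e = ≤-trans (0≤-⇒≤ (subst (0ℚ ≤ℚ_) (trans (ring (ι t) x y) (cong (λ z → z * (x * ι t * y) - ι t * (η + η)) (sym ι-8)))
        (0≤+ (0≤* 0≤ty (0≤- 1≤x)) (0≤* 0≤ty (0≤- 1≤x))))) 8xty≤e
      where
      0≤ty : 0ℚ ≤ℚ ι t * y
      0≤ty = 0≤* (0≤ι t) 0≤y
      ring : ∀ t x y → t * y * (x - 1ℚ) + t * y * (x - 1ℚ) ≡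
        (1ℚ + 1ℚ + (1ℚ + 1ℚ) + (1ℚ + 1ℚ + (1ℚ + 1ℚ))) * (x * t * y) - t * (y + x * y + x * y + x * y + (y + x * y + x * y + x * y))
      ring = solve-∀ ℚ-ring

    [1+η]^t≤1+e : (1ℚ + η) ^ t ≤ℚ 1ℚ + e
    [1+η]^t≤1+e = ≤-trans (^≤1+ t 0≤η (≤-trans t2η≤e e≤1)) (+-monoʳ-≤ 1ℚ t2η≤e)

    [1+e]²≤2 : (1ℚ + e) ^ 2 ≤ℚ ι 2
    [1+e]²≤2 = 0≤-⇒≤ (subst (0ℚ ≤ℚ_) (trans (ring e) (cong (λ z → z - (1ℚ + e) ^ 2) (sym ι-2))) (0≤+ (0≤+ (0≤- e≤¼) (0≤* 0≤e (0≤- e≤1))) 0≤e))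
      where
      ring : ∀ e → 1ℚ - (e + e + (e + e)) + e * (1ℚ - e) + e ≡ 1ℚ + 1ℚ - (1ℚ + e) * ((1ℚ + e) * 1ℚ)
      ring = solve-∀ ℚ-ring

    -- The factor from the cut is at most `16 ^ t` because `1 + x ≤ t ≤ 2 ^ t`. The exponent `2 * m`
    -- fits into `2 * t` blocks of length `t`, each worth at most `1 + e`, and `(1 + e) ^ 2 ≤ 2`
    -- turns these into `2 ^ t`.
    M-bound : ∀ {m} → m ℕ.≤ n → (1ℚ + x) ^ 4 * (1ℚ + η) ^ (2 ℕ.* m) ≤ℚ ι 32 ^ t
    M-bound {m} m≤n = begin
      (1ℚ + x) ^ 4 * (1ℚ + η) ^ (2 ℕ.* m) ≤⟨ *-mono (0≤^ 4 (0≤ι (2 ℕ.^ t))) (0≤^ (2 ℕ.* m) (0≤+ 0≤1 0≤η)) (^-monoˡ 4 (0≤+ 0≤1 0≤x) (≤-trans 1+x≤t (ι-mono (n≤2^n t)))) second ⟩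
      ι (2 ℕ.^ t) ^ 4 * ι 2 ^ t ≡⟨ cong (_* ι 2 ^ t) fourth ⟩
      ι 16 ^ t * ι 2 ^ t ≡⟨ *-^ (ι 16) (ι 2) t ⟨
      (ι 16 * ι 2) ^ t ≡⟨ cong (_^ t) (ι-* 16 2) ⟨
      ι 32 ^ t ∎
      where
      open ≤-Reasoning
      second : (1ℚ + η) ^ (2 ℕ.* m) ≤ℚ ι 2 ^ t
      second = begin
        (1ℚ + η) ^ (2 ℕ.* m) ≤⟨ ^-monoʳ 1≤1+η (ℕₚ.*-monoʳ-≤ 2 (ℕₚ.≤-trans m≤n n≤t²)) ⟩
        (1ℚ + η) ^ (2 ℕ.* (t ℕ.* t)) ≡⟨ cong ((1ℚ + η) ^_) (arrange t) ⟩
        (1ℚ + η) ^ (t ℕ.* 2 ℕ.* t) ≡⟨ ^-* (1ℚ + η) (t ℕ.* 2) t ⟩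
        ((1ℚ + η) ^ t) ^ (t ℕ.* 2) ≤⟨ ^-monoˡ (t ℕ.* 2) (0≤^ t (0≤+ 0≤1 0≤η)) [1+η]^t≤1+e ⟩
        (1ℚ + e) ^ (t ℕ.* 2) ≡⟨ ^-* (1ℚ + e) t 2 ⟩
        ((1ℚ + e) ^ 2) ^ t ≤⟨ ^-monoˡ t (0≤^ 2 (0≤+ 0≤1 0≤e)) [1+e]²≤2 ⟩
        ι 2 ^ t ∎
        where
        arrange : ∀ t → 2 ℕ.* (t ℕ.* t) ≡ t ℕ.* 2 ℕ.* t
        arrange = ℕSolver.solve-∀
      fourth : ι (2 ℕ.^ t) ^ 4 ≡ ι 16 ^ t
      fourth = trans (cong (_^ 4) (ι-^ 2 t)) (trans (sym (^-* (ι 2) 4 t)) (trans (cong (ι 2 ^_) (ℕₚ.*-comm 4 t)) (trans (^-* (ι 2) t 4) (cong (_^ t) (sym (ι-^ 2 4))))))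

-- Assembly of the two rounds.

module Assembly where

  open import Data.Nat as ℕ using (ℕ; suc; _≤_)
  import Data.Nat.Properties as ℕₚ
  import Data.Nat.Tactic.RingSolver as ℕSolver
  open import Data.Fin.Subset using (Subset; _∩_; ∣_∣; _⊆_)
  open import Data.List.Membership.Propositional using (_∈_)
  open import Data.Unit using (tt)
  open import Data.Rational using (ℚ; 0ℚ; 1ℚ; ½; _+_; _*_; _-_; -_; _<_) renaming (_≤_ to _≤ℚ_)
  open import Data.Rational.Properties using (module ≤-Reasoning; ≤-refl; ≤-trans; ≤-reflexive; <⇒≤; +-mono-≤; +-monoˡ-≤; *-identityˡ; *-assoc; *-comm; positive⁻¹; ≤-total)
  open import Tactic.RingSolver using (solve-∀)
  open import Relation.Unary using (Decidable)
  open Expectation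
  open RandomSubsets
  open FragmentMethod
  open Permutations using (perms; idPerm∈)
  open CyclicSquare using (module Cyclic)
  open SlotCounting
  open OverlapBound
  open Numerics

  halves : ∀ ε → ½ * ε + ½ * ε ≡ ε
  halves ε = trans (ring ½ ε) (*-identityˡ ε)
    where
    ring : ∀ a ε → a * ε + a * ε ≡ (a + a) * ε
    ring = solve-∀ ℚ-ring

  -- The minimum of `ε / 2` and `1 / 4`: the failure probability splits as `e + e`, one part for the
  -- bad fragments and one for the variance.
  small-part : ∀ {ε} → 0ℚ < ε → ∃ λ e → 0ℚ < e × e + e ≤ℚ ε × e + e + (e + e) ≤ℚ 1ℚ
  small-part {ε} 0<ε with ≤-total (½ * ε) (½ * ½)
  ... | inj₁ ½ε≤¼ = ½ * ε , 0<* (positive⁻¹ ½) 0<ε , ≤-reflexive (halves ε) , +-mono-≤ (+-mono-≤ ½ε≤¼ ½ε≤¼) (+-mono-≤ ½ε≤¼ ½ε≤¼)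
  ... | inj₂ ¼≤½ε = ½ * ½ , positive⁻¹ (½ * ½) , ≤-trans (+-mono-≤ ¼≤½ε ¼≤½ε) (≤-reflexive (halves ε)) , ≤-refl

  sq-cancel-ℕ : ∀ {m t} → m ℕ.* m ≤ t ℕ.* t → m ≤ t
  sq-cancel-ℕ {m} {t} m²≤t² with m ℕ.≤? t
  ... | yes m≤t = m≤t
  ... | no  m≰t = contradiction m²≤t² (ℕₚ.<⇒≱ (ℕₚ.*-mono-< (ℕₚ.≰⇒> m≰t) (ℕₚ.≰⇒> m≰t)))

  -- The square of `4 * t` is at most `64 * n`, which is below `n * n`. This is the room required
  -- for an uncut base of a fragment with `t` edges.
  4t<n : ∀ {n t} → 200 ≤ n → t ℕ.* t ≤ 4 ℕ.* n → 4 ℕ.* t ℕ.< n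
  4t<n {n} {t} 200≤n t²≤4n with 4 ℕ.* t ℕ.<? n
  ... | yes lt = lt
  ... | no ¬lt = contradiction (begin
      suc (64 ℕ.* n) ≤⟨ ℕₚ.+-monoˡ-≤ (64 ℕ.* n) (ℕₚ.≤-trans (ℕₚ.≤ᵇ⇒≤ 1 200 tt) 200≤n) ⟩
      65 ℕ.* n ≤⟨ ℕₚ.*-monoˡ-≤ n (ℕₚ.≤-trans (ℕₚ.≤ᵇ⇒≤ 65 200 tt) 200≤n) ⟩
      n ℕ.* n ≤⟨ ℕₚ.*-mono-≤ n≤4t n≤4t ⟩
      4 ℕ.* t ℕ.* (4 ℕ.* t) ≡⟨ ring t ⟩
      16 ℕ.* (t ℕ.* t) ≤⟨ ℕₚ.*-monoʳ-≤ 16 t²≤4n ⟩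
      16 ℕ.* (4 ℕ.* n) ≡⟨ ℕₚ.*-assoc 16 4 n ⟨
      64 ℕ.* n ∎) (ℕₚ.<-irrefl refl)
    where
    open ℕₚ.≤-Reasoning
    n≤4t : n ≤ 4 ℕ.* t
    n≤4t = ℕₚ.≮⇒≥ ¬lt
    ring : ∀ t → 4 ℕ.* t ℕ.* (4 ℕ.* t) ≡ 16 ℕ.* (t ℕ.* t)
    ring = ℕSolver.solve-∀

  module Final (m₀ : ℕ) {e K p : ℚ} {t : ℕ} (0<e : 0ℚ < e) (0<K : 0ℚ < K) (e≤¼ : e + e + (e + e) ≤ℚ 1ℚ)
    (eK≡ : e * K ≡ ι 128 * ι 2560) (0≤p : 0ℚ ≤ℚ p) (p≤1 : p ≤ℚ 1ℚ) (K²≤ : K * K ≤ℚ p * p * ι (2 ℕ.+ m₀))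
    (200≤n : 200 ≤ 2 ℕ.+ m₀) (n≤t² : 2 ℕ.+ m₀ ≤ t ℕ.* t) (t²≤4n : t ℕ.* t ≤ 4 ℕ.* (2 ℕ.+ m₀)) (1≤te : 1ℚ ≤ℚ ι t * e)
    (dec : Decidable (ContainsSqHamCycle {2 ℕ.+ m₀})) where

    open Overlap m₀
    open Bounds m₀
    open Parameters {t = t} 0<e 0<K e≤¼ eK≡ 0≤p p≤1 K²≤ (ℕₚ.≤-trans (ℕₚ.≤ᵇ⇒≤ 1 200 tt) 200≤n) n≤t² t²≤4n

    private
      n : ℕ
      n = 2 ℕ.+ m₀

    open Fragments (perms n) (idPerm∈ n) E

    fail : Subset N → ℚ
    fail G = 1ℚ - 𝟙 (does (dec G))

    fail≤1 : ∀ G → fail G ≤ℚ 1ℚ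
    fail≤1 G = -≤ (0≤𝟙 (does (dec G)))

    fail≡0 : ∀ {G ω} → ω ∈ perms n → E ω ⊆ G → fail G ≡ 0ℚ
    fail≡0 {G} ω∈ E⊆G = cong (λ b → 1ℚ - 𝟙 b) (dec-true (dec G) (contains (ℕₚ.≤-pred (ℕₚ.≤-pred (ℕₚ.≤-trans (ℕₚ.≤ᵇ⇒≤ 3 200 tt) 200≤n))) ω∈ E⊆G))

    -- Dividing by `32 ^ t` leaves `2 ^ t * b ≤ h`, and `2 ^ t ≥ t ≥ 1 / e`: of the exponential
    -- gain, only enough to reach `e` is kept.
    M-small : ∀ {b} → 0ℚ ≤ℚ b → L ^ t * b ≤ℚ h * ((1ℚ + x) ^ 4 * (1ℚ + η) ^ (2 ℕ.* m₀)) → b ≤ℚ h * e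
    M-small {b} 0≤b bound = begin
      b ≡⟨ *-identityˡ b ⟨
      1ℚ * b ≤⟨ *-monoʳ 0≤b 1≤te ⟩
      ι t * e * b ≡⟨ ring (ι t) e b ⟩
      ι t * b * e ≤⟨ *-monoʳ 0≤e (≤-trans (*-monoʳ 0≤b (subst (ι t ≤ℚ_) (ι-^ 2 t) (ι-mono (n≤2^n t)))) halved) ⟩
      h * e ∎
      where
      open ≤-Reasoning
      ring : ∀ t e b → t * e * b ≡ t * b * e
      ring = solve-∀ ℚ-ring
      halved : ι 2 ^ t * b ≤ℚ h
      halved = *-cancelˡ (0<^ t (0<ι 32 (ℕ.s≤s ℕ.z≤n))) (begin
        ι 32 ^ t * (ι 2 ^ t * b) ≡⟨ *-assoc (ι 32 ^ t) (ι 2 ^ t) b ⟨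
        ι 32 ^ t * ι 2 ^ t * b ≡⟨ cong (_* b) (*-^ (ι 32) (ι 2) t) ⟨
        (ι 32 * ι 2) ^ t * b ≡⟨ cong (λ z → z ^ t * b) (ι-* 32 2) ⟨
        L ^ t * b ≤⟨ bound ⟩
        h * ((1ℚ + x) ^ 4 * (1ℚ + η) ^ (2 ℕ.* m₀)) ≤⟨ *-monoˡ (<⇒≤ 0<h) (M-bound (ℕₚ.m≤n+m m₀ 2)) ⟩
        h * ι 32 ^ t ≡⟨ *-comm h (ι 32 ^ t) ⟩
        ι 32 ^ t * h ∎)

    small-overlap : ∀ {τ F} → τ ∈ perms n → F ⊆ E τ → ∣ F ∣ ≤ t → ∑ (perms n) (λ ω → (1ℚ + x) ^ ∣ F ∩ E ω ∣) ≤ℚ h * (1ℚ + e)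
    small-overlap τ∈ F⊆ ∣F∣≤t = ≤-trans
      (overlap-small 0≤x 0≤y 0<n yn≡160 2x²y≤1 τ∈ F⊆ (ℕₚ.≤-<-trans (ℕₚ.*-monoʳ-≤ 4 ∣F∣≤t) (4t<n {t = t} 200≤n t²≤4n)))
      (*-monoˡ (<⇒≤ 0<h) (≤-trans (^-monoʳ 1≤1+η ∣F∣≤t) [1+η]^t≤1+e))

    fail-bound : 𝔼 p fail ≤ℚ e + e
    fail-bound = TwoRounds.two-rounds t split 0≤q q≤1 (≤-reflexive (sym qX≡1)) 0≤X 1≤L 0≤q′ q′≤1 q′Q≡1 0≤Q Q≤1+x 0≤e
      (overlap-full 0≤x 0≤y 0<n yn≡160 2x²y≤1) small-overlap M-small fail fail≤1 fail≡0

    prob-bound : 1ℚ - (e + e) ≤ℚ Prob n p (ContainsSqHamCycle {n}) dec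
    prob-bound = subst (1ℚ - (e + e) ≤ℚ_) (sym (Prob≡𝔼 n p (ContainsSqHamCycle {n}) dec))
      (0≤-⇒≤ (subst (0ℚ ≤ℚ_) (ring (e + e) S) (0≤- (subst (_≤ℚ e + e) (𝔼-complement {p = p} {N = N} (λ G → 𝟙 (does (dec G)))) fail-bound))))
      where
      S : ℚ
      S = 𝔼 p {N} (λ G → 𝟙 (does (dec G)))
      ring : ∀ a s → a - (1ℚ - s) ≡ s - (1ℚ - a)
      ring = solve-∀ ℚ-ring

-- The choice of `K` and of the threshold for `n`.

open Expectation
open Numerics using (reciprocal; archimedean; ceil-sqrt)
open Assembly
open import Data.Nat using (ℕ; _≤_)
open import Data.Rational using (ℚ; 0ℚ; 1ℚ; _*_; _-_; _<_) renaming (_≤_ to _≤ℚ_)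
open import Relation.Unary using (Decidable)
open import Data.Nat as ℕ using (zero; suc)
import Data.Nat.Properties as ℕₚ
open import Data.Rational.Properties using (≤-trans; <⇒≤; +-monoʳ-≤; *-assoc; *-identityˡ; *-comm; neg-antimono-≤)

theorem1p2 : (ε : ℚ) → 0ℚ < ε →
    Σ ℚ λ K → (0ℚ < K) × Σ ℕ λ n₀ → (n : ℕ) → n₀ ≤ n →
    (dec : Decidable (ContainsSqHamCycle {n})) →
    (p : ℚ) → 0ℚ ≤ℚ p → p ≤ℚ 1ℚ → K * K ≤ℚ p * p * ℕtoℚ n →
    1ℚ - ε ≤ℚ Prob n p (ContainsSqHamCycle {n}) dec
theorem1p2 ε 0<ε with small-part 0<ε
-- `M` is at least `1 / e`, and `M * M ≤ n ≤ t * t` gives `M ≤ t`, hence `1 ≤ t * e`. The summand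
-- 200 makes `4 * t < n`.
... | e , 0<e , e+e≤ε , e≤¼ = K , 0<K , 200 ℕ.+ M ℕ.* M , bound
  where
  i : ℚ
  i = proj₁ (reciprocal 0<e)
  ei≡1 : e * i ≡ 1ℚ
  ei≡1 = proj₂ (proj₂ (reciprocal 0<e))
  K : ℚ
  K = i * (ι 128 * ι 2560)
  0<K : 0ℚ < K
  0<K = 0<* (proj₁ (proj₂ (reciprocal 0<e))) (0<* (0<ι 128 (ℕ.s≤s ℕ.z≤n)) (0<ι 2560 (ℕ.s≤s ℕ.z≤n)))
  eK≡ : e * K ≡ ι 128 * ι 2560
  eK≡ = trans (sym (*-assoc e i (ι 128 * ι 2560))) (trans (cong (_* (ι 128 * ι 2560)) ei≡1) (*-identityˡ (ι 128 * ι 2560)))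
  M : ℕ
  M = proj₁ (archimedean i)
  bound : (n : ℕ) → 200 ℕ.+ M ℕ.* M ≤ n → (dec : Decidable (ContainsSqHamCycle {n})) → (p : ℚ) → 0ℚ ≤ℚ p → p ≤ℚ 1ℚ →
    K * K ≤ℚ p * p * ℕtoℚ n → 1ℚ - ε ≤ℚ Prob n p (ContainsSqHamCycle {n}) dec
  bound (suc zero) (ℕ.s≤s ())
  bound (suc (suc m₀)) n₀≤n dec p 0≤p p≤1 K²≤ =
    ≤-trans (+-monoʳ-≤ 1ℚ (neg-antimono-≤ e+e≤ε))
      (Final.prob-bound m₀ {t = t} 0<e 0<K e≤¼ eK≡ 0≤p p≤1 (subst (λ z → K * K ≤ℚ p * p * z) (sym (ι≡ℕtoℚ n)) K²≤)
        (ℕₚ.≤-trans (ℕₚ.m≤m+n 200 (M ℕ.* M)) n₀≤n) n≤t² t²≤4n 1≤te dec)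
    where
    n = 2 ℕ.+ m₀
    root = ceil-sqrt n (ℕ.s≤s ℕ.z≤n)
    t = proj₁ root
    n≤t² = proj₁ (proj₂ root)
    t²≤4n = proj₂ (proj₂ root)
    1≤te : 1ℚ ≤ℚ ι t * e
    1≤te = subst₂ _≤ℚ_ ei≡1 (*-comm e (ι t)) (*-monoˡ (<⇒≤ 0<e)
      (≤-trans (proj₂ (archimedean i)) (ι-mono (sq-cancel-ℕ {M} {t} (ℕₚ.≤-trans (ℕₚ.m≤n+m (M ℕ.* M) 200) (ℕₚ.≤-trans n₀≤n n≤t²))))))
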